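{- Let $\mathcal{A}$ be a hesitant graded alternating tree automaton (HGTA) (resp., a counter-free HGTA) over the alphabet $2^{AP}$. Then one can construct a Counting Computation Dynamic Logic (CCDL) formula (resp., a Counting-CTL* (CCTL*) formula) $\varphi_{\mathcal{A}}$ such that $\mathcal{L}(\varphi_{\mathcal{A}})=\mathcal{L}(\mathcal{A})$. Moreover, $\varphi_{\mathcal{A}}$ is a CDL formula (resp., a CTL* formula) if $\mathcal{A}$ is symmetric.
   Context: Setting. $AP$ is a finite set of atomic propositions. A Kripke tree over $AP$ is a tree (prefix-closed non-empty set of words over some set of directions) in which every node has at least one child, labelled by $Lab:T\to 2^{AP}$. A tree language is a set of such labelled trees. Graded alternating tree automata (GTA). For a finite set $Q$ of states, graded $Q$-constraints are given by $\theta::=\top\mid\bot\mid\theta\vee\theta\mid\theta\wedge\theta\mid \Diamond_k\alpha\mid\Box_k\alpha$, with $k\ge1$ and $\alpha$ a positive Boolean formula over $Q$ (the atoms $\Diamond_k\alpha,\Box_k\alpha$ are the $Q$-atoms; $\Diamond_1,\Box_1$ are written $\Diamond,\Box$). A one-step interpretation $(S,I)$ with $I:S\to 2^Q$ satisfies $\Diamond_k\alpha$ iff at least $k$ elements $s\in S$ have $I(s)\models\alpha$, and $\Box_k\alpha$ iff fewer than $k$ elements $s$ have $I(s)\not\models\alpha$. A parity GTA is $\mathcal{A}=(\Sigma,Q,\delta,q_0,\Omega)$ with $\delta:Q\times\Sigma\to$ graded $Q$-constraints and $\Omega:Q\to\mathbb{N}$ a parity (max-even) condition. A run on a $\Sigma$-labelled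 tree is a $(Q\times T)$-labelled tree whose root is $(q_0,\varepsilon)$ and where for each run node labelled $(q,w)$ there is a one-step interpretation $(S_w,I)$ over the children $S_w$ of $w$ satisfying $\delta(q,Lab(w))$ such that the children of the run node are labelled exactly by the pairs $(q',w')$ with $w'\in S_w$, $q'\in I(w')$; it is accepting if every infinite branch satisfies $\Omega$. $\mathcal{A}$ is symmetric if all its atoms are of the form $\Diamond\alpha$ or $\Box\alpha$. $Atoms(\mathcal{A})$ denotes the set of $Q$-atoms occurring in $\delta$; for a set $A$ of atoms, $Con(A)$ (resp. $Dis(A)$) is their conjunction (resp. disjunction). For a graded constraint $\theta$, $\mathcal{A}^{\theta}$ is the automaton obtained from $\mathcal{A}$ by adding a fresh initial state $\theta$ of highest order with $\delta(\theta,a)=\theta$ for all $a$; $\mathcal{A}^{q}$ is $\mathcal{A}$ with initial state $q$. Hesitant GTA (HGTA). An HGTA additionally has an ordered partition $\langle Q_1,\dots,Q_n\rangle$ of $Q$ into components, each transient, existential or universal, such that: for transient $Q_i$, $\delta(q,a)$ mentions only states in $Q_j$, $j<i$; for existential $Q_i$, $\delta(q,a)$ is a disjunction of conjunctions $\Diamond q'\wedge Con(A)$ with $q'\in Q_i$ and atoms of $A$ only referring to states of order $<i$; for universal $Q_i$, $\delta(q,a)$ is a conjunction of disjunctions $\Box q'\vee Dis(A)$ with the same conditions; and $\Omega$ restricted to an existential (resp. universal) component is a Büchi (resp. co-Büchi) condition. For a non-transient $Q_i$ and $q\in Q_i$, the linearization word automaton $\mathcal{A}_{Q_i,q}$ is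 the nondeterministic word automaton with states $Q_i$, initial state $q$, acceptance $\Omega$ restricted to $Q_i$, over letters $(a,A)\in\Sigma\times 2^{Atoms(\mathcal{A})}$, with $q''\in\delta_{Q_i}(q',(a,A))$ iff $\Diamond q''\wedge Con(A)$ is a disjunct of the DNF of $\delta(q',a)$ (existential case), resp. $\Box q''\vee Dis(A)$ is a conjunct of the CNF of $\delta(q',a)$ (universal case); $\Upsilon_{Q_i}$ is the set of $A$ actually used in such transitions. A word automaton is counter-free if for all $n>0$, states $q$ and finite words $\rho$, a path from $q$ to $q$ over $\rho^n$ implies a path from $q$ to $q$ over $\rho$. An HGTA satisfies the mutual-exclusion property if for each non-transient $Q_i$ and distinct $A,A'\in\Upsilon_{Q_i}$ there are atoms $\mathsf{atom}\in A$, $\mathsf{atom}'\in A'$ with $\mathcal{L}(\mathcal{A}^{\mathsf{atom}})$ the complement of $\mathcal{L}(\mathcal{A}^{\mathsf{atom}'})$. A counter-free HGTA is an HGTA whose linearization automata are all counter-free and which satisfies the mutual-exclusion property. Logics. CCTL* state formulae: $\varphi::=\top\mid p\mid\neg\varphi\mid\varphi\wedge\varphi\mid E\psi\mid D^n\varphi$ ($n\ge1$); path formulae: $\psi::=\varphi\mid\neg\psi\mid\psi\wedge\psi\mid X\psi\mid\psi U\psi$, with the usual semantics, $E$ quantifying over infinite paths from the current node and $D^n\varphi$ meaning at least $n$ distinct children satisfy $\varphi$. CTL* is the fragment with no $D^n$, $n>1$. CCDL has the same state formulae but path formulae $\psi::=\varphi\mid\neg\psi\mid\psi\wedge\psi\mid\langle\mathcal{B}\rangle\psi$,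 where $\mathcal{B}$ is a testing nondeterministic finite-word automaton over $2^{AP}$ with a test function $\tau$ mapping states to CCDL path formulae; $\langle\mathcal{B}\rangle\psi$ holds at position $i$ of a path $\pi$ iff for some $j\ge i$ there is an accepting run $q_i\dots q_j$ of $\mathcal{B}$ on $Lab(\pi(i))\dots Lab(\pi(j-1))$ with $\tau(q_k)$ holding at position $k$ for all $k\in[i,j]$, and $\psi$ holds at $j$. CDL is the fragment with no $D^n$, $n>1$. $\mathcal{L}(\varphi)$ is the set of Kripke trees whose root satisfies $\varphi$. -}

module Defs where

open import Level using (Level) renaming (suc to lsuc; zero to 0ℓ)
open import Data.Nat using (ℕ; zero; suc; _≤_; _<_)
open import Data.Nat.Divisibility using (_∣_)
open import Data.Bool using (Bool; true; false)
open import Data.Fin using (Fin) renaming (zero to fz; suc to fs; _<_ to _<ᶠ_)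
open import Data.Fin.Subset using (Subset; _∈_)
open import Data.List using (List; []; _∷_; map; concat; replicate)
import Data.List.Membership.Propositional as LM
open import Data.List.Relation.Binary.Subset.Propositional using (_⊆_)
open import Data.List.Relation.Unary.All using (All)
open import Data.Product using (Σ; Σ-syntax; _×_; _,_; proj₁; proj₂)
open import Data.Sum using (_⊎_)
open import Data.Unit using (⊤)
open import Data.Empty using (⊥)
open import Relation.Nullary using (¬_)
open import Relation.Binary.PropositionalEquality using (_≡_; _≢_)
open import Function.Definitions using (Injective)

Even : ℕ → Set
Even p = 2 ∣ p

Odd : ℕ → Set
Odd p = ¬ Even p

_⇔_ : Set → Set → Set
P ⇔ Q = (P → Q) × (Q → P)

_≈ˢ_ : {A : Set} → List A → List A → Set
xs ≈ˢ ys = (xs ⊆ ys) × (ys ⊆ xs)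

-- Kripke trees over AP = Fin m, labels in 2^AP = Subset m.
-- A word d₁…dₖ over the direction set Dir is represented by the list
-- dₖ ∷ … ∷ d₁ ∷ [] (reversed), so the children of w are the d ∷ w.

record KTree (m : ℕ) : Set₁ where
  field
    Dir    : Set
    Node   : List Dir → Set
    root   : Node []
    prefix : ∀ d w → Node (d ∷ w) → Node w
    serial : ∀ w → Node w → Σ[ d ∈ Dir ] Node (d ∷ w)
    lab    : List Dir → Subset m                     -- Lab (relevant on nodes)

module _ {m : ℕ} (t : KTree m) where
  open KTree t

  AtLeast : List Dir → ℕ → (Dir → Set) → Set
  AtLeast w k P = Σ[ f ∈ (Fin k → Dir) ] (Injective _≡_ _≡_ f ×
                    (∀ i → Node (f i ∷ w) × P (f i)))

  record IPath : Set where
    field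
      π     : ℕ → List Dir
      π-ok  : Node (π 0)
      step  : ∀ i → Σ[ d ∈ Dir ] (π (suc i) ≡ d ∷ π i × Node (π (suc i)))

-- Syntax of (the union of) CCTL* and CCDL.
-- D[1+ k ] φ  stands for  D^(k+1) φ   (so the grade is always ≥ 1).
-- A testing automaton: nondeterministic finite-word automaton over 2^AP
-- with k states, initial states, transitions, final states and a test
-- function τ into path formulae.

record TestAut (m : ℕ) (P : Set) : Set where
  constructor mkTA
  field
    k     : ℕ
    init  : Fin k → Bool
    trans : Fin k → Subset m → Fin k → Bool
    final : Fin k → Bool
    τ     : Fin k → P

data SF (m : ℕ) : Set
data PF (m : ℕ) : Set

data SF m where
  ⊤ˢ     : SF m
  prop   : Fin m → SF m
  ¬ˢ_    : SF m → SF m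
  _∧ˢ_   : SF m → SF m → SF m
  E      : PF m → SF m
  D[1+_] : ℕ → SF m → SF m

data PF m where
  st    : SF m → PF m
  ¬ᵖ_   : PF m → PF m
  _∧ᵖ_  : PF m → PF m → PF m
  X     : PF m → PF m
  _U_   : PF m → PF m → PF m
  ⟨_⟩_  : TestAut m (PF m) → PF m → PF m

NoCountS : ∀ {m} → SF m → Set
NoCountP : ∀ {m} → PF m → Set
NoCountS ⊤ˢ = ⊤
NoCountS (prop _) = ⊤
NoCountS (¬ˢ φ) = NoCountS φ
NoCountS (φ ∧ˢ ψ) = NoCountS φ × NoCountS ψ
NoCountS (E ψ) = NoCountP ψ
NoCountS (D[1+ k ] φ) = (k ≡ 0) × NoCountS φ
NoCountP (st φ) = NoCountS φ
NoCountP (¬ᵖ ψ) = NoCountP ψ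
NoCountP (ψ ∧ᵖ χ) = NoCountP ψ × NoCountP χ
NoCountP (X ψ) = NoCountP ψ
NoCountP (ψ U χ) = NoCountP ψ × NoCountP χ
NoCountP (⟨ mkTA k i Δ F τ ⟩ ψ) = (∀ q → NoCountP (τ q)) × NoCountP ψ

TemporalS : ∀ {m} → SF m → Set
TemporalP : ∀ {m} → PF m → Set
TemporalS ⊤ˢ = ⊤
TemporalS (prop _) = ⊤
TemporalS (¬ˢ φ) = TemporalS φ
TemporalS (φ ∧ˢ ψ) = TemporalS φ × TemporalS ψ
TemporalS (E ψ) = TemporalP ψ
TemporalS (D[1+ k ] φ) = TemporalS φ
TemporalP (st φ) = TemporalS φ
TemporalP (¬ᵖ ψ) = TemporalP ψ
TemporalP (ψ ∧ᵖ χ) = TemporalP ψ × TemporalP χ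
TemporalP (X ψ) = TemporalP ψ
TemporalP (ψ U χ) = TemporalP ψ × TemporalP χ
TemporalP (⟨ _ ⟩ _) = ⊥

DynamicS : ∀ {m} → SF m → Set
DynamicP : ∀ {m} → PF m → Set
DynamicS ⊤ˢ = ⊤
DynamicS (prop _) = ⊤
DynamicS (¬ˢ φ) = DynamicS φ
DynamicS (φ ∧ˢ ψ) = DynamicS φ × DynamicS ψ
DynamicS (E ψ) = DynamicP ψ
DynamicS (D[1+ k ] φ) = DynamicS φ
DynamicP (st φ) = DynamicS φ
DynamicP (¬ᵖ ψ) = DynamicP ψ
DynamicP (ψ ∧ᵖ χ) = DynamicP ψ × DynamicP χ
DynamicP (X ψ) = ⊥
DynamicP (ψ U χ) = ⊥
DynamicP (⟨ mkTA k i Δ F τ ⟩ ψ) = (∀ q → DynamicP (τ q)) × DynamicP ψ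

IsCCTL* : ∀ {m} → SF m → Set
IsCCTL* φ = TemporalS φ

IsCTL* : ∀ {m} → SF m → Set
IsCTL* φ = TemporalS φ × NoCountS φ

IsCCDL : ∀ {m} → SF m → Set
IsCCDL φ = DynamicS φ

IsCDL : ∀ {m} → SF m → Set
IsCDL φ = DynamicS φ × NoCountS φ

module _ {m : ℕ} (t : KTree m) where
  open KTree t

  _⊨ˢ_ : List Dir → SF m → Set
  _,_⊨ᵖ_ : IPath t → ℕ → PF m → Set

  w ⊨ˢ ⊤ˢ = ⊤
  w ⊨ˢ prop p = p ∈ lab w
  w ⊨ˢ (¬ˢ φ) = ¬ (w ⊨ˢ φ)
  w ⊨ˢ (φ ∧ˢ ψ) = (w ⊨ˢ φ) × (w ⊨ˢ ψ)
  w ⊨ˢ E ψ = Σ[ ρ ∈ IPath t ] (IPath.π ρ 0 ≡ w × (ρ , 0 ⊨ᵖ ψ))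
  w ⊨ˢ D[1+ k ] φ = AtLeast t w (suc k) (λ d → (d ∷ w) ⊨ˢ φ)

  ρ , i ⊨ᵖ st φ = IPath.π ρ i ⊨ˢ φ
  ρ , i ⊨ᵖ (¬ᵖ ψ) = ¬ (ρ , i ⊨ᵖ ψ)
  ρ , i ⊨ᵖ (ψ ∧ᵖ χ) = (ρ , i ⊨ᵖ ψ) × (ρ , i ⊨ᵖ χ)
  ρ , i ⊨ᵖ X ψ = ρ , suc i ⊨ᵖ ψ
  ρ , i ⊨ᵖ (ψ U χ) = Σ[ j ∈ ℕ ] (i ≤ j × (ρ , j ⊨ᵖ χ) ×
                       (∀ l → i ≤ l → l < j → ρ , l ⊨ᵖ ψ))
  ρ , i ⊨ᵖ (⟨ mkTA k init trans final τ ⟩ ψ) =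
    Σ[ j ∈ ℕ ] (i ≤ j × Σ[ r ∈ (ℕ → Fin k) ] (
      init (r i) ≡ true ×
      (∀ l → i ≤ l → l < j →
         trans (r l) (lab (IPath.π ρ l)) (r (suc l)) ≡ true) ×
      final (r j) ≡ true ×
      (∀ l → i ≤ l → l ≤ j → ρ , l ⊨ᵖ τ (r l)) ×
      (ρ , j ⊨ᵖ ψ)))

_⊨_ : ∀ {m} → KTree m → SF m → Set
t ⊨ φ = _⊨ˢ_ t [] φ

-- Graded alternating tree automata over Σ = 2^AP = Subset m, Q = Fin n.

data PBF (n : ℕ) : Set where
  tt ff : PBF n
  var   : Fin n → PBF n
  _∧ᵇ_ _∨ᵇ_ : PBF n → PBF n → PBF n

_⊨ᵇ_ : ∀ {n} → Subset n → PBF n → Set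
I ⊨ᵇ tt = ⊤
I ⊨ᵇ ff = ⊥
I ⊨ᵇ var q = q ∈ I
I ⊨ᵇ (α ∧ᵇ β) = (I ⊨ᵇ α) × (I ⊨ᵇ β)
I ⊨ᵇ (α ∨ᵇ β) = (I ⊨ᵇ α) ⊎ (I ⊨ᵇ β)

-- Q-atoms:  ◇[1+ k ] α  is  ◇_(k+1) α ,  □[1+ k ] α  is  □_(k+1) α
data Atom (n : ℕ) : Set where
  ◇[1+_]_ : ℕ → PBF n → Atom n
  □[1+_]_ : ℕ → PBF n → Atom n

data GC (n : ℕ) : Set where
  ⊤ᶜ ⊥ᶜ : GC n
  _∨ᶜ_ _∧ᶜ_ : GC n → GC n → GC n
  at : Atom n → GC n

MentionsB : ∀ {n} → Fin n → PBF n → Set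
MentionsB q tt = ⊥
MentionsB q ff = ⊥
MentionsB q (var q') = q ≡ q'
MentionsB q (α ∧ᵇ β) = MentionsB q α ⊎ MentionsB q β
MentionsB q (α ∨ᵇ β) = MentionsB q α ⊎ MentionsB q β

MentionsA : ∀ {n} → Fin n → Atom n → Set
MentionsA q (◇[1+ k ] α) = MentionsB q α
MentionsA q (□[1+ k ] α) = MentionsB q α

MentionsC : ∀ {n} → Fin n → GC n → Set
MentionsC q ⊤ᶜ = ⊥
MentionsC q ⊥ᶜ = ⊥
MentionsC q (θ ∨ᶜ η) = MentionsC q θ ⊎ MentionsC q η
MentionsC q (θ ∧ᶜ η) = MentionsC q θ ⊎ MentionsC q η
MentionsC q (at x) = MentionsA q x

AtomIn : ∀ {n} → Atom n → GC n → Set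
AtomIn x ⊤ᶜ = ⊥
AtomIn x ⊥ᶜ = ⊥
AtomIn x (θ ∨ᶜ η) = AtomIn x θ ⊎ AtomIn x η
AtomIn x (θ ∧ᶜ η) = AtomIn x θ ⊎ AtomIn x η
AtomIn x (at y) = x ≡ y

Con : ∀ {n} → List (Atom n) → GC n
Con [] = ⊤ᶜ
Con (x ∷ xs) = at x ∧ᶜ Con xs

Dis : ∀ {n} → List (Atom n) → GC n
Dis [] = ⊥ᶜ
Dis (x ∷ xs) = at x ∨ᶜ Dis xs

renB : ∀ {n n'} → (Fin n → Fin n') → PBF n → PBF n'
renB f tt = tt
renB f ff = ff
renB f (var q) = var (f q)
renB f (α ∧ᵇ β) = renB f α ∧ᵇ renB f β
renB f (α ∨ᵇ β) = renB f α ∨ᵇ renB f β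

renA : ∀ {n n'} → (Fin n → Fin n') → Atom n → Atom n'
renA f (◇[1+ k ] α) = ◇[1+ k ] renB f α
renA f (□[1+ k ] α) = □[1+ k ] renB f α

renC : ∀ {n n'} → (Fin n → Fin n') → GC n → GC n'
renC f ⊤ᶜ = ⊤ᶜ
renC f ⊥ᶜ = ⊥ᶜ
renC f (θ ∨ᶜ η) = renC f θ ∨ᶜ renC f η
renC f (θ ∧ᶜ η) = renC f θ ∧ᶜ renC f η
renC f (at x) = at (renA f x)

record GTA (m n : ℕ) : Set where
  field
    δ  : Fin n → Subset m → GC n
    q₀ : Fin n
    Ω  : Fin n → ℕ

module _ {m : ℕ} (t : KTree m) where
  open KTree t

  SatA : ∀ {n} → List Dir → (Dir → Subset n) → Atom n → Set
  SatA w I (◇[1+ k ] α) = AtLeast t w (suc k) (λ d → I d ⊨ᵇ α)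
  SatA w I (□[1+ k ] α) = ¬ AtLeast t w (suc k) (λ d → ¬ (I d ⊨ᵇ α))

  SatC : ∀ {n} → List Dir → (Dir → Subset n) → GC n → Set
  SatC w I ⊤ᶜ = ⊤
  SatC w I ⊥ᶜ = ⊥
  SatC w I (θ ∨ᶜ η) = SatC w I θ ⊎ SatC w I η
  SatC w I (θ ∧ᶜ η) = SatC w I θ × SatC w I η
  SatC w I (at x) = SatA w I x

ParityOK : (ℕ → ℕ) → Set
ParityOK c = Σ[ p ∈ ℕ ] (Even p ×
               (Σ[ N ∈ ℕ ] (∀ i → N ≤ i → c i ≤ p)) ×
               (∀ N → Σ[ i ∈ ℕ ] (N ≤ i × c i ≡ p)))

-- Runs.  A run node is represented by the (reversed) list of
-- (state, direction) steps leading to it from the root (q₀, ε); its label is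
-- (its last state, the word of its directions).  A run is given by the
-- one-step interpretation I chosen at every run node: the children of a
-- run node labelled (q, w) are exactly the (q', d ∷ w) with d ∷ w ∈ T and
-- q' ∈ I d.
module _ {m n : ℕ} (A : GTA m n) (t : KTree m) where
  open GTA A
  open KTree t

  RNode : Set
  RNode = List (Fin n × Dir)

  rstate : RNode → Fin n
  rstate [] = q₀
  rstate ((q , _) ∷ _) = q

  rword : RNode → List Dir
  rword = map proj₂

  record Run : Set where
    field
      interp : RNode → Dir → Subset n

    ValidRN : RNode → Set
    ValidRN [] = ⊤
    ValidRN ((q , d) ∷ r) = ValidRN r × Node (d ∷ rword r) × q ∈ interp r d

  branchNode : (ℕ → Fin n × Dir) → ℕ → RNode
  branchNode s zero = []
  branchNode s (suc i) = s i ∷ branchNode s i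

  Accepting : Run → Set
  Accepting R =
    (∀ r → Run.ValidRN R r →
       SatC t (rword r) (Run.interp R r) (δ (rstate r) (lab (rword r)))) ×
    (∀ s → (∀ i → Run.ValidRN R (branchNode s i)) →
       ParityOK (λ i → Ω (rstate (branchNode s i))))

Accepts : ∀ {m n} → GTA m n → KTree m → Set
Accepts A t = Σ[ R ∈ Run A t ] Accepting A t R

SameLang : ∀ {m n} → SF m → GTA m n → Set₁
SameLang {m} φ A = (t : KTree m) → (t ⊨ φ) ⇔ Accepts A t

withConstraint : ∀ {m n} → GTA m n → GC n → GTA m (suc n)
withConstraint {m} {n} A θ = record
  { δ  = δ'
  ; q₀ = fz
  ; Ω  = Ω'
  }
  where
    open GTA A
    δ' : Fin (suc n) → Subset m → GC (suc n)
    δ' fz a = renC fs θ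
    δ' (fs q) a = renC fs (δ q a)
    Ω' : Fin (suc n) → ℕ
    Ω' fz = 0
    Ω' (fs q) = Ω q

IsK1 : ∀ {n} → Atom n → Set
IsK1 (◇[1+ k ] α) = k ≡ 0
IsK1 (□[1+ k ] α) = k ≡ 0

data Kind : Set where
  transient existential universal : Kind

DisE : ∀ {n} → List (Fin n × List (Atom n)) → GC n
DisE [] = ⊥ᶜ
DisE ((q , As) ∷ L) = (at (◇[1+ 0 ] var q) ∧ᶜ Con As) ∨ᶜ DisE L

ConU : ∀ {n} → List (Fin n × List (Atom n)) → GC n
ConU [] = ⊤ᶜ
ConU ((q , As) ∷ L) = (at (□[1+ 0 ] var q) ∨ᶜ Dis As) ∧ᶜ ConU L

record HGTA (m n : ℕ) : Set where
  field
    gta  : GTA m n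
    c    : ℕ
    comp : Fin n → Fin c          -- q ∈ Q_(comp q); the order is that of Fin c
    kind : Fin c → Kind
  open GTA gta

  WellScoped : Fin c → Fin n × List (Atom n) → Set
  WellScoped i (q' , As) =
    comp q' ≡ i × All (λ x → ∀ q'' → MentionsA q'' x → comp q'' <ᶠ i) As

  field
    transientC : ∀ q a → kind (comp q) ≡ transient →
                 ∀ q' → MentionsC q' (δ q a) → comp q' <ᶠ comp q
    existentialC : ∀ q a → kind (comp q) ≡ existential →
                 Σ[ L ∈ List (Fin n × List (Atom n)) ]
                   (δ q a ≡ DisE L × All (WellScoped (comp q)) L)
    universalC : ∀ q a → kind (comp q) ≡ universal →
                 Σ[ L ∈ List (Fin n × List (Atom n)) ]
                   (δ q a ≡ ConU L × All (WellScoped (comp q)) L)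
    -- Büchi (priorities {o, o+1}, o odd) on existential components,
    -- co-Büchi (priorities {e, e+1}, e even) on universal components
    existentialΩ : ∀ i → kind i ≡ existential →
                 Σ[ o ∈ ℕ ] (Odd o × (∀ q → comp q ≡ i → (Ω q ≡ o ⊎ Ω q ≡ suc o)))
    universalΩ : ∀ i → kind i ≡ universal →
                 Σ[ e ∈ ℕ ] (Even e × (∀ q → comp q ≡ i → (Ω q ≡ e ⊎ Ω q ≡ suc e)))

module _ {m n : ℕ} (H : HGTA m n) where
  open HGTA H
  open GTA gta

  Letter : Set
  Letter = Subset m × List (Atom n)

  -- transitions of the linearization word automaton A_(Q_i, -)
  -- (the atom-set component of letters is compared as a set)
  LinTrans : Fin c → Fin n → Letter → Fin n → Set
  LinTrans i q' (a , As) q'' = comp q' ≡ i ×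
    ((kind i ≡ existential × Σ[ L ∈ List (Fin n × List (Atom n)) ]
        (δ q' a ≡ DisE L × Σ[ As' ∈ List (Atom n) ] ((q'' , As') LM.∈ L × As' ≈ˢ As)))
     ⊎
     (kind i ≡ universal × Σ[ L ∈ List (Fin n × List (Atom n)) ]
        (δ q' a ≡ ConU L × Σ[ As' ∈ List (Atom n) ] ((q'' , As') LM.∈ L × As' ≈ˢ As))))

  data LinPath (i : Fin c) : Fin n → List Letter → Fin n → Set where
    []  : ∀ {q} → LinPath i q [] q
    _∷_ : ∀ {q q' q'' x w} → LinTrans i q x q' → LinPath i q' w q'' →
          LinPath i q (x ∷ w) q''

  Used : Fin c → List (Atom n) → Set
  Used i As = Σ[ q' ∈ Fin n ] Σ[ a ∈ Subset m ] Σ[ q'' ∈ Fin n ] LinTrans i q' (a , As) q''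

  CounterFreeLin : Set
  CounterFreeLin = ∀ i → kind i ≢ transient → ∀ q → comp q ≡ i →
    ∀ k (ρ : List Letter) → LinPath i q (concat (replicate (suc k) ρ)) q →
    LinPath i q ρ q

  MutualExclusion : Set₁
  MutualExclusion = ∀ i → kind i ≢ transient → ∀ As As' →
    Used i As → Used i As' → ¬ (As ≈ˢ As') →
    Σ[ x ∈ Atom n ] Σ[ x' ∈ Atom n ] (x LM.∈ As × x' LM.∈ As' ×
      ((t : KTree m) → Accepts (withConstraint gta (at x)) t ⇔
                       (¬ Accepts (withConstraint gta (at x')) t)))

  CounterFree : Set₁
  CounterFree = CounterFreeLin × MutualExclusion

  Symmetric : Set
  Symmetric = ∀ q a x → AtomIn x (δ q a) → IsK1 x

{-# OPTIONS --safe #-}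

-- For each state q, by induction on the component order, a formula φ q is built that holds exactly at
-- the nodes accepted from q. A transient state is unfolded once. In an existential component
-- acceptance means that some path carries an accepting run of the linearization whose atoms hold
-- along the path; a universal component is rejected exactly when some path carries a run of the
-- linearization whose atoms all fail and whose states violate the co-Büchi condition. Büchi
-- acceptance is expressed through factors of the word of transition matrices (Ramsey), so that it
-- only remains to define "some later position is reached by a factor of value x, and ψ holds there".
-- Testing automata do this directly. In the counter-free case mutual exclusion makes each position
-- carry a letter of the linearization, whose transition monoid is aperiodic, and the
-- local divisor argument of Diekert and Gastin gives a temporal formula.
module Submission where

open import Defs
open import Level using () renaming (suc to lsuc; zero to 0ℓ)
import Level
open import Axiom.ExcludedMiddle using (ExcludedMiddle)
open import Data.Nat using (ℕ; zero; suc; _≤_; _<_; _≤′_; ≤′-refl; ≤′-step; _+_; _*_; _∸_; _⊔_; z≤n; s≤s; s≤s⁻¹)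
import Data.Nat.Properties as ℕₚ
open import Data.Nat.Divisibility using (∣m+n∣m⇒∣n; ∣1⇒≡1)
open import Data.Bool using (Bool; true; false)
open import Data.Fin using (Fin; toℕ; combine; remQuot) renaming (zero to fz; suc to fs; _<_ to _<ᶠ_)
import Data.Fin.Properties as Finₚ
open import Data.Fin.Subset using (Subset; _∈_)
open import Data.List using (List; []; _∷_; length; map; _++_; concat; replicate; allFin)
open import Data.List.Properties using (map-++; map-injective)
import Data.List.Membership.Propositional as LM
import Data.List.Membership.Propositional.Properties as LMₚ
open import Data.List.Relation.Unary.All as All using (All; []; _∷_)
open import Data.List.Relation.Unary.Any using (Any; here; there)
open import Data.Maybe using (Maybe; just; nothing)
open import Data.Maybe.Properties using (just-injective)
open import Data.Vec using (Vec; []; _∷_; lookup; tabulate)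
import Data.Vec.Properties as Vecₚ
open import Data.Product using (Σ; Σ-syntax; _×_; _,_; proj₁; proj₂)
open import Data.Sum using (_⊎_; inj₁; inj₂; [_,_]′)
open import Data.Unit using (⊤; tt)
open import Data.Empty using (⊥; ⊥-elim)
open import Relation.Nullary using (¬_; Dec; yes; no)
open import Relation.Nullary.Decidable using (⌊_⌋; map′)
open import Relation.Binary using (tri<; tri≈; tri>)
open import Relation.Binary.PropositionalEquality

record Finite (A : Set) : Set where
  field
    size      : ℕ
    enum      : Fin size → A
    code      : A → Fin size
    enum-code : ∀ x → enum (code x) ≡ x

Finite-Fin : ∀ n → Finite (Fin n)
Finite-Fin n = record { size = n ; enum = λ x → x ; code = λ x → x ; enum-code = λ _ → refl }

Finite-Bool : Finite Bool
Finite-Bool = record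
  { size = 2
  ; enum = λ { fz → false ; (fs _) → true }
  ; code = λ { false → fz ; true → fs fz }
  ; enum-code = λ { false → refl ; true → refl } }

Finite-× : ∀ {A B} → Finite A → Finite B → Finite (A × B)
Finite-× {A} {B} fX fY = record
  { size = FX.size * FY.size
  ; enum = dec
  ; code = λ (x , y) → combine (FX.code x) (FY.code y)
  ; enum-code = λ (x , y) → trans
      (cong (λ (a , b) → FX.enum a , FY.enum b) (Finₚ.remQuot-combine (FX.code x) (FY.code y)))
      (cong₂ _,_ (FX.enum-code x) (FY.enum-code y)) }
  where
    module FX = Finite fX
    module FY = Finite fY
    dec : Fin (FX.size * FY.size) → A × B
    dec k = let (a , b) = remQuot FY.size k in FX.enum a , FY.enum b

Finite-surj : ∀ {A B} (f : A → B) (g : B → A) → (∀ y → f (g y) ≡ y) → Finite A → Finite B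
Finite-surj f g fg fX = record
  { size = size ; enum = λ k → f (enum k) ; code = λ y → code (g y)
  ; enum-code = λ y → trans (cong f (enum-code (g y))) (fg y) }
  where open Finite fX

Finite-Vec : ∀ {A} n → Finite A → Finite (Vec A n)
Finite-Vec zero    fX = Finite-surj (λ _ → []) (λ _ → fz) (λ { [] → refl }) (Finite-Fin 1)
Finite-Vec (suc n) fX = Finite-surj (λ (x , v) → x ∷ v) (λ { (x ∷ v) → x , v }) (λ { (x ∷ v) → refl })
                          (Finite-× fX (Finite-Vec n fX))

delete : ∀ {A : Set} {x : A} {xs} → x LM.∈ xs →
         Σ[ ys ∈ List A ] (length xs ≡ suc (length ys) × (∀ {y} → y LM.∈ xs → y ≢ x → y LM.∈ ys))
delete {xs = _ ∷ xs} (here refl) = xs , refl , λ { (here eq) ne → ⊥-elim (ne eq) ; (there m) _ → m }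
delete {xs = z ∷ _} (there m) with delete m
... | ys , eq , f = z ∷ ys , cong suc eq , λ { (here e) _ → here e ; (there k) ne → there (f k ne) }

⇔-sym : ∀ {P Q : Set} → P ⇔ Q → Q ⇔ P
⇔-sym (f , g) = g , f

⇔-trans : ∀ {P Q R : Set} → P ⇔ Q → Q ⇔ R → P ⇔ R
⇔-trans (f , g) (f' , g') = (λ x → f' (f x)) , (λ x → g (g' x))

Vec-ext : ∀ {B : Set} {n} {u v : Vec B n} → (∀ i → lookup u i ≡ lookup v i) → u ≡ v
Vec-ext {u = u} {v} h = trans (sym (Vecₚ.tabulate∘lookup u)) (trans (Vecₚ.tabulate-cong h) (Vecₚ.tabulate∘lookup v))

bool-≡ : ∀ {b c} → (b ≡ true) ⇔ (c ≡ true) → b ≡ c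
bool-≡ {false} {false} _ = refl
bool-≡ {true}  {true}  _ = refl
bool-≡ {false} {true}  (f , g) = g refl
bool-≡ {true}  {false} (f , g) = sym (f refl)

EM₀ : Set₁
EM₀ = ∀ {P : Set} → Dec P

module Classical (em : EM₀) where

  dne : ∀ {P : Set} → ¬ ¬ P → P
  dne {P} nn with em {P}
  ... | yes p = p
  ... | no np = ⊥-elim (nn np)

  bool : Set → Bool
  bool P = ⌊ em {P} ⌋

  bool⁻ : ∀ {P} → bool P ≡ true → P
  bool⁻ {P} eq with em {P}
  bool⁻ eq | yes p = p
  bool⁻ () | no _

  bool⁺ : ∀ {P} → P → bool P ≡ true
  bool⁺ {P} p with em {P}
  ... | yes _ = refl
  ... | no np = ⊥-elim (np p)

  ¬∀⇒∃¬ : ∀ {A : Set} {P : A → Set} → ¬ (∀ x → P x) → Σ[ x ∈ A ] ¬ P x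
  ¬∀⇒∃¬ {A} {P} nf with em {Σ[ x ∈ A ] ¬ P x}
  ... | yes w = w
  ... | no nw = ⊥-elim (nf λ x → dne λ np → nw (x , np))

  setOf : ∀ {n} → (Fin n → Set) → Subset n
  setOf P = tabulate (λ q → bool (P q))

  ∈-setOf⁺ : ∀ {n} {P : Fin n → Set} {q} → P q → q ∈ setOf P
  ∈-setOf⁺ {P = P} {q} p = Vecₚ.lookup⇒[]= q (setOf P) (trans (Vecₚ.lookup∘tabulate _ q) (bool⁺ p))

  ∈-setOf⁻ : ∀ {n} {P : Fin n → Set} {q} → q ∈ setOf P → P q
  ∈-setOf⁻ {P = P} {q} m = bool⁻ (trans (sym (Vecₚ.lookup∘tabulate _ q)) (Vecₚ.[]=⇒lookup m))

Pred : Set₁ → Set₁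
Pred Path = Path → ℕ → Set

module _ {Path : Set₁} where

  Until : Pred Path → Pred Path → Pred Path
  Until P Q p i = Σ[ j ∈ ℕ ] (i ≤ j × Q p j × (∀ l → i ≤ l → l < j → P p l))

  record Closed (𝒟 : Pred Path → Set₁) : Set₁ where
    field
      iff-closed : ∀ {P Q} → (∀ p i → P p i ⇔ Q p i) → 𝒟 P → 𝒟 Q
      true-closed : 𝒟 (λ _ _ → ⊤)
      neg  : ∀ {P} → 𝒟 P → 𝒟 (λ p i → ¬ P p i)
      conj : ∀ {P Q} → 𝒟 P → 𝒟 Q → 𝒟 (λ p i → P p i × Q p i)

  module ClosedProps (em : EM₀) {𝒟 : Pred Path → Set₁} (cl : Closed 𝒟) where
    open Closed cl public
    open Classical em

    const : ∀ (C : Set) → 𝒟 (λ _ _ → C)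
    const C with em {C}
    ... | yes c = iff-closed (λ _ _ → (λ _ → c) , (λ _ → tt)) true-closed
    ... | no nc = iff-closed (λ _ _ → (λ n → ⊥-elim (n tt)) , (λ c → ⊥-elim (nc c))) (neg true-closed)

    disj : ∀ {P Q} → 𝒟 P → 𝒟 Q → 𝒟 (λ p i → P p i ⊎ Q p i)
    disj {P} {Q} dP dQ = iff-closed eqv (neg (conj (neg dP) (neg dQ)))
      where
        eqv : ∀ p i → (¬ (¬ P p i × ¬ Q p i)) ⇔ (P p i ⊎ Q p i)
        eqv p i = (λ n → dne λ m → n ((λ x → m (inj₁ x)) , (λ x → m (inj₂ x))))
                , [ (λ x (a , b) → a x) , (λ x (a , b) → b x) ]′

    ∃Fin : ∀ {k} {P : Fin k → Pred Path} → (∀ c → 𝒟 (P c)) → 𝒟 (λ p i → Σ[ c ∈ Fin k ] P c p i)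
    ∃Fin {zero}  dP = iff-closed (λ _ _ → ⊥-elim , λ ()) (const ⊥)
    ∃Fin {suc k} dP = iff-closed (λ p i → [ (λ x → fz , x) , (λ (c , x) → fs c , x) ]′
                                  , λ { (fz , x) → inj₁ x ; (fs c , x) → inj₂ (c , x) })
                       (disj (dP fz) (∃Fin (λ c → dP (fs c))))

    ∃fin : ∀ {A} → Finite A → {P : A → Pred Path} → (∀ x → 𝒟 (P x)) → 𝒟 (λ p i → Σ[ x ∈ A ] P x p i)
    ∃fin fX {P} dP = iff-closed (λ p i → (λ (c , x) → enum c , x)
                                 , λ (x , w) → code x , subst (λ y → P y p i) (sym (enum-code x)) w)
                       (∃Fin (λ c → dP (enum c)))
      where open Finite fX

    ∀fin : ∀ {A} → Finite A → {P : A → Pred Path} → (∀ x → 𝒟 (P x)) → 𝒟 (λ p i → ∀ x → P x p i)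
    ∀fin fX {P} dP = iff-closed (λ p i → (λ n x → dne λ np → n (x , np)) , (λ f (x , np) → np (f x)))
                       (neg (∃fin fX (λ x → neg (dP x))))

-- Factors and local divisors

data Seg {A : Set} (_·_ : A → A → A) (e : A) (β : A → ℕ → Set) : ℕ → A → ℕ → Set where
  nil  : ∀ {i} → Seg _·_ e β i e i
  cons : ∀ {i x y j} → β x i → Seg _·_ e β (suc i) y j → Seg _·_ e β i (x · y) j

module _ {A : Set} {_·_ : A → A → A} {e : A} {β : A → ℕ → Set} where

  Seg-≤ : ∀ {i x j} → Seg _·_ e β i x j → i ≤ j
  Seg-≤ nil = ℕₚ.≤-refl
  Seg-≤ (cons _ s) = ℕₚ.<⇒≤ (Seg-≤ s)

  Seg-map : ∀ {β' : A → ℕ → Set} → (∀ {x i} → β x i → β' x i) → ∀ {i x j} →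
            Seg _·_ e β i x j → Seg _·_ e β' i x j
  Seg-map f nil = nil
  Seg-map f (cons b s) = cons (f b) (Seg-map f s)

power : ∀ {A : Set} (_·_ : A → A → A) (e : A) → A → ℕ → A
power _·_ e x zero = e
power _·_ e x (suc k) = x · power _·_ e x k

record MonoidOn (A : Set) : Set₁ where
  infixl 7 _·_
  field
    S     : A → Set
    _·_   : A → A → A
    e     : A
    S-e   : S e
    S-·   : ∀ {x y} → S x → S y → S (x · y)
    assoc : ∀ {x y z} → S x → S y → S z → (x · y) · z ≡ x · (y · z)
    idˡ   : ∀ {x} → S x → e · x ≡ x
    idʳ   : ∀ {x} → S x → x · e ≡ x

  module _ {β : A → ℕ → Set} (β-S : ∀ {x i} → β x i → S x) where

    Seg-S : ∀ {i x j} → Seg _·_ e β i x j → S x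
    Seg-S nil = S-e
    Seg-S (cons b s) = S-· (β-S b) (Seg-S s)

    Seg-++ : ∀ {i x j y k} → Seg _·_ e β i x j → Seg _·_ e β j y k → Seg _·_ e β i (x · y) k
    Seg-++ nil t = subst (λ z → Seg _·_ e β _ z _) (sym (idˡ (Seg-S t))) t
    Seg-++ (cons b s) t = subst (λ z → Seg _·_ e β _ z _) (sym (assoc (β-S b) (Seg-S s) (Seg-S t)))
                            (cons b (Seg-++ s t))

record AperiodicMonoid (A : Set) : Set₁ where
  field
    monoid    : MonoidOn A
  open MonoidOn monoid public
  field
    index     : ℕ
    aperiodic : ∀ {x} → S x → power _·_ e x index ≡ power _·_ e x (suc index)

  pow : A → ℕ → A
  pow = power _·_ e

  S-pow : ∀ {x} k → S x → S (pow x k)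
  S-pow zero sx = S-e
  S-pow (suc k) sx = S-· sx (S-pow k sx)

  pow-sucʳ : ∀ {x} k → S x → pow x (suc k) ≡ pow x k · x
  pow-sucʳ zero sx = trans (idʳ sx) (sym (idˡ sx))
  pow-sucʳ {x} (suc k) sx = trans (cong (x ·_) (pow-sucʳ k sx)) (sym (assoc sx (S-pow k sx) sx))

  pow-inverse : ∀ {x y} k → S x → S y → x · y ≡ e → pow x k · pow y k ≡ e
  pow-inverse zero sx sy eq = idˡ S-e
  pow-inverse {x} {y} (suc k) sx sy eq = begin
    pow x (suc k) · (y · pow y k) ≡⟨ cong (_· (y · pow y k)) (pow-sucʳ k sx) ⟩
    pow x k · x · (y · pow y k)   ≡⟨ assoc (S-pow k sx) sx (S-· sy (S-pow k sy)) ⟩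
    pow x k · (x · (y · pow y k)) ≡⟨ cong (pow x k ·_) (assoc sx sy (S-pow k sy)) ⟨
    pow x k · (x · y · pow y k)   ≡⟨ cong (λ z → pow x k · (z · pow y k)) eq ⟩
    pow x k · (e · pow y k)       ≡⟨ cong (pow x k ·_) (idˡ (S-pow k sy)) ⟩
    pow x k · pow y k             ≡⟨ pow-inverse k sx sy eq ⟩
    e ∎
    where open ≡-Reasoning

  unit-trivial : ∀ {c y} → S c → S y → c · y ≡ e → c ≡ e
  unit-trivial {c} {y} sc sy eq = begin
    c                                      ≡⟨ idʳ sc ⟨
    c · e                                  ≡⟨ cong (c ·_) (pow-inverse index sc sy eq) ⟨
    c · (pow c index · pow y index)        ≡⟨ assoc sc (S-pow index sc) (S-pow index sy) ⟨
    pow c (suc index) · pow y index        ≡⟨ cong (_· pow y index) (aperiodic sc) ⟨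
    pow c index · pow y index              ≡⟨ pow-inverse index sc sy eq ⟩
    e ∎
    where open ≡-Reasoning

-- The local divisor c S ∩ S c with product (x′ c) ∘ (c y′) = x′ c y′ and neutral element c
-- (Diekert–Gastin); when c ≠ e it misses e, so it is smaller.
module LocalDivisor (em : EM₀) {A : Set} (M : AperiodicMonoid A) {c : A} (Sc : AperiodicMonoid.S M c) where
  open AperiodicMonoid M
  open ≡-Reasoning

  S′ : A → Set
  S′ x = (Σ[ y ∈ A ] (S y × x ≡ c · y)) × (Σ[ y ∈ A ] (S y × x ≡ y · c))

  S′⇒S : ∀ {x} → S′ x → S x
  S′⇒S ((y , sy , refl) , _) = S-· Sc sy

  _∘_ : A → A → A
  x ∘ y with em {Σ[ x′ ∈ A ] (S x′ × x ≡ x′ · c)}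
  ... | yes (x′ , _) = x′ · y
  ... | no _ = x

  ∘-≡ : ∀ {x x′ y} → S x′ → x ≡ x′ · c → S′ y → x ∘ y ≡ x′ · y
  ∘-≡ {x} {x′} {y} sx′ eq ((y′ , sy′ , y≡) , _) with em {Σ[ x′ ∈ A ] (S x′ × x ≡ x′ · c)}
  ... | no n = ⊥-elim (n (x′ , sx′ , eq))
  ... | yes (x″ , sx″ , eq″) = begin
    x″ · y        ≡⟨ cong (x″ ·_) y≡ ⟩
    x″ · (c · y′) ≡⟨ assoc sx″ Sc sy′ ⟨
    x″ · c · y′   ≡⟨ cong (_· y′) (trans (sym eq″) eq) ⟩
    x′ · c · y′   ≡⟨ assoc sx′ Sc sy′ ⟩
    x′ · (c · y′) ≡⟨ cong (x′ ·_) y≡ ⟨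
    x′ · y ∎

  S′-c : S′ c
  S′-c = (e , S-e , sym (idʳ Sc)) , (e , S-e , sym (idˡ Sc))

  S′-∘ : ∀ {x y} → S′ x → S′ y → S′ (x ∘ y)
  S′-∘ {x} {y} ((x″ , sx″ , xl) , (x′ , sx′ , xr)) sy@((y″ , sy″ , yl) , (y′ , sy′ , yr)) =
    (x″ · y″ , S-· sx″ sy″ , (begin
      x ∘ y         ≡⟨ ∘-≡ sx′ xr sy ⟩
      x′ · y        ≡⟨ cong (x′ ·_) yl ⟩
      x′ · (c · y″) ≡⟨ assoc sx′ Sc sy″ ⟨
      x′ · c · y″   ≡⟨ cong (_· y″) (trans (sym xr) xl) ⟩
      c · x″ · y″   ≡⟨ assoc Sc sx″ sy″ ⟩
      c · (x″ · y″) ∎)) ,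
    (x′ · y′ , S-· sx′ sy′ , (begin
      x ∘ y         ≡⟨ ∘-≡ sx′ xr sy ⟩
      x′ · y        ≡⟨ cong (x′ ·_) yr ⟩
      x′ · (y′ · c) ≡⟨ assoc sx′ sy′ Sc ⟨
      x′ · y′ · c ∎))

  ∘-assoc : ∀ {x y z} → S′ x → S′ y → S′ z → (x ∘ y) ∘ z ≡ x ∘ (y ∘ z)
  ∘-assoc {x} {y} {z} sx@(_ , (x′ , sx′ , xr)) sy@(_ , (y′ , sy′ , yr)) sz = begin
    (x ∘ y) ∘ z   ≡⟨ ∘-≡ (S-· sx′ sy′) (trans (∘-≡ sx′ xr sy) (trans (cong (x′ ·_) yr) (sym (assoc sx′ sy′ Sc)))) sz ⟩
    x′ · y′ · z   ≡⟨ assoc sx′ sy′ (S′⇒S sz) ⟩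
    x′ · (y′ · z) ≡⟨ cong (x′ ·_) (∘-≡ sy′ yr sz) ⟨
    x′ · (y ∘ z)  ≡⟨ ∘-≡ sx′ xr (S′-∘ sy sz) ⟨
    x ∘ (y ∘ z) ∎

  power-∘ : ∀ {x x′} → S x′ → x ≡ x′ · c → S′ x → ∀ k → power _∘_ c x k ≡ pow x′ k · c × S′ (power _∘_ c x k)
  power-∘ sx′ xr sx zero = sym (idˡ Sc) , S′-c
  power-∘ {x} {x′} sx′ xr sx (suc k) with power-∘ sx′ xr sx k
  ... | eq , s = trans (∘-≡ sx′ xr s) (trans (cong (x′ ·_) eq) (sym (assoc sx′ (S-pow k sx′) Sc))) , S′-∘ sx s

  localDivisor : AperiodicMonoid A
  localDivisor = record
    { monoid = record
        { S = S′ ; _·_ = _∘_ ; e = c ; S-e = S′-c ; S-· = S′-∘ ; assoc = ∘-assoc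
        ; idˡ = λ sx → trans (∘-≡ S-e (sym (idˡ Sc)) sx) (idˡ (S′⇒S sx))
        ; idʳ = λ (_ , (x′ , sx′ , xr)) → trans (∘-≡ sx′ xr S′-c) (sym xr) }
    ; index = index
    ; aperiodic = λ sx@(_ , (x′ , sx′ , xr)) → trans (proj₁ (power-∘ sx′ xr sx index))
        (trans (cong (_· c) (aperiodic sx′)) (sym (proj₁ (power-∘ sx′ xr sx (suc index)))))
    }

  e∉S′ : c ≢ e → ¬ S′ e
  e∉S′ c≢e ((y , sy , eq) , _) = c≢e (unit-trivial Sc sy (sym eq))

  c·t·c∈S′ : ∀ {t} → S t → S′ (c · (t · c))
  c·t·c∈S′ {t} St = (t · c , S-· St Sc , refl) , (c · t , S-· Sc St , sym (assoc Sc St Sc))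

module AperiodicDia (em : EM₀) {Path : Set₁} {𝒟 : Pred Path → Set₁} (cl : Closed 𝒟)
  (next-closed : ∀ {P} → 𝒟 P → 𝒟 (λ p i → P p (suc i)))
  (until-closed : ∀ {P Q} → 𝒟 P → 𝒟 Q → 𝒟 (Until P Q))
  {A : Set} (fin : Finite A) where
  open ClosedProps em cl
  open Classical em

  Dia : (M : AperiodicMonoid A) → (A → Pred Path) → A → Pred Path → Pred Path
  Dia M β x ψ p i = Σ[ j ∈ ℕ ] (Seg _·_ e (λ y k → β y p k) i x j × ψ p j)
    where open AperiodicMonoid M

  record Alphabet (M : AperiodicMonoid A) (ℓ : List A) (β : A → Pred Path) : Set₁ where
    open AperiodicMonoid M
    field
      definable : ∀ x → 𝒟 (β x)
      in-S      : ∀ {x p i} → β x p i → S x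
      exclusive : ∀ {x y p i} → β x p i → β y p i → x ≡ y
      listed    : ∀ {x p i} → β x p i → x ≡ e ⊎ x LM.∈ ℓ

  module Unary (M : AperiodicMonoid A) {β : A → Pred Path} (al : Alphabet M [] β) where
    open AperiodicMonoid M
    open Alphabet al

    trivial : ∀ {p i x j} → Seg _·_ e (λ y k → β y p k) i x j → x ≡ e × (∀ l → i ≤ l → l < j → β e p l)
    trivial nil = refl , λ l i≤l l<i → ⊥-elim (ℕₚ.<⇒≱ l<i i≤l)
    trivial (cons b s) with listed b | trivial s
    ... | inj₁ refl | refl , f = idˡ S-e , g
      where
        g : ∀ l → _ ≤ l → l < _ → β e _ l
        g l i≤l l<j with ℕₚ.m≤n⇒m<n∨m≡n i≤l
        ... | inj₁ i<l = f l i<l l<j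
        ... | inj₂ refl = b

    untrivial : ∀ {p} d i → (∀ l → i ≤ l → l < d + i → β e p l) → Seg _·_ e (λ y k → β y p k) i e (d + i)
    untrivial zero i f = nil
    untrivial {p} (suc d) i f = subst₂ (λ x j → Seg _·_ e (λ y k → β y p k) i x j) (idˡ S-e) (ℕₚ.+-suc d i)
      (cons (f i ℕₚ.≤-refl (s≤s (ℕₚ.m≤n+m i d)))
        (untrivial d (suc i) λ l i<l l< → f l (ℕₚ.<⇒≤ i<l) (subst (l <_) (ℕₚ.+-suc d i) l<)))

    dia : ∀ x {ψ} → 𝒟 ψ → 𝒟 (Dia M β x ψ)
    dia x {ψ} dψ = iff-closed (λ p i → to p i , from p i) (conj (const (x ≡ e)) (until-closed (definable e) dψ))
      where
        to : ∀ p i → x ≡ e × Until (β e) ψ p i → Dia M β x ψ p i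
        to p i (refl , j , i≤j , h , f) = j , subst (Seg _ _ _ i e) eq (untrivial (j ∸ i) i λ l i≤l l< → f l i≤l (subst (l <_) eq l<)) , h
          where
            eq : j ∸ i + i ≡ j
            eq = ℕₚ.m∸n+n≡m i≤j
        from : ∀ p i → Dia M β x ψ p i → x ≡ e × Until (β e) ψ p i
        from p i (j , s , h) = proj₁ (trivial s) , j , Seg-≤ s , h , proj₂ (trivial s)

  module RemoveLetter (M : AperiodicMonoid A) {c : A} (Sc : AperiodicMonoid.S M c)
              {ℓ : List A} {β : A → Pred Path} (al : Alphabet M (c ∷ ℓ) β) where
    open AperiodicMonoid M
    open Alphabet al
    open LocalDivisor em M Sc

    β₁ : A → Pred Path
    β₁ x p i = β x p i × x ≢ c

    al₁ : Alphabet M ℓ β₁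
    al₁ = record
      { definable = λ x → conj (definable x) (const _)
      ; in-S = λ b → in-S (proj₁ b)
      ; exclusive = λ b b′ → exclusive (proj₁ b) (proj₁ b′)
      ; listed = λ { {x} {p} {i} (b , ne) → case-listed (listed b) ne } }
      where
        case-listed : ∀ {x} → x ≡ e ⊎ x LM.∈ (c ∷ ℓ) → x ≢ c → x ≡ e ⊎ x LM.∈ ℓ
        case-listed (inj₁ eq) ne = inj₁ eq
        case-listed (inj₂ (here eq)) ne = ⊥-elim (ne eq)
        case-listed (inj₂ (there m)) ne = inj₂ m

    Seg₁ Seg₂ Seg₀ : Path → ℕ → A → ℕ → Set
    Seg₀ p = Seg _·_ e (λ y k → β y p k)
    Seg₁ p = Seg _·_ e (λ y k → β₁ y p k)

    -- Letters of the divisor: an occurrence of c stands for c t c, where t is the value of the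
    -- c-free factor up to the next c (no letter if there is none); other positions are neutral.
    β₂ : A → Pred Path
    β₂ x p i = (¬ β c p i × x ≡ c) ⊎
               (β c p i × Σ[ t ∈ A ] (x ≡ c · (t · c) × Σ[ j ∈ ℕ ] (Seg₁ p (suc i) t j × β c p j)))

    Seg₂ p = Seg _∘_ c (λ y k → β₂ y p k)

    Seg₁-S : ∀ {p i x j} → Seg₁ p i x j → S x
    Seg₁-S = Seg-S (λ b → in-S (proj₁ b))

    next-c-unique : ∀ {p i t j t′ j′} → Seg₁ p i t j → β c p j → Seg₁ p i t′ j′ → β c p j′ → t ≡ t′
    next-c-unique nil cj nil cj′ = refl
    next-c-unique nil cj (cons (b , ne) _) cj′ = ⊥-elim (ne (exclusive b cj))
    next-c-unique (cons (b , ne) _) cj nil cj′ = ⊥-elim (ne (exclusive b cj′))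
    next-c-unique (cons (b , _) s) cj (cons (b′ , _) s′) cj′ =
      cong₂ _·_ (exclusive b b′) (next-c-unique s cj s′ cj′)

    β₂-S′ : ∀ {x p i} → β₂ x p i → S′ x
    β₂-S′ (inj₁ (_ , refl)) = S′-c
    β₂-S′ (inj₂ (_ , t , refl , j , s , _)) = c·t·c∈S′ (Seg₁-S s)

    β₂-exclusive : ∀ {x y p i} → β₂ x p i → β₂ y p i → x ≡ y
    β₂-exclusive (inj₁ (_ , refl)) (inj₁ (_ , refl)) = refl
    β₂-exclusive (inj₁ (n , _)) (inj₂ (b , _)) = ⊥-elim (n b)
    β₂-exclusive (inj₂ (b , _)) (inj₁ (n , _)) = ⊥-elim (n b)
    β₂-exclusive (inj₂ (_ , t , refl , j , s , cj)) (inj₂ (_ , t′ , refl , j′ , s′ , cj′)) =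
      cong (λ t → c · (t · c)) (next-c-unique s cj s′ cj′)

    Decomposition : Path → ℕ → A → ℕ → Set
    Decomposition p i x j = Σ[ y ∈ A ] Σ[ v ∈ A ] Σ[ z ∈ A ] Σ[ i′ ∈ ℕ ] Σ[ i″ ∈ ℕ ]
      (x ≡ y · (v · z) × Seg₁ p i y i′ × β c p i′ × Seg₂ p i′ v i″ × β c p i″ × Seg₁ p (suc i″) z j)

    decompose : ∀ {p i x j} → Seg₀ p i x j → Seg₁ p i x j ⊎ Decomposition p i x j
    decompose nil = inj₁ nil
    decompose {p} {i} {j = j} (cons {x = x} {y = w} b s) with em {x ≡ c} | decompose s
    ... | no ne | inj₁ s₁ = inj₁ (cons (b , ne) s₁)
    ... | no ne | inj₂ (y , v , z , i′ , i″ , refl , sy , ci′ , sv , ci″ , sz) =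
      inj₂ (x · y , v , z , i′ , i″ ,
            sym (assoc (in-S b) (Seg₁-S sy) (S-· (S′⇒S (AperiodicMonoid.Seg-S localDivisor β₂-S′ sv)) (Seg₁-S sz))) ,
            cons (b , ne) sy , ci′ , sv , ci″ , sz)
    ... | yes refl | inj₁ s₁ = inj₂ (e , c , w , i , i , sym (idˡ (S-· Sc (Seg₁-S s₁))) , nil , b , nil , b , s₁)
    ... | yes refl | inj₂ (y , v , z , i′ , i″ , refl , sy , ci′ , sv , ci″ , sz) =
      inj₂ (e , (c · (y · c)) ∘ v , z , i , i″ , eq , nil , b ,
            cons (inj₂ (b , y , refl , i′ , sy , ci′)) (skip sy ci′ sv) , ci″ , sz)
      where
        open ≡-Reasoning
        Sy = Seg₁-S sy
        Sz = Seg₁-S sz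
        S′v = AperiodicMonoid.Seg-S localDivisor β₂-S′ sv
        skip : ∀ {k y i′ v i″} → Seg₁ p k y i′ → β c p i′ → Seg₂ p i′ v i″ → Seg₂ p k v i″
        skip nil ci′ sv = sv
        skip (cons (b , ne) sy) ci′ sv =
          subst (λ v → Seg₂ p _ v _) (AperiodicMonoid.idˡ localDivisor (AperiodicMonoid.Seg-S localDivisor β₂-S′ sv))
            (cons (inj₁ ((λ b′ → ne (exclusive b b′)) , refl)) (skip sy ci′ sv))
        eq : c · (y · (v · z)) ≡ e · (((c · (y · c)) ∘ v) · z)
        eq = begin
          c · (y · (v · z))               ≡⟨ assoc Sc Sy (S-· (S′⇒S S′v) Sz) ⟨
          c · y · (v · z)                 ≡⟨ assoc (S-· Sc Sy) (S′⇒S S′v) Sz ⟨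
          c · y · v · z                   ≡⟨ cong (_· z) (∘-≡ (S-· Sc Sy) (sym (assoc Sc Sy Sc)) S′v) ⟨
          ((c · (y · c)) ∘ v) · z         ≡⟨ idˡ (S-· (S′⇒S (S′-∘ (c·t·c∈S′ Sy) S′v)) Sz) ⟨
          e · (((c · (y · c)) ∘ v) · z) ∎

    unfold : ∀ {p i t k v j} → Seg₁ p i t k → β c p k → Seg₂ p i v j → β c p j →
             Σ[ w ∈ A ] (S w × Seg₀ p k w j × w · c ≡ v)
    unfold nil ck nil cj = e , S-e , nil , idˡ Sc
    unfold (cons (b , ne) _) ck nil cj = ⊥-elim (ne (exclusive b cj))
    unfold nil ck (cons (inj₁ (n , _)) _) cj = ⊥-elim (n ck)
    unfold {p} nil ck (cons (inj₂ (_ , t , refl , k′ , s , ck′)) s₂) cj with unfold s ck′ s₂ cj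
    ... | w , sw , sg , refl =
      c · (t · w) , S-· Sc (S-· St sw) , cons ck (Seg-++ in-S (Seg-map proj₁ s) sg) , eq
      where
        open ≡-Reasoning
        St = Seg₁-S s
        S′v = AperiodicMonoid.Seg-S localDivisor β₂-S′ s₂
        eq : c · (t · w) · c ≡ (c · (t · c)) ∘ (w · c)
        eq = begin
          c · (t · w) · c           ≡⟨ assoc Sc (S-· St sw) Sc ⟩
          c · (t · w · c)           ≡⟨ cong (c ·_) (assoc St sw Sc) ⟩
          c · (t · (w · c))         ≡⟨ assoc Sc St (S-· sw Sc) ⟨
          c · t · (w · c)           ≡⟨ ∘-≡ (S-· Sc St) (sym (assoc Sc St Sc)) S′v ⟨
          (c · (t · c)) ∘ (w · c) ∎
    unfold (cons (b , ne) s₁) ck (cons (inj₂ (b′ , _)) _) cj = ⊥-elim (ne (exclusive b b′))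
    unfold (cons _ s₁) ck (cons (inj₁ (_ , refl)) s₂) cj with unfold s₁ ck s₂ cj
    ... | w , sw , sg , eq = w , sw , sg , trans eq (sym (AperiodicMonoid.idˡ localDivisor (AperiodicMonoid.Seg-S localDivisor β₂-S′ s₂)))

    recompose : ∀ {p i x j} → Decomposition p i x j → Seg₀ p i x j
    recompose {p} {i} {j = j} (y , v , z , i′ , i″ , refl , sy , ci′ , sv , ci″ , sz)
      with unfold nil ci′ sv ci″
    ... | w , sw , sg , refl = subst (λ x → Seg₀ p i x j) (cong (y ·_) (sym (assoc sw Sc (Seg₁-S sz))))
      (Seg-++ in-S (Seg-map proj₁ sy) (Seg-++ in-S sg (cons ci″ (Seg-map proj₁ sz))))

    module _ (dia₁ : ∀ x {ψ} → 𝒟 ψ → 𝒟 (Dia M β₁ x ψ)) where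

      al₂ : ∀ {ℓ₂} → (∀ {x} → S′ x → x LM.∈ ℓ₂) → Alphabet localDivisor ℓ₂ β₂
      al₂ cover = record
        { definable = λ x → disj (conj (neg (definable c)) (const _))
            (conj (definable c) (∃fin fin λ t → conj (const _) (next-closed (dia₁ t (definable c)))))
        ; in-S = β₂-S′
        ; exclusive = β₂-exclusive
        ; listed = λ b → inj₂ (cover (β₂-S′ b)) }

      dia : (∀ x {ψ} → 𝒟 ψ → 𝒟 (Dia localDivisor β₂ x ψ)) → ∀ x {ψ} → 𝒟 ψ → 𝒟 (Dia M β x ψ)
      dia dia₂ x {ψ} dψ = iff-closed (λ p i → to p i , from p i)
        (disj (dia₁ x dψ)
          (∃fin fin λ y → ∃fin fin λ v → ∃fin fin λ z → conj (const (x ≡ y · (v · z)))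
            (dia₁ y (conj (definable c) (dia₂ v (conj (definable c) (next-closed (dia₁ z dψ))))))))
        where
          Target : Pred Path
          Target p i = Dia M β₁ x ψ p i ⊎ (Σ[ y ∈ A ] Σ[ v ∈ A ] Σ[ z ∈ A ] (x ≡ y · (v · z) ×
            Dia M β₁ y (λ p i → β c p i × Dia localDivisor β₂ v (λ p i → β c p i × Dia M β₁ z ψ p (suc i)) p i) p i))
          to : ∀ p i → Target p i → Dia M β x ψ p i
          to p i (inj₁ (j , s , h)) = j , Seg-map proj₁ s , h
          to p i (inj₂ (y , v , z , eq , i′ , sy , ci′ , i″ , sv , ci″ , j , sz , h)) =
            j , recompose (y , v , z , i′ , i″ , eq , sy , ci′ , sv , ci″ , sz) , h
          from : ∀ p i → Dia M β x ψ p i → Target p i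
          from p i (j , s , h) with decompose s
          ... | inj₁ s₁ = inj₁ (j , s₁ , h)
          ... | inj₂ (y , v , z , i′ , i″ , eq , sy , ci′ , sv , ci″ , sz) =
            inj₂ (y , v , z , eq , i′ , sy , ci′ , i″ , sv , ci″ , j , sz , h)

  ¬∈[] : ∀ {x : A} → ¬ (x LM.∈ [])
  ¬∈[] ()

  Claim : ℕ → Set₁
  Claim k = ∀ (M : AperiodicMonoid A) (cover : List A) → length cover ≡ k →
    (∀ {x} → AperiodicMonoid.S M x → x LM.∈ cover) →
    ∀ ℓ {β} → Alphabet M ℓ β → ∀ x {ψ} → 𝒟 ψ → 𝒟 (Dia M β x ψ)

  claim-step : ∀ {k} → Claim k → Claim (suc k)
  claim-step ih M cs len cover [] al = Unary.dia M al
  claim-step {k} ih M cs len cover (c ∷ ℓ) {β} al with em {AperiodicMonoid.S M c × c ≢ AperiodicMonoid.e M}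
  ... | no n = claim-step ih M cs len cover ℓ record
        { definable = definable ; in-S = in-S ; exclusive = exclusive ; listed = listed′ }
    where
      open Alphabet al
      listed′ : ∀ {x p i} → β x p i → x ≡ AperiodicMonoid.e M ⊎ x LM.∈ ℓ
      listed′ b with listed b
      ... | inj₁ eq = inj₁ eq
      ... | inj₂ (there m) = inj₂ m
      ... | inj₂ (here refl) = inj₁ (dne λ ne → n (in-S b , ne))
  ... | yes (Sc , c≢e) with delete (cover (AperiodicMonoid.S-e M))
  ... | cs′ , len′ , f = RemoveLetter.dia M Sc al dia₁
        (ih localDivisor cs′ (ℕₚ.suc-injective (trans (sym len′) len)) cover′ cs′ (RemoveLetter.al₂ M Sc al dia₁ cover′))
    where
      open LocalDivisor em M Sc
      dia₁ : ∀ x {ψ} → 𝒟 ψ → 𝒟 (Dia M (RemoveLetter.β₁ M Sc al) x ψ)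
      dia₁ = claim-step ih M cs len cover ℓ (RemoveLetter.al₁ M Sc al)
      cover′ : ∀ {x} → S′ x → x LM.∈ cs′
      cover′ s = f (cover (S′⇒S s)) (λ { refl → e∉S′ c≢e s })

  claim : ∀ k → Claim k
  claim zero M [] _ cover = λ _ _ → ⊥-elim (¬∈[] (cover (AperiodicMonoid.S-e M)))
  claim (suc k) = claim-step (claim k)

  elements : List A
  elements = map (Finite.enum fin) (allFin (Finite.size fin))

  ∈-elements : ∀ x → x LM.∈ elements
  ∈-elements x = subst (LM._∈ elements) (Finite.enum-code fin x)
    (LMₚ.∈-map⁺ (Finite.enum fin) (LMₚ.∈-allFin (Finite.code fin x)))

  aperiodic-dia : ∀ (M : AperiodicMonoid A) {β} →
    (∀ x → 𝒟 (β x)) → (∀ {x p i} → β x p i → AperiodicMonoid.S M x) →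
    (∀ {x y p i} → β x p i → β y p i → x ≡ y) →
    ∀ x {ψ} → 𝒟 ψ → 𝒟 (Dia M β x ψ)
  aperiodic-dia M dβ sβ eβ = claim (length elements) M elements refl (λ _ → ∈-elements _) elements
    record { definable = dβ ; in-S = sβ ; exclusive = eβ ; listed = λ _ → inj₂ (∈-elements _) }

-- Ramsey's theorem and transition matrices

bound : ∀ {k} (f : Fin k → ℕ) → Σ[ b ∈ ℕ ] (∀ c → f c ≤ b)
bound {zero} f = 0 , λ ()
bound {suc k} f with bound (λ c → f (fs c))
... | b , h = f fz ⊔ b , λ { fz → ℕₚ.m≤m⊔n _ _ ; (fs c) → ℕₚ.≤-trans (h c) (ℕₚ.m≤n⊔m (f fz) b) }

Infinite : (ℕ → Set) → Set
Infinite P = ∀ k → Σ[ a ∈ ℕ ] (k ≤ a × P a)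

module Ramsey (em : EM₀) where
  open Classical em

  abstract
    pigeonhole : ∀ {C} → Finite C → (Q : C → ℕ → Set) → Infinite (λ a → Σ[ c ∈ C ] Q c a) →
                 Σ[ c ∈ C ] Infinite (Q c)
    pigeonhole {C} fC Q inf = dne λ none →
      let miss : ∀ c → Σ[ k ∈ ℕ ] ¬ (Σ[ a ∈ ℕ ] (k ≤ a × Q c a))
          miss c = ¬∀⇒∃¬ (λ all → none (c , all))
          (b , h) = bound (λ i → proj₁ (miss (enum i)))
          (a , b≤a , c , q) = inf b
          c≡ = enum-code c
      in proj₂ (miss (enum (code c))) (a , ℕₚ.≤-trans (h (code c)) b≤a , subst (λ c → Q c a) (sym c≡) q)
      where open Finite fC

  module _ {C : Set} (fC : Finite C) (Col : C → ℕ → ℕ → Set)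
           (colour : ∀ a b → a < b → Σ[ c ∈ C ] Col c a b) where

    InfSet : Set₁
    InfSet = Σ[ P ∈ (ℕ → Set) ] Infinite P

    pick : InfSet → ℕ
    pick (P , inf) = proj₁ (inf 0)

    Later : InfSet → C → ℕ → Set
    Later s@(P , _) c b = P b × pick s < b × Col c (pick s) b

    abstract
      refine : (s : InfSet) → Σ[ c ∈ C ] Infinite (Later s c)
      refine s@(P , inf) = pigeonhole fC (Later s) λ k →
        let (b , k≤b , pb) = inf (k ⊔ suc (pick s))
            a<b = ℕₚ.m⊔n≤o⇒n≤o k (suc (pick s)) k≤b
            (c , col) = colour (pick s) b a<b
        in b , ℕₚ.m⊔n≤o⇒m≤o k (suc (pick s)) k≤b , c , pb , a<b , col

    sets : ℕ → InfSet
    sets zero = (λ _ → ⊤) , λ k → k , ℕₚ.≤-refl , tt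
    sets (suc k) = Later (sets k) (proj₁ (refine (sets k))) , proj₂ (refine (sets k))

    point : ℕ → ℕ
    point k = pick (sets k)

    col : ℕ → C
    col k = proj₁ (refine (sets k))

    shrink : ∀ {k l b} → k ≤′ l → proj₁ (sets l) b → proj₁ (sets k) b
    shrink ≤′-refl p = p
    shrink (≤′-step k≤l) (p , _) = shrink k≤l p

    later : ∀ {k l} → k < l → Later (sets k) (col k) (point l)
    later {k} {l} k<l = shrink {suc k} (ℕₚ.≤⇒≤′ k<l) (proj₂ (proj₂ (proj₂ (sets l) 0)))

    point-≥ : ∀ k → k ≤ point k
    point-≥ zero = z≤n
    point-≥ (suc k) = ℕₚ.≤-<-trans (point-≥ k) (proj₁ (proj₂ (later {k} {suc k} ℕₚ.≤-refl)))

    ramsey : Σ[ c ∈ C ] Σ[ G ∈ (ℕ → Set) ] (Infinite G × (∀ {a b} → G a → G b → a < b → Col c a b))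
    ramsey with pigeonhole fC (λ c k → col k ≡ c) (λ k → k , ℕₚ.≤-refl , col k , refl)
    ... | c , inf = c , G , infG , hom
      where
        G : ℕ → Set
        G a = Σ[ k ∈ ℕ ] (point k ≡ a × col k ≡ c)
        infG : Infinite G
        infG k = let (l , k≤l , eq) = inf k in point l , ℕₚ.≤-trans k≤l (point-≥ l) , l , refl , eq
        hom : ∀ {a b} → G a → G b → a < b → Col c a b
        hom (k , refl , refl) (l , refl , _) a<b with ℕₚ.<-cmp k l
        ... | tri< k<l _ _ = proj₂ (proj₂ (later k<l))
        ... | tri≈ _ refl _ = ⊥-elim (ℕₚ.<-irrefl refl a<b)
        ... | tri> _ _ l<k = ⊥-elim (ℕₚ.<-asym a<b (proj₁ (proj₂ (later l<k))))

module Matrices (em : EM₀) (N : ℕ) where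
  open Classical em

  Mat : Set
  Mat = Vec (Vec Bool N) N

  finite-Mat : Finite Mat
  finite-Mat = Finite-Vec N (Finite-Vec N Finite-Bool)

  Entry : Mat → Fin N → Fin N → Set
  Entry x a b = lookup (lookup x a) b ≡ true

  mat : (Fin N → Fin N → Set) → Mat
  mat R = tabulate λ a → tabulate λ b → bool (R a b)

  lookup-mat : ∀ R a b → lookup (lookup (mat R) a) b ≡ bool (R a b)
  lookup-mat R a b = trans (cong (λ v → lookup v b) (Vecₚ.lookup∘tabulate _ a)) (Vecₚ.lookup∘tabulate _ b)

  mat⁺ : ∀ {R a b} → R a b → Entry (mat R) a b
  mat⁺ {R} {a} {b} r = trans (lookup-mat R a b) (bool⁺ r)

  mat⁻ : ∀ {R a b} → Entry (mat R) a b → R a b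
  mat⁻ {R} {a} {b} eq = bool⁻ (trans (sym (lookup-mat R a b)) eq)

  Mat-ext : ∀ {x y} → (∀ a b → Entry x a b ⇔ Entry y a b) → x ≡ y
  Mat-ext h = Vec-ext λ a → Vec-ext λ b → bool-≡ (h a b)

  infixl 7 _⊙_
  _⊙_ : Mat → Mat → Mat
  x ⊙ y = mat λ a b → Σ[ s ∈ Fin N ] (Entry x a s × Entry y s b)

  one : Mat
  one = mat _≡_

  ⊙-assoc : ∀ x y z → (x ⊙ y) ⊙ z ≡ x ⊙ (y ⊙ z)
  ⊙-assoc x y z = Mat-ext λ a b →
    (λ h → let (s , xy , sz) = mat⁻ h ; (t , ex , ey) = mat⁻ xy in mat⁺ (t , ex , mat⁺ (s , ey , sz))) ,
    (λ h → let (s , ex , yz) = mat⁻ h ; (t , ey , ez) = mat⁻ yz in mat⁺ (t , mat⁺ (s , ex , ey) , ez))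

  ⊙-idˡ : ∀ x → one ⊙ x ≡ x
  ⊙-idˡ x = Mat-ext λ a b →
    (λ h → let (s , e , ex) = mat⁻ h in subst (λ s → Entry x s b) (sym (mat⁻ e)) ex) ,
    (λ h → mat⁺ (a , mat⁺ refl , h))

  ⊙-idʳ : ∀ x → x ⊙ one ≡ x
  ⊙-idʳ x = Mat-ext λ a b →
    (λ h → let (s , ex , e) = mat⁻ h in subst (λ s → Entry x a s) (mat⁻ e) ex) ,
    (λ h → mat⁺ (b , h , mat⁺ refl))

  matMonoid : MonoidOn Mat
  matMonoid = record
    { S = λ _ → ⊤ ; _·_ = _⊙_ ; e = one ; S-e = tt ; S-· = λ _ _ → tt
    ; assoc = λ {x} {y} {z} _ _ _ → ⊙-assoc x y z ; idˡ = λ _ → ⊙-idˡ _ ; idʳ = λ _ → ⊙-idʳ _ }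

  data WordPath (R : ℕ → Fin N → Fin N → Set) : ℕ → Fin N → ℕ → Fin N → Set where
    nil  : ∀ {i y} → WordPath R i y i y
    cons : ∀ {i y y′ j z} → R i y y′ → WordPath R (suc i) y′ j z → WordPath R i y j z

  module Word (R : ℕ → Fin N → Fin N → Set) where

    Factor : ℕ → Mat → ℕ → Set
    Factor = Seg _⊙_ one (λ x k → mat (R k) ≡ x)

    Factor-++ : ∀ {i x j y k} → Factor i x j → Factor j y k → Factor i (x ⊙ y) k
    Factor-++ = MonoidOn.Seg-++ matMonoid (λ _ → tt)

    _++ᵖ_ : ∀ {i y j z k w} → WordPath R i y j z → WordPath R j z k w → WordPath R i y k w
    nil ++ᵖ q = q
    cons r p ++ᵖ q = cons r (p ++ᵖ q)

    WordPath-≤ : ∀ {i y j z} → WordPath R i y j z → i ≤ j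
    WordPath-≤ nil = ℕₚ.≤-refl
    WordPath-≤ (cons _ p) = ℕₚ.<⇒≤ (WordPath-≤ p)

    uncons : ∀ {i y j z} → WordPath R i y j z → i < j → Σ[ y′ ∈ Fin N ] (R i y y′ × WordPath R (suc i) y′ j z)
    uncons nil i<i = ⊥-elim (ℕₚ.<-irrefl refl i<i)
    uncons (cons r p) _ = _ , r , p

    factor-path : ∀ {i x j y z} → Factor i x j → Entry x y z → WordPath R i y j z
    factor-path {i} nil e = subst (WordPath R i _ i) (mat⁻ e) nil
    factor-path (cons refl s) e = let (_ , r , e′) = mat⁻ e in cons (mat⁻ r) (factor-path s e′)

    path-entry : ∀ {i x j y z} → Factor i x j → WordPath R i y j z → Entry x y z
    path-entry nil nil = mat⁺ refl
    path-entry nil (cons _ p) = ⊥-elim (ℕₚ.<-irrefl refl (WordPath-≤ p))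
    path-entry (cons _ s) nil = ⊥-elim (ℕₚ.<-irrefl refl (Seg-≤ s))
    path-entry (cons refl s) (cons r p) = mat⁺ (_ , mat⁺ r , path-entry s p)

    factor-unique : ∀ {i x y j} → Factor i x j → Factor i y j → x ≡ y
    factor-unique nil nil = refl
    factor-unique nil (cons _ s) = ⊥-elim (ℕₚ.<-irrefl refl (Seg-≤ s))
    factor-unique (cons _ s) nil = ⊥-elim (ℕₚ.<-irrefl refl (Seg-≤ s))
    factor-unique (cons refl s) (cons refl t) = cong (mat (R _) ⊙_) (factor-unique s t)

    factor : ∀ {i j} → i ≤′ j → Σ[ x ∈ Mat ] Factor i x j
    factor ≤′-refl = one , nil
    factor (≤′-step i≤j) = _ , Factor-++ (proj₂ (factor i≤j)) (cons refl nil)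

-- Büchi acceptance

InfiniteRun : ∀ {n} → (Fin n → Fin n → ℕ → Set) → (Fin n → Set) → ℕ → Fin n → Set
InfiniteRun {n} ed F i q = Σ[ r ∈ (ℕ → Fin n) ]
  (r 0 ≡ q × (∀ l → ed (r l) (r (suc l)) (l + i)) × Infinite (λ l → F (r l)))

-- States are doubled by a flag that may be raised only when an accepting state is left, so that
-- entries (s , 0) → (s′ , 1) of a matrix product say that an accepting path exists.
module Doubled {n : ℕ} (F : Fin n → Set) where

  state : Fin (n * 2) → Fin n
  state y = proj₁ (remQuot {n} 2 y)

  flag : Fin (n * 2) → Fin 2
  flag y = proj₂ (remQuot {n} 2 y)

  with-flag : Fin n → Fin 2 → Fin (n * 2)
  with-flag q b = combine q b

  state-with-flag : ∀ q b → state (with-flag q b) ≡ q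
  state-with-flag q b = cong proj₁ (Finₚ.remQuot-combine q b)

  flag-with-flag : ∀ q b → flag (with-flag q b) ≡ b
  flag-with-flag q b = cong proj₂ (Finₚ.remQuot-combine q b)

  FlagStep : Fin (n * 2) → Fin (n * 2) → Set
  FlagStep y y′ = flag y ≡ flag y′ ⊎ (flag y ≡ fz × flag y′ ≡ fs fz × F (state y))

  double : (Fin n → Fin n → Set) → Fin (n * 2) → Fin (n * 2) → Set
  double R y y′ = R (state y) (state y′) × FlagStep y y′

module BüchiWord (em : EM₀) {n : ℕ} (F : Fin n → Set) (ed : Fin n → Fin n → ℕ → Set) where
  open Doubled F
  open Matrices em (n * 2)

  step : ℕ → Fin (n * 2) → Fin (n * 2) → Set
  step k = double (λ q q′ → ed q q′ k)

  open Word step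

  Merges : Mat → ℕ → Set
  Merges e j = Σ[ y ∈ Mat ] (e ⊙ y ≡ y × Σ[ k ∈ ℕ ] Factor j y k)

  -- The suffix from i factors into infinitely many factors of value e.
  Splits : Mat → ℕ → Set
  Splits e i = ∀ x → ¬ (Σ[ j ∈ ℕ ] (Factor i x j ×
                  ¬ (Σ[ y ∈ Mat ] (x ⊙ y ≡ e × Σ[ k ∈ ℕ ] (Factor j y k × Merges e k)))))

  Lasso : ℕ → Fin n → Set
  Lasso i q = Σ[ x ∈ Mat ] Σ[ e ∈ Mat ] Σ[ s ∈ Fin n ]
    ((Entry x (with-flag q fz) (with-flag s fz) × Entry e (with-flag s fz) (with-flag s (fs fz))) ×
     Σ[ j ∈ ℕ ] (Factor i x j × Splits e j))

  module FromLasso {i₀ : ℕ} {e : Mat} (splits : Splits e i₀) {s : Fin n}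
                   (loop : Entry e (with-flag s fz) (with-flag s (fs fz))) where
    open Classical em

    -- The factors starting at i₀ and at j eventually agree, so that a later factor of value e
    -- from i₀ also is one from j.
    Mergeable : ℕ → Set
    Mergeable j = Σ[ y ∈ Mat ] Σ[ k ∈ ℕ ] (Factor j y k × Factor i₀ y k)

    abstract
      next-segment : ∀ {j} → Mergeable j → Σ[ k ∈ ℕ ] (j < k × Factor j e k × Mergeable k)
      next-segment {j} (y , k , sj , si) =
        let c = cons {x = mat (step k)} refl nil
            tj = Factor-++ sj c
            ti = Factor-++ si c
            (u , eq , l , su , (v , ev , l′ , sv)) = dne (λ n → splits _ (suc k , ti , n))
        in l , ℕₚ.≤-trans (s≤s (Seg-≤ sj)) (Seg-≤ su) ,
           subst (λ x → Factor j x l) eq (Factor-++ tj su) ,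
           (v , l′ , sv , subst (λ x → Factor i₀ x l′) (trans (cong (_⊙ v) eq) ev) (Factor-++ (Factor-++ ti su) sv))

    goal : Fin (n * 2)
    goal = with-flag s (fs fz)

    record Position : Set where
      constructor position
      field
        {time}    : ℕ
        {node}    : Fin (n * 2)
        {end}     : ℕ
        path      : WordPath step time node end goal
        mergeable : Mergeable end
    open Position

    abstract
      segment : ∀ {j} → Mergeable j → Σ[ k ∈ ℕ ] Σ[ y ∈ Fin (n * 2) ]
        (step j (with-flag s fz) y × WordPath step (suc j) y k goal × Mergeable k)
      segment m =
        let (k , j<k , f , m′) = next-segment m
            (y , r , p) = uncons (factor-path f loop) j<k
        in k , y , r , p , m′

    advance : Position → Position
    advance (position nil m) = let (_ , _ , _ , p , m′) = segment m in position p m′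
    advance (position (cons _ p) m) = position p m

    iterate : Position → ℕ → Position
    iterate c zero = c
    iterate c (suc l) = iterate (advance c) l

    iterate-+ : ∀ c k l → iterate c (k + l) ≡ iterate (iterate c k) l
    iterate-+ c zero l = refl
    iterate-+ c (suc k) l = iterate-+ (advance c) k l

    run : Position → ℕ → Fin n
    run c l = state (node (iterate c l))

    advance-edge : ∀ c → ed (state (node c)) (state (node (advance c))) (time c) × time (advance c) ≡ suc (time c)
    advance-edge (position nil m) = subst (λ q → ed q (state (proj₁ (proj₂ (segment m)))) _)
      (trans (state-with-flag s fz) (sym (state-with-flag s (fs fz)))) (proj₁ (proj₁ (proj₂ (proj₂ (segment m))))) , refl
    advance-edge (position (cons (r , _) p) m) = r , refl

    run-edge : ∀ c l → ed (run c l) (run c (suc l)) (l + time c)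
    run-edge c zero = proj₁ (advance-edge c)
    run-edge c (suc l) = subst (ed _ _) (trans (cong (l +_) (proj₂ (advance-edge c))) (ℕₚ.+-suc l (time c)))
                           (run-edge (advance c) l)

    visit-unflagged : ∀ {i y j} (p : WordPath step i y j goal) (m : Mergeable j) → flag y ≡ fz →
                      Σ[ l ∈ ℕ ] F (run (position p m) l)
    visit-unflagged nil m eq with trans (sym eq) (flag-with-flag s (fs fz))
    ... | ()
    visit-unflagged (cons (_ , inj₁ same) p) m eq =
      let (l , f) = visit-unflagged p m (trans (sym same) eq) in suc l , f
    visit-unflagged (cons (_ , inj₂ (_ , _ , f)) p) m eq = 0 , f

    visit : ∀ {i y j} (p : WordPath step i y j goal) (m : Mergeable j) → Σ[ l ∈ ℕ ] F (run (position p m) l)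
    visit (cons _ p) m = let (l , f) = visit p m in suc l , f
    visit nil m = at-goal
      where
        at-goal : Σ[ l ∈ ℕ ] F (run (position nil m) l)
        at-goal with segment m in eq
        ... | k , y , (_ , inj₂ (_ , _ , f)) , p , m′ =
          0 , subst F (trans (state-with-flag s fz) (sym (state-with-flag s (fs fz)))) f
        ... | k , y , (_ , inj₁ same) , p , m′ =
          let (l , f) = visit-unflagged p m′ (trans (sym same) (flag-with-flag s fz))
          in suc l , subst (λ { (_ , _ , _ , p , m′) → F (run (position p m′) l) }) (sym eq) f

    run-infinite : ∀ c → Infinite (λ l → F (run c l))
    run-infinite c k =
      let c′ = iterate c k
          (l , f) = visit (path c′) (mergeable c′)
      in k + l , ℕₚ.m≤m+n k l , subst (λ c → F (state (node c))) (sym (iterate-+ c k l)) f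

  lasso⇒run : ∀ {i q} → Lasso i q → InfiniteRun ed F i q
  lasso⇒run {i} {q} (x , e , s , (ex , ee) , j , sx , splits) =
    run c , state-with-flag q fz , run-edge c , run-infinite c
    where
      open FromLasso splits ee
      first : Σ[ k ∈ ℕ ] (j < k × Factor j e k × Mergeable k)
      first = next-segment (one , j , nil , nil)
      c : Position
      c = position (factor-path sx ex ++ᵖ factor-path (proj₁ (proj₂ (proj₂ first))) ee)
                   (proj₂ (proj₂ (proj₂ first)))

  module FromRun {i : ℕ} (r : ℕ → Fin n) (edge : ∀ l → ed (r l) (r (suc l)) (l + i)) (inf : Infinite (λ l → F (r l))) where
    open Ramsey em

    double-edge : ∀ b l → step (l + i) (with-flag (r l) b) (with-flag (r (suc l)) b)
    double-edge b l = subst₂ (λ q q′ → ed q q′ (l + i)) (sym (state-with-flag _ b)) (sym (state-with-flag _ b)) (edge l) ,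
      inj₁ (trans (flag-with-flag _ b) (sym (flag-with-flag _ b)))

    raise : ∀ l → F (r l) → step (l + i) (with-flag (r l) fz) (with-flag (r (suc l)) (fs fz))
    raise l f = subst₂ (λ q q′ → ed q q′ (l + i)) (sym (state-with-flag _ fz)) (sym (state-with-flag _ (fs fz))) (edge l) ,
      inj₂ (flag-with-flag _ fz , flag-with-flag _ (fs fz) , subst F (sym (state-with-flag _ fz)) f)

    stretch : ∀ b {k l} → k ≤′ l → WordPath step (k + i) (with-flag (r k) b) (l + i) (with-flag (r l) b)
    stretch b ≤′-refl = nil
    stretch b (≤′-step k≤l) = stretch b k≤l ++ᵖ cons (double-edge b _) nil

    accepting-stretch : ∀ {k l m} → k ≤ l → F (r l) → l < m →
      WordPath step (k + i) (with-flag (r k) fz) (m + i) (with-flag (r m) (fs fz))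
    accepting-stretch {l = l} k≤l f l<m =
      stretch fz (ℕₚ.≤⇒≤′ k≤l) ++ᵖ cons (raise l f) (stretch (fs fz) (ℕₚ.≤⇒≤′ l<m))

    Col : Mat × Fin n → ℕ → ℕ → Set
    Col (x , s) a b = Factor (a + i) x (b + i) × r a ≡ s

    colour : ∀ a b → a < b → Σ[ c ∈ Mat × Fin n ] Col c a b
    colour a b a<b = let (x , f) = factor (ℕₚ.≤⇒≤′ (ℕₚ.+-monoˡ-≤ i (ℕₚ.<⇒≤ a<b))) in (x , r a) , f , refl

    lasso : Lasso i (r 0)
    lasso with ramsey (Finite-× finite-Mat (Finite-Fin n)) Col colour
    ... | (e , s) , G , infG , hom =
        proj₁ prefix , e , s , (path-entry (proj₂ prefix) (to-s (stretch fz (ℕₚ.≤⇒≤′ z≤n))) , loop) ,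
        a + i , proj₂ prefix , splits
      where
        a = proj₁ (infG 0)
        Ga = proj₂ (proj₂ (infG 0))
        above : ∀ k → Σ[ b ∈ ℕ ] (k < b × G b)
        above k = infG (suc k)
        state-of : ∀ {k} → G k → r k ≡ s
        state-of {k} g = let (b , k<b , gb) = above k in proj₂ (hom g gb k<b)
        to-s : ∀ {k y b} → WordPath step k y (a + i) (with-flag (r a) b) → WordPath step k y (a + i) (with-flag s b)
        to-s = subst (λ s → WordPath step _ _ (a + i) (with-flag s _)) (state-of Ga)
        prefix : Σ[ x ∈ Mat ] Factor i x (a + i)
        prefix = factor (ℕₚ.≤⇒≤′ (ℕₚ.m≤n+m i a))
        loop : Entry e (with-flag s fz) (with-flag s (fs fz))
        loop =
          let (l , a≤l , f) = inf a
              (b , l<b , gb) = above l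
          in path-entry (proj₁ (hom Ga gb (ℕₚ.≤-<-trans a≤l l<b)))
               (subst₂ (λ q q′ → WordPath step (a + i) (with-flag q fz) (b + i) (with-flag q′ (fs fz)))
                  (state-of Ga) (state-of gb) (accepting-stretch a≤l f l<b))
        splits : Splits e (a + i)
        splits x (j , fx , none) =
          let (b , m<b , gb) = above (a ⊔ j)
              a<b = ℕₚ.≤-<-trans (ℕₚ.m≤m⊔n a j) m<b
              j≤b = ℕₚ.≤-trans (ℕₚ.<⇒≤ (ℕₚ.≤-<-trans (ℕₚ.m≤n⊔m a j) m<b)) (ℕₚ.m≤m+n b i)
              (y , fy) = factor (ℕₚ.≤⇒≤′ j≤b)
              (b′ , b<b′ , gb′) = above b
              fab = proj₁ (hom Ga gb a<b)
              fbb′ = proj₁ (hom gb gb′ b<b′)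
          in none (y , factor-unique (Factor-++ fx fy) fab , b + i , fy ,
               (e , factor-unique (Factor-++ fab fbb′) (proj₁ (hom Ga gb′ (ℕₚ.<-trans a<b b<b′))) , b′ + i , fbb′))

  run⇒lasso : ∀ {i q} → InfiniteRun ed F i q → Lasso i q
  run⇒lasso (r , refl , edge , inf) = FromRun.lasso r edge inf

module BüchiDefinable (em : EM₀) {Path : Set₁} {𝒟 : Pred Path → Set₁} (cl : Closed 𝒟)
  {n : ℕ} (F : Fin n → Set) (ed : Fin n → Fin n → Pred Path) where
  open ClosedProps em cl
  open Doubled F
  open Matrices em (n * 2)

  letter : Mat → Pred Path
  letter x p i = mat (double (λ q q′ → ed q q′ p i)) ≡ x

  module _ (ded : ∀ q q′ → 𝒟 (ed q q′)) where

    letter-closed : ∀ x → 𝒟 (letter x)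
    letter-closed x = iff-closed (λ p i → (λ h → Mat-ext λ a b → ⇔-trans (mat⁻ , mat⁺) (h a b)) ,
                                          (λ { refl a b → mat⁺ , mat⁻ }))
      (∀fin (Finite-Fin _) λ a → ∀fin (Finite-Fin _) λ b →
        iff (conj (ded (state a) (state b)) (const (FlagStep a b))) (const (Entry x a b)))
      where
        imp : ∀ {P Q} → 𝒟 P → 𝒟 Q → 𝒟 (λ p i → P p i → Q p i)
        imp dP dQ = iff-closed (λ p i → (λ n x → Classical.dne em λ nq → n (x , nq)) , (λ f (x , nq) → nq (f x)))
                      (neg (conj dP (neg dQ)))
        iff : ∀ {P Q} → 𝒟 P → 𝒟 Q → 𝒟 (λ p i → P p i ⇔ Q p i)
        iff dP dQ = conj (imp dP dQ) (imp dQ dP)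

    run-closed : (∀ x {ψ} → 𝒟 ψ → 𝒟 (λ p i → Σ[ j ∈ ℕ ] (Seg _⊙_ one (λ x k → letter x p k) i x j × ψ p j))) →
                 ∀ q → 𝒟 (λ p i → InfiniteRun (λ q q′ k → ed q q′ p k) F i q)
    run-closed dia q = iff-closed (λ p i → BüchiWord.lasso⇒run em F (λ q q′ k → ed q q′ p k) ,
                                           BüchiWord.run⇒lasso em F (λ q q′ k → ed q q′ p k))
      (∃fin finite-Mat λ x → ∃fin finite-Mat λ e → ∃fin (Finite-Fin n) λ s →
        conj (const _) (dia x (splits-closed e)))
      where
        splits-closed : ∀ e → 𝒟 (λ p i → BüchiWord.Splits em F (λ q q′ k → ed q q′ p k) e i)
        splits-closed e = ∀fin finite-Mat λ x → neg (dia x (neg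
          (∃fin finite-Mat λ y → conj (const _) (dia y
            (∃fin finite-Mat λ z → conj (const _) (iff-closed
               (λ p i → (λ (k , f , _) → k , f) , (λ (k , f) → k , f , tt)) (dia z true-closed)))))))

-- Fragments and testing automata

record Fragment (m : ℕ) (Sym : Set) : Set₁ where
  field
    InS : SF m → Set
    InP : PF m → Set
    in-⊤  : InS ⊤ˢ
    in-prop : ∀ p → InS (prop p)
    in-¬  : ∀ {φ} → InS φ → InS (¬ˢ φ)
    in-∧  : ∀ {φ ψ} → InS φ → InS ψ → InS (φ ∧ˢ ψ)
    in-E  : ∀ {ψ} → InP ψ → InS (E ψ)
    in-D  : ∀ {k φ} → (Sym → k ≡ 0) → InS φ → InS (D[1+ k ] φ)
    in-st : ∀ {φ} → InS φ → InP (st φ)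
    in-¬ᵖ : ∀ {ψ} → InP ψ → InP (¬ᵖ ψ)
    in-∧ᵖ : ∀ {ψ χ} → InP ψ → InP χ → InP (ψ ∧ᵖ χ)

dynamic : ∀ m Sym → Fragment m Sym
dynamic m Sym = record
  { InS = λ φ → DynamicS φ × (Sym → NoCountS φ)
  ; InP = λ ψ → DynamicP ψ × (Sym → NoCountP ψ)
  ; in-⊤ = tt , λ _ → tt
  ; in-prop = λ _ → tt , λ _ → tt
  ; in-¬ = λ x → x
  ; in-∧ = λ (d , c) (d′ , c′) → (d , d′) , λ s → c s , c′ s
  ; in-E = λ x → x
  ; in-D = λ k (d , c) → d , λ s → k s , c s
  ; in-st = λ x → x
  ; in-¬ᵖ = λ x → x
  ; in-∧ᵖ = λ (d , c) (d′ , c′) → (d , d′) , λ s → c s , c′ s }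

temporal : ∀ m Sym → Fragment m Sym
temporal m Sym = record
  { InS = λ φ → TemporalS φ × (Sym → NoCountS φ)
  ; InP = λ ψ → TemporalP ψ × (Sym → NoCountP ψ)
  ; in-⊤ = tt , λ _ → tt
  ; in-prop = λ _ → tt , λ _ → tt
  ; in-¬ = λ x → x
  ; in-∧ = λ (d , c) (d′ , c′) → (d , d′) , λ s → c s , c′ s
  ; in-E = λ x → x
  ; in-D = λ k (d , c) → d , λ s → k s , c s
  ; in-st = λ x → x
  ; in-¬ᵖ = λ x → x
  ; in-∧ᵖ = λ (d , c) (d′ , c′) → (d , d′) , λ s → c s , c′ s }

TreePath : ℕ → Set₁
TreePath m = Σ[ t ∈ KTree m ] IPath t

_⟪_⟫_ : ∀ {m} → TreePath m → PF m → ℕ → Set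
(t , ρ) ⟪ ψ ⟫ i = _,_⊨ᵖ_ t ρ i ψ

Definable : ∀ {m} → (PF m → Set) → Pred (TreePath m) → Set₁
Definable {m} InP P = Σ[ ψ ∈ PF m ] (InP ψ × (∀ p i → (p ⟪ ψ ⟫ i) ⇔ P p i))

module _ {m : ℕ} {Sym : Set} (fr : Fragment m Sym) where
  open Fragment fr

  definable-closed : Closed (Definable InP)
  definable-closed = record
    { iff-closed = λ h (ψ , c , eqv) → ψ , c , λ p i → ⇔-trans (eqv p i) (h p i)
    ; true-closed = st ⊤ˢ , in-st in-⊤ , λ p i → (λ x → x) , (λ x → x)
    ; neg = λ (ψ , c , eqv) → ¬ᵖ ψ , in-¬ᵖ c , λ p i →
        (λ n x → n (proj₂ (eqv p i) x)) , (λ n x → n (proj₁ (eqv p i) x))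
    ; conj = λ (ψ , c , eqv) (ψ′ , c′ , eqv′) → ψ ∧ᵖ ψ′ , in-∧ᵖ c c′ , λ p i →
        (λ (x , y) → proj₁ (eqv p i) x , proj₁ (eqv′ p i) y) ,
        (λ (x , y) → proj₂ (eqv p i) x , proj₂ (eqv′ p i) y) }

module _ (m : ℕ) (Sym : Set) where

  temporal-next : ∀ {P} → Definable (Fragment.InP (temporal m Sym)) P →
                  Definable (Fragment.InP (temporal m Sym)) (λ p i → P p (suc i))
  temporal-next (ψ , c , eqv) = X ψ , c , λ p i → eqv p (suc i)

  temporal-until : ∀ {P Q} → Definable (Fragment.InP (temporal m Sym)) P → Definable (Fragment.InP (temporal m Sym)) Q →
                   Definable (Fragment.InP (temporal m Sym)) (Until P Q)
  temporal-until (ψ , (c , s) , eqv) (χ , (c′ , s′) , eqv′) = ψ U χ , ((c , c′) , λ y → s y , s′ y) , λ p i →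
    (λ (j , i≤j , h , f) → j , i≤j , proj₁ (eqv′ p j) h , λ l a b → proj₁ (eqv p l) (f l a b)) ,
    (λ (j , i≤j , h , f) → j , i≤j , proj₂ (eqv′ p j) h , λ l a b → proj₂ (eqv p l) (f l a b))

module TestAutomaton (em : EM₀) (m : ℕ) (Sym : Set) {A : Set} (fin : Finite A) (_·_ : A → A → A) (e : A)
  (β : A → Pred (TreePath m)) (β-definable : ∀ x → Definable (Fragment.InP (dynamic m Sym)) (β x))
  (β-total : ∀ p i → Σ[ x ∈ A ] β x p i) where
  open Classical em

  -- A state holds the value still to be read and the current letter, the latter enforced by the test.
  states : Finite (A × A)
  states = Finite-× fin fin

  open Finite states

  value current : Fin size → A
  value q = proj₁ (enum q)
  current q = proj₂ (enum q)

  automaton : A → TestAut m (PF m)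
  automaton x = mkTA size
    (λ q → bool (value q ≡ x))
    (λ q _ q′ → bool (value q ≡ (current q · value q′)))
    (λ q → bool (value q ≡ e))
    (λ q → proj₁ (β-definable (current q)))

  module _ (p : TreePath m) where

    Factor : ℕ → A → ℕ → Set
    Factor = Seg _·_ e (λ x k → β x p k)

    read : ∀ {r : ℕ → Fin size} {j} d i → d + i ≡ j →
           (∀ l → i ≤ l → l < j → value (r l) ≡ (current (r l) · value (r (suc l)))) →
           value (r j) ≡ e → (∀ l → i ≤ l → l ≤ j → β (current (r l)) p l) → Factor i (value (r i)) j
    read zero i refl tr fi te = subst (λ x → Factor i x i) (sym fi) nil
    read {r} {j} (suc d) i eq tr fi te = subst (λ x → Factor i x j) (sym (tr i ℕₚ.≤-refl i<j))
      (cons (te i ℕₚ.≤-refl (ℕₚ.<⇒≤ i<j))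
        (read {r} d (suc i) (trans (ℕₚ.+-suc d i) eq) (λ l i<l → tr l (ℕₚ.<⇒≤ i<l)) fi (λ l i<l → te l (ℕₚ.<⇒≤ i<l))))
      where
        i<j : i < j
        i<j = subst (i <_) eq (s≤s (ℕₚ.m≤n+m i d))

    run : ∀ {i x j} → Factor i x j → ℕ → A × A
    run nil l = e , proj₁ (β-total p l)
    run {i} (cons {x = x} {y} _ s) l with l ℕₚ.≟ i
    ... | yes _ = x · y , x
    ... | no _ = run s l

    run-start : ∀ {i x j} (s : Factor i x j) → proj₁ (run s i) ≡ x
    run-start nil = refl
    run-start {i} (cons b s) with i ℕₚ.≟ i
    ... | yes _ = refl
    ... | no n = ⊥-elim (n refl)

    run-later : ∀ {i x y j} (b : β x p i) (s : Factor (suc i) y j) {l} → suc i ≤ l → run (cons b s) l ≡ run s l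
    run-later {i} b s {l} i<l with l ℕₚ.≟ i
    ... | yes refl = ⊥-elim (ℕₚ.<-irrefl refl i<l)
    ... | no _ = refl

    run-first : ∀ {i x y j} (b : β x p i) (s : Factor (suc i) y j) → run (cons b s) i ≡ (x · y , x)
    run-first {i} b s with i ℕₚ.≟ i
    ... | yes _ = refl
    ... | no n = ⊥-elim (n refl)

    run-trans : ∀ {i x j} (s : Factor i x j) l → i ≤ l → l < j →
                proj₁ (run s l) ≡ (proj₂ (run s l) · proj₁ (run s (suc l)))
    run-trans nil l i≤l l<i = ⊥-elim (ℕₚ.<⇒≱ l<i i≤l)
    run-trans {i} (cons {x = x} b s) l i≤l l<j with ℕₚ.m≤n⇒m<n∨m≡n i≤l
    ... | inj₁ i<l = subst₂ (λ u v → proj₁ u ≡ (proj₂ u · proj₁ v)) (sym (run-later b s i<l))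
                       (sym (run-later b s (ℕₚ.m≤n⇒m≤1+n i<l))) (run-trans s l i<l l<j)
    ... | inj₂ refl = subst₂ (λ u v → proj₁ u ≡ (proj₂ u · proj₁ v)) (sym (run-first b s))
                       (sym (run-later b s ℕₚ.≤-refl)) (cong (x ·_) (sym (run-start s)))

    run-end : ∀ {i x j} (s : Factor i x j) → proj₁ (run s j) ≡ e
    run-end nil = refl
    run-end (cons b s) = trans (cong proj₁ (run-later b s (Seg-≤ s))) (run-end s)

    run-test : ∀ {i x j} (s : Factor i x j) l → i ≤ l → l ≤ j → β (proj₂ (run s l)) p l
    run-test nil l i≤l l≤i = proj₂ (β-total p l)
    run-test (cons b s) l i≤l l≤j with ℕₚ.m≤n⇒m<n∨m≡n i≤l
    ... | inj₁ i<l = subst (λ u → β (proj₂ u) p l) (sym (run-later b s i<l)) (run-test s l i<l l≤j)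
    ... | inj₂ refl = subst (λ u → β (proj₂ u) p l) (sym (run-first b s)) b

  dia : ∀ x {ψ} → Definable (Fragment.InP (dynamic m Sym)) ψ →
        Definable (Fragment.InP (dynamic m Sym)) (λ p i → Σ[ j ∈ ℕ ] (Seg _·_ e (λ y k → β y p k) i x j × ψ p j))
  dia x {P} (ψ , (d , c) , eqv) =
    ⟨ automaton x ⟩ ψ ,
    (((λ q → proj₁ (proj₁ (proj₂ (β-definable (current q))))) , d) ,
     (λ y → (λ q → proj₂ (proj₁ (proj₂ (β-definable (current q)))) y) , c y)) ,
    λ p i →
      (λ (j , i≤j , r , ini , tr , fi , te , h) → j ,
        subst (λ x → Factor p i x j) (bool⁻ ini)
          (read p {r} (j ∸ i) i (ℕₚ.m∸n+n≡m i≤j) (λ l a b → bool⁻ (tr l a b)) (bool⁻ fi)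
            (λ l a b → proj₁ (proj₂ (proj₂ (β-definable (current (r l)))) p l) (te l a b))) ,
        proj₁ (eqv p j) h) ,
      (λ (j , s , h) → let r = λ l → code (run p s l) ; ec = λ l → enum-code (run p s l) in
        j , Seg-≤ s , r ,
        bool⁺ (trans (cong proj₁ (ec i)) (run-start p s)) ,
        (λ l a b → bool⁺ (trans (cong proj₁ (ec l)) (trans (run-trans p s l a b)
           (sym (cong₂ _·_ (cong proj₂ (ec l)) (cong proj₁ (ec (suc l)))))))) ,
        bool⁺ (trans (cong proj₁ (ec j)) (run-end p s)) ,
        (λ l a b → proj₂ (proj₂ (proj₂ (β-definable (current (r l)))) p l)
           (subst (λ u → β (proj₂ u) p l) (sym (ec l)) (run-test p s l a b))) ,
        proj₂ (eqv p j) h)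

-- Transition monoids of counter-free automata

data Power {N : ℕ} (R : Fin N → Fin N → Set) : ℕ → Fin N → Fin N → Set where
  nil  : ∀ {y} → Power R 0 y y
  cons : ∀ {k y y′ z} → R y y′ → Power R k y′ z → Power R (suc k) y z

module _ {N : ℕ} {R : Fin N → Fin N → Set} where

  _++ʷ_ : ∀ {k l y z w} → Power R k y z → Power R l z w → Power R (k + l) y w
  nil ++ʷ q = q
  cons r p ++ʷ q = cons r (p ++ʷ q)

  visited : ∀ {k y z} → Power R k y z → Fin (suc k) → Fin N
  visited {y = y} _ fz = y
  visited (cons _ p) (fs i) = visited p i

  split-at : ∀ {k y z} (p : Power R k y z) i → Power R (toℕ i) y (visited p i) × Power R (k ∸ toℕ i) (visited p i) z
  split-at p fz = nil , p
  split-at (cons r p) (fs i) = let (a , b) = split-at p i in cons r a , b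

  split-twice : ∀ {k y z} (p : Power R k y z) i j → i <ᶠ j →
    Power R (toℕ i) y (visited p i) × Power R (toℕ j ∸ toℕ i) (visited p i) (visited p j) ×
    Power R (k ∸ toℕ j) (visited p j) z
  split-twice (cons r p) fz (fs j) _ = let (a , b) = split-at p j in nil , cons r a , b
  split-twice (cons r p) (fs i) (fs j) (s≤s i<j) = let (a , b , c) = split-twice p i j i<j in cons r a , b , c

  -- A long path repeats a state s; the loop there can be lengthened or shortened by one since R s s.
  module _ (loops : ∀ {k y} → Power R (suc k) y y → R y y) where

    record Repetition (k : ℕ) (y z : Fin N) : Set where
      field
        {s}    : Fin N
        {a b c} : ℕ
        before : Power R a y s
        loop   : Power R (suc b) s s
        after  : Power R c s z
        total  : a + (suc b + c) ≡ k

    repetition : ∀ {k y z} → N ≤ k → Power R k y z → Repetition k y z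
    repetition {k} {y} {z} N≤k p with Finₚ.pigeonhole (s≤s N≤k) (visited p)
    ... | i , j , i<j , eq with split-twice p i j i<j
    ... | before , loop , after with toℕ j ∸ toℕ i in d
    ...   | zero = ⊥-elim (ℕₚ.<⇒≱ i<j (ℕₚ.m∸n≡0⇒m≤n d))
    ...   | suc b = record
            { before = before ; loop = subst (Power R (suc b) _) (sym eq) loop
            ; after = subst (λ s → Power R (k ∸ toℕ j) s z) (sym eq) after
            ; total = begin
                toℕ i + (suc b + (k ∸ toℕ j))            ≡⟨ ℕₚ.+-assoc (toℕ i) (suc b) _ ⟨
                toℕ i + suc b + (k ∸ toℕ j)              ≡⟨ cong (λ d → toℕ i + d + (k ∸ toℕ j)) d ⟨
                toℕ i + (toℕ j ∸ toℕ i) + (k ∸ toℕ j)    ≡⟨ cong (_+ (k ∸ toℕ j)) (ℕₚ.m+[n∸m]≡n (ℕₚ.<⇒≤ i<j)) ⟩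
                toℕ j + (k ∸ toℕ j)                      ≡⟨ ℕₚ.m+[n∸m]≡n (s≤s⁻¹ (Finₚ.toℕ<n j)) ⟩
                k ∎ }
      where open ≡-Reasoning

    repeat : ∀ {s} k → R s s → Power R k s s
    repeat zero r = nil
    repeat (suc k) r = cons r (repeat k r)

    lengthen : ∀ {k y z} → N ≤ k → Power R k y z → Power R (suc k) y z
    lengthen {k} {y} {z} N≤k p = subst (λ k → Power R k y z) (trans (ℕₚ.+-suc a (suc b + c)) (cong suc total))
      (before ++ʷ (cons (loops loop) (loop ++ʷ after)))
      where open Repetition (repetition N≤k p)

    shorten : ∀ {k y z} → N ≤ k → Power R (suc k) y z → Power R k y z
    shorten {k} {y} {z} N≤k p = subst (λ k → Power R k y z) (ℕₚ.suc-injective (trans (sym (ℕₚ.+-suc a (b + c))) total))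
      (before ++ʷ (repeat b (loops loop) ++ʷ after))
      where open Repetition (repetition (ℕₚ.m≤n⇒m≤1+n N≤k) p)

data ListPath {n : ℕ} {Λ : Set} (T : Λ → Fin n → Fin n → Set) : Fin n → List Λ → Fin n → Set where
  nil  : ∀ {q} → ListPath T q [] q
  cons : ∀ {q q′ q″ l ρ} → T l q q′ → ListPath T q′ ρ q″ → ListPath T q (l ∷ ρ) q″

ListPath-++ : ∀ {n Λ} {T : Λ → Fin n → Fin n → Set} {q q′ q″ ρ σ} →
              ListPath T q ρ q′ → ListPath T q′ σ q″ → ListPath T q (ρ ++ σ) q″
ListPath-++ nil p = p
ListPath-++ (cons t p) p′ = cons t (ListPath-++ p p′)

module CounterFreeMonoid (em : EM₀) {n : ℕ} (F : Fin n → Set) {Λ : Set} (T : Λ → Fin n → Fin n → Set)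
  (counter-free : ∀ k ρ {q} → ListPath T q (concat (replicate (suc k) ρ)) q → ListPath T q ρ q) where
  open Doubled F
  open Matrices em (n * 2)

  transition : Λ → Mat
  transition l = mat (double (T l))

  value : List Λ → Mat
  value [] = one
  value (l ∷ ρ) = transition l ⊙ value ρ

  value-++ : ∀ ρ σ → value (ρ ++ σ) ≡ value ρ ⊙ value σ
  value-++ [] σ = sym (⊙-idˡ _)
  value-++ (l ∷ ρ) σ = trans (cong (transition l ⊙_) (value-++ ρ σ)) (sym (⊙-assoc (transition l) (value ρ) (value σ)))

  entry-path : ∀ ρ {y z} → Entry (value ρ) y z → ListPath T (state y) ρ (state z)
  entry-path [] {y} h = subst (λ z → ListPath T (state y) [] (state z)) (mat⁻ h) nil
  entry-path (l ∷ ρ) h = let (s , tr , h′) = mat⁻ h in cons (proj₁ (mat⁻ tr)) (entry-path ρ h′)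

  path-entry : ∀ {ρ q q′} b → ListPath T q ρ q′ → Entry (value ρ) (with-flag q b) (with-flag q′ b)
  path-entry b nil = mat⁺ refl
  path-entry b (cons {l = l} t p) = mat⁺ (_ , mat⁺ (subst₂ (T l) (sym (state-with-flag _ b)) (sym (state-with-flag _ b)) t ,
    inj₁ (trans (flag-with-flag _ b) (sym (flag-with-flag _ b)))) , path-entry b p)

  power-path : ∀ {ρ k y z} → Power (Entry (value ρ)) k y z → ListPath T (state y) (concat (replicate k ρ)) (state z)
  power-path nil = nil
  power-path {ρ} (cons r p) = ListPath-++ (entry-path ρ r) (power-path p)

  loops : ∀ {ρ k y} → Power (Entry (value ρ)) (suc k) y y → Entry (value ρ) y y
  loops {ρ} {k} {y} p = subst (λ z → Entry (value ρ) z z) (Finₚ.combine-remQuot {n} 2 y)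
    (path-entry (flag y) (counter-free k ρ (power-path p)))

  power-entry : ∀ {x} k {y z} → Entry (power _⊙_ one x k) y z ⇔ Power (Entry x) k y z
  power-entry zero {y} = (λ h → subst (Power _ 0 y) (mat⁻ h) nil) , (λ { nil → mat⁺ refl })
  power-entry (suc k) =
    (λ h → let (_ , r , h′) = mat⁻ h in cons r (proj₁ (power-entry k) h′)) ,
    (λ { (cons r p) → mat⁺ (_ , r , proj₂ (power-entry k) p) })

  transitionMonoid : AperiodicMonoid Mat
  transitionMonoid = record
    { monoid = record
        { S = λ x → Σ[ ρ ∈ List Λ ] x ≡ value ρ ; _·_ = _⊙_ ; e = one ; S-e = [] , refl
        ; S-· = λ { (ρ , refl) (σ , refl) → ρ ++ σ , sym (value-++ ρ σ) }
        ; assoc = λ {x} {y} {z} _ _ _ → ⊙-assoc x y z ; idˡ = λ _ → ⊙-idˡ _ ; idʳ = λ _ → ⊙-idʳ _ }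
    ; index = n * 2
    ; aperiodic = λ { (ρ , refl) → Mat-ext λ y z →
        ⇔-trans (power-entry (n * 2)) (⇔-trans (lengthen (loops {ρ}) ℕₚ.≤-refl , shorten (loops {ρ}) ℕₚ.≤-refl)
          (⇔-sym (power-entry (suc (n * 2))))) } }

  ∈-monoid : ∀ l → AperiodicMonoid.S transitionMonoid (transition l)
  ∈-monoid l = (l ∷ []) , sym (⊙-idʳ _)

-- Constraints, parity and runs as transition systems

AtLeast-map : ∀ {m} (t : KTree m) {w k} {P Q : KTree.Dir t → Set} →
  (∀ d → KTree.Node t (d ∷ w) → P d → Q d) → AtLeast t w k P → AtLeast t w k Q
AtLeast-map t h (f , inj , g) = f , inj , λ i → proj₁ (g i) , h (f i) (proj₁ (g i)) (proj₂ (g i))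

SatB-mono : ∀ {n} {I J : Subset n} α → (∀ q → MentionsB q α → q ∈ I → q ∈ J) → I ⊨ᵇ α → J ⊨ᵇ α
SatB-mono tt h s = tt
SatB-mono (var q) h s = h q refl s
SatB-mono (α ∧ᵇ β) h (a , b) = SatB-mono α (λ q x → h q (inj₁ x)) a , SatB-mono β (λ q x → h q (inj₂ x)) b
SatB-mono (α ∨ᵇ β) h (inj₁ a) = inj₁ (SatB-mono α (λ q x → h q (inj₁ x)) a)
SatB-mono (α ∨ᵇ β) h (inj₂ b) = inj₂ (SatB-mono β (λ q x → h q (inj₂ x)) b)

module _ {m n : ℕ} (t : KTree m) {w : List (KTree.Dir t)} {I J : KTree.Dir t → Subset n} where
  open KTree t

  SatA-mono : ∀ x → (∀ d q → Node (d ∷ w) → MentionsA q x → q ∈ I d → q ∈ J d) → SatA t w I x → SatA t w J x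
  SatA-mono (◇[1+ k ] α) h s = AtLeast-map t (λ d nd → SatB-mono α (λ q → h d q nd)) s
  SatA-mono (□[1+ k ] α) h s a = s (AtLeast-map t {P = λ d → ¬ (J d ⊨ᵇ α)} (λ d nd nj i → nj (SatB-mono α (λ q → h d q nd) i)) a)

  SatC-mono : ∀ θ → (∀ d q → Node (d ∷ w) → MentionsC q θ → q ∈ I d → q ∈ J d) → SatC t w I θ → SatC t w J θ
  SatC-mono ⊤ᶜ h s = tt
  SatC-mono (θ ∨ᶜ η) h (inj₁ s) = inj₁ (SatC-mono θ (λ d q nd x → h d q nd (inj₁ x)) s)
  SatC-mono (θ ∨ᶜ η) h (inj₂ s) = inj₂ (SatC-mono η (λ d q nd x → h d q nd (inj₂ x)) s)
  SatC-mono (θ ∧ᶜ η) h (s , s′) =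
    SatC-mono θ (λ d q nd x → h d q nd (inj₁ x)) s , SatC-mono η (λ d q nd x → h d q nd (inj₂ x)) s′
  SatC-mono (at x) h s = SatA-mono x h s

module _ {m n : ℕ} (t : KTree m) {w : List (KTree.Dir t)} {I : KTree.Dir t → Subset n} where

  Con⁺ : ∀ {As} → All (SatA t w I) As → SatC t w I (Con As)
  Con⁺ [] = tt
  Con⁺ (a ∷ as) = a , Con⁺ as

  Con⁻ : ∀ {As} → SatC t w I (Con As) → All (SatA t w I) As
  Con⁻ {[]} _ = []
  Con⁻ {_ ∷ _} (a , as) = a ∷ Con⁻ as

  Dis⁺ : ∀ {As} → Any (SatA t w I) As → SatC t w I (Dis As)
  Dis⁺ (here a) = inj₁ a
  Dis⁺ (there as) = inj₂ (Dis⁺ as)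

  Dis⁻ : ∀ {As} → SatC t w I (Dis As) → Any (SatA t w I) As
  Dis⁻ {_ ∷ _} (inj₁ a) = here a
  Dis⁻ {_ ∷ _} (inj₂ as) = there (Dis⁻ as)

  DisE⁺ : ∀ {L q As} → (q , As) LM.∈ L → SatA t w I (◇[1+ 0 ] var q) → All (SatA t w I) As → SatC t w I (DisE L)
  DisE⁺ (here refl) s as = inj₁ (s , Con⁺ as)
  DisE⁺ (there mem) s as = inj₂ (DisE⁺ mem s as)

  DisE⁻ : ∀ {L} → SatC t w I (DisE L) →
          Σ[ q ∈ Fin n ] Σ[ As ∈ List (Atom n) ] ((q , As) LM.∈ L × SatA t w I (◇[1+ 0 ] var q) × All (SatA t w I) As)
  DisE⁻ {(q , As) ∷ L} (inj₁ (s , as)) = q , As , here refl , s , Con⁻ as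
  DisE⁻ {_ ∷ L} (inj₂ s) = let (q , As , mem , r) = DisE⁻ {L} s in q , As , there mem , r

  ConU⁺ : ∀ {L} → (∀ {q As} → (q , As) LM.∈ L → SatA t w I (□[1+ 0 ] var q) ⊎ Any (SatA t w I) As) → SatC t w I (ConU L)
  ConU⁺ {[]} h = tt
  ConU⁺ {(q , As) ∷ L} h with h (here refl)
  ... | inj₁ s = inj₁ s , ConU⁺ {L} (λ mem → h (there mem))
  ... | inj₂ s = inj₂ (Dis⁺ s) , ConU⁺ {L} (λ mem → h (there mem))

  ConU⁻ : ∀ {L q As} → SatC t w I (ConU L) → (q , As) LM.∈ L → SatA t w I (□[1+ 0 ] var q) ⊎ Any (SatA t w I) As
  ConU⁻ (inj₁ s , _) (here refl) = inj₁ s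
  ConU⁻ (inj₂ s , _) (here refl) = inj₂ (Dis⁻ s)
  ConU⁻ (_ , s) (there mem) = ConU⁻ s mem

ParityOK-cong : ∀ {f g : ℕ → ℕ} → (∀ i → f i ≡ g i) → ParityOK f → ParityOK g
ParityOK-cong h (p , ev , (N , le) , inf) = p , ev , (N , λ i l → subst (_≤ p) (h i) (le i l)) ,
  λ k → let (i , l , eq) = inf k in i , l , trans (sym (h i)) eq

ParityOK-tail : ∀ {f : ℕ → ℕ} → ParityOK f → ParityOK (λ i → f (suc i))
ParityOK-tail (p , ev , (N , le) , inf) = p , ev , (N , λ i l → le (suc i) (ℕₚ.m≤n⇒m≤1+n l)) , later
  where
    later : ∀ k → _
    later k with inf (suc k)
    ... | suc i , s≤s l , eq = i , l , eq

ParityOK-drop : ∀ {f : ℕ → ℕ} K → ParityOK (λ i → f (K + i)) → ParityOK f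
ParityOK-drop {f} K (p , ev , (N , le) , inf) = p , ev ,
  (K + N , λ i l → subst (λ i → f i ≤ p) (ℕₚ.m+[n∸m]≡n (ℕₚ.≤-trans (ℕₚ.m≤m+n K N) l))
     (le (i ∸ K) (subst (_≤ i ∸ K) (ℕₚ.m+n∸m≡n K N) (ℕₚ.∸-monoˡ-≤ K l)))) ,
  λ k → let (i , l , eq) = inf k in K + i , ℕₚ.≤-trans l (ℕₚ.m≤n+m i K) , eq

module ParityLemmas (em : EM₀) where
  open Classical em

  büchi⁻ : ∀ {f} → ParityOK f → Infinite (λ i → Even (f i))
  büchi⁻ (p , ev , _ , inf) k = let (i , l , eq) = inf k in i , l , subst Even (sym eq) ev

  büchi⁺ : ∀ {f o} → Odd o → (∀ i → f i ≡ o ⊎ f i ≡ suc o) → Infinite (λ i → Even (f i)) → ParityOK f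
  büchi⁺ {f} {o} odd vals inf =
    suc o , subst Even (high 0) (proj₂ (proj₂ (inf 0))) , (0 , λ i _ → le i) ,
    λ k → let (i , l , _) = inf k in i , l , high k
    where
      le : ∀ i → f i ≤ suc o
      le i with vals i
      ... | inj₁ eq = ℕₚ.≤-trans (ℕₚ.≤-reflexive eq) (ℕₚ.n≤1+n o)
      ... | inj₂ eq = ℕₚ.≤-reflexive eq
      high : ∀ k → f (proj₁ (inf k)) ≡ suc o
      high k with vals (proj₁ (inf k))
      ... | inj₁ eq = ⊥-elim (odd (subst Even eq (proj₂ (proj₂ (inf k)))))
      ... | inj₂ eq = eq

  cobüchi⁻ : ∀ {f e} → Even e → (∀ i → f i ≡ e ⊎ f i ≡ suc e) → ParityOK f → ¬ Infinite (λ i → Odd (f i))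
  cobüchi⁻ {f} {e} even vals (p , ev , (N , le) , inf) odds with odds N
  ... | i , N≤i , odd with vals i
  ... | inj₁ eq = odd (subst Even (sym eq) even)
  ... | inj₂ eq with inf 0
  ... | j , _ , fj≡p with vals j
  ... | inj₁ eq′ = ℕₚ.<-irrefl refl (ℕₚ.≤-trans (ℕₚ.≤-reflexive (sym eq)) (ℕₚ.≤-trans (le i N≤i) (ℕₚ.≤-reflexive (trans (sym fj≡p) eq′))))
  ... | inj₂ eq′ = odd (subst Even (trans (sym fj≡p) (trans eq′ (sym eq))) ev)

  cobüchi⁺ : ∀ {f e} → Even e → (∀ i → f i ≡ e ⊎ f i ≡ suc e) → ¬ Infinite (λ i → Odd (f i)) → ParityOK f
  cobüchi⁺ {f} {e} even vals fin with ¬∀⇒∃¬ fin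
  ... | N , none = e , even , (N , λ i l → ℕₚ.≤-reflexive (low i l)) , λ k → N ⊔ k , ℕₚ.m≤n⊔m N k , low (N ⊔ k) (ℕₚ.m≤m⊔n N k)
    where
      2≢1 : ¬ (2 ≡ 1)
      2≢1 ()
      low : ∀ i → N ≤ i → f i ≡ e
      low i l with vals i
      ... | inj₁ eq = eq
      ... | inj₂ eq = ⊥-elim (none (i , l , λ ev →
              2≢1 (∣1⇒≡1 (∣m+n∣m⇒∣n (subst Even (trans eq (ℕₚ.+-comm 1 e)) ev) even))))

  eventually-constant : (f : ℕ → ℕ) → (∀ i → f (suc i) ≤ f i) → Σ[ K ∈ ℕ ] (∀ l → f (K + l) ≡ f K)
  eventually-constant f dec = search (f 0) 0 ℕₚ.≤-refl
    where
      decreasing : ∀ K l → f (K + l) ≤ f K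
      decreasing K zero = ℕₚ.≤-reflexive (cong f (ℕₚ.+-identityʳ K))
      decreasing K (suc l) = ℕₚ.≤-trans (ℕₚ.≤-reflexive (cong f (ℕₚ.+-suc K l))) (ℕₚ.≤-trans (dec (K + l)) (decreasing K l))
      search : ∀ b K → f K ≤ b → Σ[ K ∈ ℕ ] (∀ l → f (K + l) ≡ f K)
      search b K fK≤b with em {Σ[ l ∈ ℕ ] f (K + l) < f K}
      search b K fK≤b | no none = K , λ l → ℕₚ.≤-antisym (decreasing K l) (ℕₚ.≮⇒≥ (λ lt → none (l , lt)))
      search zero K fK≤b | yes (l , lt) = ⊥-elim (ℕₚ.n≮0 (ℕₚ.≤-trans lt fK≤b))
      search (suc b) K fK≤b | yes (l , lt) = search b (K + l) (s≤s⁻¹ (ℕₚ.≤-trans lt fK≤b))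

-- A run presented as a transition system: nodes may share histories, and next is only meaningful
-- along the obligations prescribed by interp.
record System {m n : ℕ} (B : GTA m n) (t : KTree m) : Set₁ where
  open GTA B
  open KTree t
  field
    Pos    : Set
    state  : Pos → Fin n
    word   : Pos → List Dir
    interp : Pos → Dir → Subset n
    next   : Pos → Fin n → Dir → Pos

  Child : Pos → Fin n → Dir → Set
  Child ν q d = Node (d ∷ word ν) × q ∈ interp ν d

  field
    node       : ∀ ν → Node (word ν)
    next-state : ∀ {ν q d} → Child ν q d → state (next ν q d) ≡ q
    next-word  : ∀ {ν q d} → Child ν q d → word (next ν q d) ≡ d ∷ word ν
    sat        : ∀ ν → SatC t (word ν) (interp ν) (δ (state ν) (lab (word ν)))
    accepting  : ∀ (ν : ℕ → Pos) (q : ℕ → Fin n) (d : ℕ → Dir) →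
                 (∀ k → Child (ν k) (q k) (d k)) → (∀ k → ν (suc k) ≡ next (ν k) (q k) (d k)) →
                 ParityOK (λ k → Ω (state (ν k)))

module _ {m n : ℕ} {B : GTA m n} {t : KTree m} where
  open GTA B
  open KTree t

  system⇒accepts : (S : System B t) (ν : System.Pos S) → System.state S ν ≡ q₀ → System.word S ν ≡ [] → Accepts B t
  system⇒accepts S ν₀ st₀ wd₀ = R , sat′ , acc′
    where
      open System S
      pos : RNode B t → Pos
      pos [] = ν₀
      pos ((q , d) ∷ r) = next (pos r) q d
      R : Run B t
      R = record { interp = λ r → interp (pos r) }
      labels : ∀ r → Run.ValidRN R r → state (pos r) ≡ rstate B t r × word (pos r) ≡ rword B t r
      child : ∀ r q d → Run.ValidRN R ((q , d) ∷ r) → Child (pos r) q d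
      labels [] _ = st₀ , wd₀
      labels ((q , d) ∷ r) v = next-state (child r q d v) ,
        trans (next-word (child r q d v)) (cong (d ∷_) (proj₂ (labels r (proj₁ v))))
      child r q d (v , nd , mem) = subst (λ w → Node (d ∷ w)) (sym (proj₂ (labels r v))) nd , mem
      sat′ : ∀ r → Run.ValidRN R r → SatC t (rword B t r) (interp (pos r)) (δ (rstate B t r) (lab (rword B t r)))
      sat′ r v = subst₂ (λ q w → SatC t w (interp (pos r)) (δ q (lab w))) (proj₁ (labels r v)) (proj₂ (labels r v)) (sat (pos r))
      acc′ : ∀ s → (∀ i → Run.ValidRN R (branchNode B t s i)) → ParityOK (λ i → Ω (rstate B t (branchNode B t s i)))
      acc′ s v = ParityOK-cong (λ i → cong Ω (proj₁ (labels (branchNode B t s i) (v i))))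
        (accepting (λ k → pos (branchNode B t s k)) (λ k → proj₁ (s k)) (λ k → proj₂ (s k))
          (λ k → child (branchNode B t s k) _ _ (v (suc k))) (λ k → refl))

  module FromRun (em : EM₀) (acc : Accepts B t) (root : Node []) where
    R = proj₁ acc
    open Run R

    branch : RNode B t → (ℕ → Fin n × Dir) → ℕ → RNode B t
    branch r s zero = r
    branch r s (suc i) = s i ∷ branch r s i

    branch-root : ∀ s i → branch [] s i ≡ branchNode B t s i
    branch-root s zero = refl
    branch-root s (suc i) = cong (s i ∷_) (branch-root s i)

    shift : Fin n × Dir → (ℕ → Fin n × Dir) → ℕ → Fin n × Dir
    shift x s zero = x
    shift x s (suc i) = s i

    branch-shift : ∀ x r s i → branch r (shift x s) (suc i) ≡ branch (x ∷ r) s i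
    branch-shift x r s zero = refl
    branch-shift x r s (suc i) = cong (s i ∷_) (branch-shift x r s i)

    branch-accepting : ∀ r s → (∀ i → ValidRN (branch r s i)) → ParityOK (λ i → Ω (rstate B t (branch r s i)))
    branch-accepting [] s v = ParityOK-cong (λ i → cong (λ r → Ω (rstate B t r)) (sym (branch-root s i)))
      (proj₂ (proj₂ acc) s (λ i → subst ValidRN (branch-root s i) (v i)))
    branch-accepting (x ∷ r) s v = ParityOK-cong (λ i → cong (λ r → Ω (rstate B t r)) (branch-shift x r s i))
      (ParityOK-tail (branch-accepting r (shift x s) v′))
      where
        v′ : ∀ i → ValidRN (branch r (shift x s) i)
        v′ zero = proj₁ (v 0)
        v′ (suc i) = subst ValidRN (sym (branch-shift x r s i)) (v i)

    Position : Set
    Position = Σ[ r ∈ RNode B t ] ValidRN r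

    Obliged : Position → Fin n → Dir → Set
    Obliged (r , _) q d = Node (d ∷ rword B t r) × q ∈ interp r d

    extend : Position → Fin n → Dir → Position
    extend ν@(r , v) q d with em {Obliged ν q d}
    ... | yes ob = (q , d) ∷ r , v , ob
    ... | no _ = ν

    extend-≡ : ∀ {ν q d} → Obliged ν q d → proj₁ (extend ν q d) ≡ (q , d) ∷ proj₁ ν
    extend-≡ {ν} {q} {d} ob with em {Obliged ν q d}
    ... | yes _ = refl
    ... | no n = ⊥-elim (n ob)

    valid-node : ∀ r → ValidRN r → Node (rword B t r)
    valid-node [] _ = root
    valid-node (_ ∷ r) (_ , nd , _) = nd

    system : System B t
    system = record
      { Pos = Position
      ; state = λ ν → rstate B t (proj₁ ν)
      ; word = λ ν → rword B t (proj₁ ν)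
      ; interp = λ ν → interp (proj₁ ν)
      ; next = extend
      ; node = λ (r , v) → valid-node r v
      ; next-state = λ {ν} ob → cong (rstate B t) (extend-≡ {ν} ob)
      ; next-word = λ {ν} ob → cong (rword B t) (extend-≡ {ν} ob)
      ; sat = λ (r , v) → proj₁ (proj₂ acc) r v
      ; accepting = λ ν q d ob eq →
          let s = λ k → q k , d k
              follows : ∀ k → branch (proj₁ (ν 0)) s k ≡ proj₁ (ν k)
              follows = λ k → along ν s ob eq k
          in ParityOK-cong (λ k → cong (λ r → Ω (rstate B t r)) (follows k))
               (branch-accepting (proj₁ (ν 0)) s (λ k → subst ValidRN (sym (follows k)) (proj₂ (ν k)))) }
      where
        along : ∀ (ν : ℕ → Position) s → (∀ k → Obliged (ν k) (proj₁ (s k)) (proj₂ (s k))) →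
                (∀ k → ν (suc k) ≡ extend (ν k) (proj₁ (s k)) (proj₂ (s k))) →
                ∀ k → branch (proj₁ (ν 0)) s k ≡ proj₁ (ν k)
        along ν s ob eq zero = refl
        along ν s ob eq (suc k) = trans (cong (s k ∷_) (along ν s ob eq k))
          (sym (trans (cong proj₁ (eq k)) (extend-≡ {ν k} (ob k))))

-- Hesitant automata

module _ {m : ℕ} {t : KTree m} where
  open KTree t
  open IPath

  tail : IPath t → IPath t
  tail ρ = record { π = λ i → π ρ (suc i) ; π-ok = proj₂ (proj₂ (step ρ 0)) ; step = λ i → step ρ (suc i) }

  prepend : ∀ {w d} (ρ : IPath t) → Node w → π ρ 0 ≡ d ∷ w → IPath t
  prepend {w} {d} ρ nd eq = record
    { π = λ { zero → w ; (suc i) → π ρ i }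
    ; π-ok = nd
    ; step = λ { zero → d , eq , π-ok ρ ; (suc i) → step ρ i } }

module Hesitant (em : EM₀) {m n : ℕ} (H : HGTA m n) where
  open Classical em
  open HGTA H
  open GTA gta

  Branch : Set
  Branch = Fin n × List (Atom n)

  branches-of : ∀ q (a : Subset m) {κ} → kind (comp q) ≡ κ → List Branch
  branches-of q a {transient} eq = []
  branches-of q a {existential} eq = proj₁ (existentialC q a eq)
  branches-of q a {universal} eq = proj₁ (universalC q a eq)

  branches : Fin n → Subset m → List Branch
  branches q a = branches-of q a refl

  branches-existential : ∀ q a → kind (comp q) ≡ existential →
                         δ q a ≡ DisE (branches q a) × All (WellScoped (comp q)) (branches q a)
  branches-existential q a eq = go refl eq
    where
      go : ∀ {κ} (eq : kind (comp q) ≡ κ) → κ ≡ existential →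
           δ q a ≡ DisE (branches-of q a eq) × All (WellScoped (comp q)) (branches-of q a eq)
      go eq refl = proj₂ (existentialC q a eq)

  branches-universal : ∀ q a → kind (comp q) ≡ universal →
                       δ q a ≡ ConU (branches q a) × All (WellScoped (comp q)) (branches q a)
  branches-universal q a eq = go refl eq
    where
      go : ∀ {κ} (eq : kind (comp q) ≡ κ) → κ ≡ universal →
           δ q a ≡ ConU (branches-of q a eq) × All (WellScoped (comp q)) (branches-of q a eq)
      go eq refl = proj₂ (universalC q a eq)

  branches-scoped : ∀ q a → All (WellScoped (comp q)) (branches q a)
  branches-scoped q a = go refl
    where
      go : ∀ {κ} (eq : kind (comp q) ≡ κ) → All (WellScoped (comp q)) (branches-of q a eq)
      go {transient} eq = []
      go {existential} eq = proj₂ (proj₂ (existentialC q a eq))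
      go {universal} eq = proj₂ (proj₂ (universalC q a eq))

  Recurring : Kind → ℕ → Set
  Recurring transient _ = ⊥
  Recurring existential p = Even p
  Recurring universal p = Odd p

  module _ (φ : Fin n → SF m) where

    module _ (t : KTree m) where
      open KTree t

      canonical : List Dir → Dir → Subset n
      canonical w d = setOf (λ q → _⊨ˢ_ t (d ∷ w) (φ q))

      Holds : List Dir → Atom n → Set
      Holds w x = SatA t w (canonical w) x

      Literal : Kind → List Dir → Atom n → Set
      Literal universal w x = ¬ Holds w x
      Literal _ w x = Holds w x

      -- A step of the linearization of component i; for universal components atoms are negated, so
      -- that runs are refutations.
      Edge : Fin c → List Dir → Fin n → Fin n → Set
      Edge i w q q′ = comp q ≡ i × Σ[ As ∈ List (Atom n) ] ((q′ , As) LM.∈ branches q (lab w) × All (Literal (kind i) w) As)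

      Witness : Fin c → IPath t → Fin n → Set
      Witness i ρ = InfiniteRun (λ q q′ k → Edge i (IPath.π ρ k) q q′) (λ q → Recurring (kind i) (Ω q)) 0

      WitnessPath : Fin c → List Dir → Fin n → Set
      WitnessPath i w q = Σ[ ρ ∈ IPath t ] (IPath.π ρ 0 ≡ w × Witness i ρ q)

      data Correct (w : List Dir) (q : Fin n) : Set where
        tr : kind (comp q) ≡ transient → SatC t w (canonical w) (δ q (lab w)) → Correct w q
        ex : ∀ {i} → comp q ≡ i → kind i ≡ existential → WitnessPath i w q → Correct w q
        un : ∀ {i} → comp q ≡ i → kind i ≡ universal → ¬ WitnessPath i w q → Correct w q

      edge-scope : ∀ {i w q q′} (e : Edge i w q q′) →
                   comp q′ ≡ i × All (λ x → ∀ q″ → MentionsA q″ x → comp q″ <ᶠ i) (proj₁ (proj₂ e))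
      edge-scope {w = w} {q} (refl , As , mem , _) = All.lookup (branches-scoped q (lab w)) mem

      Witness-tail : ∀ {i} ρ {q} (r : Witness i ρ q) → Witness i (tail ρ) (proj₁ r 1)
      Witness-tail ρ (r , _ , edge , inf) = (λ l → r (suc l)) , refl , (λ l → edge (suc l)) , inf′
        where
          inf′ : Infinite (λ l → Recurring _ (Ω (r (suc l))))
          inf′ k with inf (suc k)
          ... | suc l , s≤s k≤l , f = l , k≤l , f

      Witness-prepend : ∀ {i w d q q′} → Node w → Edge i w q q′ → WitnessPath i (d ∷ w) q′ → WitnessPath i w q
      Witness-prepend {i} {w} {d} {q} {q′} nd e (ρ , eq , r , refl , edge , inf) =
        prepend ρ nd eq , refl , (λ { zero → q ; (suc l) → r l }) , refl , (λ { zero → e ; (suc l) → edge l }) ,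
        λ k → let (l , k≤l , f) = inf k in suc l , ℕₚ.m≤n⇒m≤1+n k≤l , f

    Good : Fin n → Set₁
    Good q = ∀ t w → KTree.Node t w → (_⊨ˢ_ t w (φ q)) ⇔ Correct t w q

    module Canonical {k : ℕ} (good : ∀ q → toℕ (comp q) < k → Good q) (t : KTree m) where
      open KTree t
      open IPath

      record Position : Set where
        constructor pos
        field
          q       : Fin n
          w       : List Dir
          node    : Node w
          below   : toℕ (comp q) < k
          correct : Correct t w q

      Lower : Position → Fin n → Dir → Set
      Lower (pos q w _ _ _) q′ d = comp q′ <ᶠ comp q × _⊨ˢ_ t (d ∷ w) (φ q′)

      Same : Position → Fin n → Dir → Set
      Same (pos q w _ _ (tr _ _)) q′ d = ⊥
      Same (pos q w _ _ (ex _ _ (ρ , _ , r , _))) q′ d = d ∷ w ≡ π ρ 1 × q′ ≡ r 1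
      Same (pos q w _ _ (un _ _ _)) q′ d = Edge t (comp q) w q q′

      interp : Position → Dir → Subset n
      interp ν d = setOf (λ q′ → Lower ν q′ d ⊎ Same ν q′ d)

      Child : Position → Fin n → Dir → Set
      Child ν q′ d = Node (d ∷ Position.w ν) × q′ ∈ interp ν d

      enter : ∀ ν q′ d → Node (d ∷ Position.w ν) → Lower ν q′ d → Position
      enter ν@(pos q w _ below _) q′ d nd (lt , h) = pos q′ (d ∷ w) nd below′ (proj₁ (good q′ below′ t (d ∷ w) nd) h)
        where
          below′ : toℕ (comp q′) < k
          below′ = ℕₚ.<-trans lt below

      stay : ∀ ν q′ d → Node (d ∷ Position.w ν) → Same ν q′ d → Position
      stay (pos q w nd₀ below (ex refl eq (ρ , refl , r , refl , rest))) q′ d nd (wd , st′) =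
        pos (r 1) (π ρ 1) (subst Node wd nd) (subst (λ i → toℕ i < k) (sym same) below)
          (ex same eq (tail ρ , refl , Witness-tail t ρ (r , refl , rest)))
        where
          same : comp (r 1) ≡ comp (r 0)
          same = proj₁ (edge-scope t (proj₁ rest 0))
      stay (pos q w nd₀ below (un refl eq none)) q′ d nd e =
        pos q′ (d ∷ w) nd (subst (λ i → toℕ i < k) (sym same) below)
          (un same eq (λ wp → none (Witness-prepend t nd₀ e wp)))
        where
          same : comp q′ ≡ comp q
          same = proj₁ (edge-scope t e)

      enter-or-stay : ∀ ν q′ d → Node (d ∷ Position.w ν) → Lower ν q′ d ⊎ Same ν q′ d → Position
      enter-or-stay ν q′ d nd (inj₁ l) = enter ν q′ d nd l
      enter-or-stay ν q′ d nd (inj₂ s) = stay ν q′ d nd s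

      next : Position → Fin n → Dir → Position
      next ν q′ d with em {Child ν q′ d}
      ... | yes (nd , mem) = enter-or-stay ν q′ d nd (∈-setOf⁻ mem)
      ... | no _ = ν

      next-≡ : ∀ {ν q′ d} → Child ν q′ d →
        Σ[ nd ∈ Node (d ∷ Position.w ν) ] Σ[ h ∈ Lower ν q′ d ⊎ Same ν q′ d ] next ν q′ d ≡ enter-or-stay ν q′ d nd h
      next-≡ {ν} {q′} {d} ch with em {Child ν q′ d}
      ... | yes (nd , mem) = nd , ∈-setOf⁻ mem , refl
      ... | no n = ⊥-elim (n ch)

      labels : ∀ ν q′ d nd h → let ν′ = enter-or-stay ν q′ d nd h in
               Position.q ν′ ≡ q′ × Position.w ν′ ≡ d ∷ Position.w ν
      labels ν q′ d nd (inj₁ _) = refl , refl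
      labels (pos _ _ _ _ (ex refl _ (_ , refl , _ , refl , _))) q′ d nd (inj₂ (wd , st′)) = sym st′ , sym wd
      labels (pos _ _ _ _ (un refl _ _)) q′ d nd (inj₂ _) = refl , refl

      next-labels : ∀ {ν q′ d} → Child ν q′ d → Position.q (next ν q′ d) ≡ q′ × Position.w (next ν q′ d) ≡ d ∷ Position.w ν
      next-labels {ν} {q′} {d} ch with next-≡ {ν} ch
      ... | nd , h , eq = subst (λ ν′ → Position.q ν′ ≡ q′ × Position.w ν′ ≡ d ∷ Position.w ν) (sym eq) (labels ν q′ d nd h)

      holds-interp : ∀ ν x → (∀ q′ → MentionsA q′ x → comp q′ <ᶠ comp (Position.q ν)) →
                     Holds t (Position.w ν) x → SatA t (Position.w ν) (interp ν) x
      holds-interp ν x scope = SatA-mono t x λ d q′ nd ment mem → ∈-setOf⁺ (inj₁ (scope q′ ment , ∈-setOf⁻ mem))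

      sat : ∀ ν → SatC t (Position.w ν) (interp ν) (δ (Position.q ν) (lab (Position.w ν)))
      sat ν@(pos q w nd below (tr eq s)) =
        SatC-mono t (δ q (lab w)) (λ d q′ nd ment mem → ∈-setOf⁺ (inj₁ (transientC q (lab w) eq q′ ment , ∈-setOf⁻ mem))) s
      sat ν@(pos q w nd below (ex refl eq (ρ , refl , r , refl , edge , inf))) =
        subst (SatC t w (interp ν)) (sym (proj₁ (branches-existential q (lab w) eq)))
          (DisE⁺ t (proj₁ (proj₂ (proj₂ e)))
            ((λ _ → d) , (λ { {fz} {fz} _ → refl }) ,
             λ _ → subst Node wd nd′ , ∈-setOf⁺ {P = λ q′ → Lower ν q′ d ⊎ Same ν q′ d} (inj₂ (sym wd , refl)))
            (holds (proj₁ (proj₂ e)) (proj₂ (edge-scope t e)) (proj₂ (proj₂ (proj₂ e)))))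
        where
          e = edge 0
          d = proj₁ (step ρ 0)
          wd = proj₁ (proj₂ (step ρ 0))
          nd′ = proj₂ (proj₂ (step ρ 0))
          holds : ∀ As → All (λ x → ∀ q″ → MentionsA q″ x → comp q″ <ᶠ comp q) As →
                  All (Literal t (kind (comp q)) w) As → All (SatA t w (interp ν)) As
          holds [] _ _ = []
          holds (x ∷ As) (sc ∷ scs) (l ∷ ls) = holds-interp ν x sc (subst (λ κ → Literal t κ w x) eq l) ∷ holds As scs ls
      sat ν@(pos q w nd below (un refl eq none)) =
        subst (SatC t w (interp ν)) (sym (proj₁ (branches-universal q (lab w) eq)))
          (ConU⁺ t λ {q′} {As} mem → choose mem (em {All (λ x → ¬ Holds t w x) As}))
        where
          choose : ∀ {q′ As} → (q′ , As) LM.∈ branches q (lab w) → Dec (All (λ x → ¬ Holds t w x) As) →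
                   SatA t w (interp ν) (□[1+ 0 ] var q′) ⊎ Any (SatA t w (interp ν)) As
          choose {q′} {As} mem (yes fails) = inj₁ λ (f , _ , h) → proj₂ (h fz)
            (∈-setOf⁺ {P = λ q′ → Lower ν q′ (f fz) ⊎ Same ν q′ (f fz)}
               (inj₂ (refl , As , mem , subst (λ κ → All (Literal t κ w) As) (sym eq) fails)))
          choose {q′} {As} mem (no n) = inj₂ (some As (proj₂ (All.lookup (branches-scoped q (lab w)) mem)) n)
            where
              some : ∀ As → All (λ x → ∀ q″ → MentionsA q″ x → comp q″ <ᶠ comp q) As →
                     ¬ All (λ x → ¬ Holds t w x) As → Any (SatA t w (interp ν)) As
              some [] _ n = ⊥-elim (n [])
              some (x ∷ As) (sc ∷ scs) n with em {Holds t w x}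
              ... | yes h = here (holds-interp ν x sc h)
              ... | no nh = there (some As scs (λ a → n (nh ∷ a)))

      rank : Position → ℕ
      rank ν = toℕ (comp (Position.q ν))

      planned : Position → ℕ → Fin n
      planned (pos q _ _ _ (ex _ _ (_ , _ , r , _))) l = r l
      planned (pos q _ _ _ _) l = q

      same-comp : ∀ ν q′ d → Same ν q′ d → comp q′ ≡ comp (Position.q ν)
      same-comp (pos _ _ _ _ (ex refl _ (_ , _ , r , refl , edge , _))) q′ d (_ , refl) = proj₁ (edge-scope t (edge 0))
      same-comp (pos _ _ _ _ (un refl _ _)) q′ d e = proj₁ (edge-scope t e)

      stay-planned : ∀ ν q′ d nd s → kind (comp (Position.q ν)) ≡ existential →
                     ∀ l → planned (stay ν q′ d nd s) l ≡ planned ν (suc l)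
      stay-planned (pos _ _ _ _ (ex refl _ (_ , refl , _ , refl , _))) q′ d nd s eq l = refl
      stay-planned (pos _ _ _ _ (un refl eq′ _)) q′ d nd s eq l with trans (sym eq) eq′
      ... | ()

      planned-start : ∀ ν → planned ν 0 ≡ Position.q ν
      planned-start (pos _ _ _ _ (tr _ _)) = refl
      planned-start (pos _ _ _ _ (ex _ _ (_ , _ , _ , eq , _))) = eq
      planned-start (pos _ _ _ _ (un _ _ _)) = refl

      planned-recurring : ∀ ν → kind (comp (Position.q ν)) ≡ existential → Infinite (λ l → Even (Ω (planned ν l)))
      planned-recurring (pos _ _ _ _ (ex refl _ (_ , _ , r , _ , _ , inf))) eq =
        subst (λ κ → Infinite (λ l → Recurring κ (Ω (r l)))) eq inf
      planned-recurring (pos _ _ _ _ (tr eq′ _)) eq with trans (sym eq) eq′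
      ... | ()
      planned-recurring (pos _ _ _ _ (un refl eq′ _)) eq with trans (sym eq) eq′
      ... | ()

      no-refutation : ∀ ν → kind (comp (Position.q ν)) ≡ universal →
                      ¬ WitnessPath t (comp (Position.q ν)) (Position.w ν) (Position.q ν)
      no-refutation (pos _ _ _ _ (un refl _ none)) eq = none
      no-refutation (pos _ _ _ _ (tr eq′ _)) eq with trans (sym eq) eq′
      ... | ()
      no-refutation (pos _ _ _ _ (ex refl eq′ _)) eq with trans (sym eq) eq′
      ... | ()

      same-edge : ∀ ν q′ d → Same ν q′ d → kind (comp (Position.q ν)) ≡ universal →
                  Edge t (comp (Position.q ν)) (Position.w ν) (Position.q ν) q′
      same-edge (pos _ _ _ _ (un refl _ _)) q′ d e eq = e
      same-edge (pos _ _ _ _ (ex refl eq′ _)) q′ d s eq with trans (sym eq) eq′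
      ... | ()

      same-nontransient : ∀ ν q′ d → Same ν q′ d → kind (comp (Position.q ν)) ≢ transient
      same-nontransient (pos _ _ _ _ (ex refl eq′ _)) q′ d s eq with trans (sym eq) eq′
      ... | ()
      same-nontransient (pos _ _ _ _ (un refl eq′ _)) q′ d s eq with trans (sym eq) eq′
      ... | ()

      module Infinitely (ν : ℕ → Position) (q′ : ℕ → Fin n) (d : ℕ → Dir)
        (child : ∀ l → Child (ν l) (q′ l) (d l)) (nexts : ∀ l → ν (suc l) ≡ next (ν l) (q′ l) (d l)) where
        open Position

        label-q : ∀ l → q (ν (suc l)) ≡ q′ l
        label-q l = trans (cong q (nexts l)) (proj₁ (next-labels {ν l} (child l)))

        label-w : ∀ l → w (ν (suc l)) ≡ d l ∷ w (ν l)
        label-w l = trans (cong w (nexts l)) (proj₂ (next-labels {ν l} (child l)))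

        descending : ∀ l → rank (ν (suc l)) ≤ rank (ν l)
        descending l with next-≡ {ν l} (child l)
        ... | nd , inj₁ (lt , _) , _ = subst (λ q → toℕ (comp q) ≤ rank (ν l)) (sym (label-q l)) (ℕₚ.<⇒≤ lt)
        ... | nd , inj₂ s , _ = ℕₚ.≤-reflexive (cong toℕ (trans (cong comp (label-q l)) (same-comp (ν l) (q′ l) (d l) s)))

        stays : ∀ l → rank (ν (suc l)) ≡ rank (ν l) →
                Σ[ nd ∈ Node (d l ∷ w (ν l)) ] Σ[ s ∈ Same (ν l) (q′ l) (d l) ] ν (suc l) ≡ stay (ν l) (q′ l) (d l) nd s
        stays l eq with next-≡ {ν l} (child l)
        ... | nd , inj₁ (lt , _) , _ = ⊥-elim (ℕₚ.<-irrefl (trans (cong (λ q → toℕ (comp q)) (sym (label-q l))) eq) lt)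
        ... | nd , inj₂ s , eq′ = nd , s , trans (nexts l) eq′

        module Staying (constant : ∀ l → rank (ν l) ≡ rank (ν 0)) where
          open ParityLemmas em

          i : Fin c
          i = comp (q (ν 0))

          comps : ∀ l → comp (q (ν l)) ≡ i
          comps l = Finₚ.toℕ-injective (constant l)

          stays′ : ∀ l → Σ[ nd ∈ Node (d l ∷ w (ν l)) ] Σ[ s ∈ Same (ν l) (q′ l) (d l) ] ν (suc l) ≡ stay (ν l) (q′ l) (d l) nd s
          stays′ l = stays l (trans (constant (suc l)) (sym (constant l)))

          planned-along : kind i ≡ existential → ∀ l j → planned (ν l) j ≡ planned (ν 0) (l + j)
          planned-along eq zero j = refl
          planned-along eq (suc l) j with stays′ l
          ... | nd , s , eq′ = begin
            planned (ν (suc l)) j                      ≡⟨ cong (λ ν → planned ν j) eq′ ⟩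
            planned (stay (ν l) (q′ l) (d l) nd s) j   ≡⟨ stay-planned (ν l) (q′ l) (d l) nd s (trans (cong kind (comps l)) eq) j ⟩
            planned (ν l) (suc j)                      ≡⟨ planned-along eq l (suc j) ⟩
            planned (ν 0) (l + suc j)                  ≡⟨ cong (planned (ν 0)) (ℕₚ.+-suc l j) ⟩
            planned (ν 0) (suc (l + j)) ∎
            where open ≡-Reasoning

          follows-plan : kind i ≡ existential → ∀ l → planned (ν 0) l ≡ q (ν l)
          follows-plan eq l = trans (cong (planned (ν 0)) (sym (ℕₚ.+-identityʳ l)))
            (trans (sym (planned-along eq l 0)) (planned-start (ν l)))

          path : IPath t
          path = record { π = λ l → w (ν l) ; π-ok = node (ν 0) ; step = λ l → d l , label-w l , node (ν (suc l)) }

          edge : kind i ≡ universal → ∀ l → Edge t i (w (ν l)) (q (ν l)) (q (ν (suc l)))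
          edge eq l = subst₂ (λ i q″ → Edge t i (w (ν l)) (q (ν l)) q″) (comps l) (sym (label-q l))
            (same-edge (ν l) (q′ l) (d l) (proj₁ (proj₂ (stays′ l))) (trans (cong kind (comps l)) eq))

          parity : ∀ κ → kind i ≡ κ → ParityOK (λ l → Ω (q (ν l)))
          parity transient eq = ⊥-elim (same-nontransient (ν 0) (q′ 0) (d 0) (proj₁ (proj₂ (stays′ 0))) eq)
          parity existential eq =
            let (o , odd , vals) = existentialΩ i eq
            in büchi⁺ odd (λ l → vals (q (ν l)) (comps l))
                 (λ b → let (l , b≤l , ev) = planned-recurring (ν 0) eq b
                        in l , b≤l , subst (λ q → Even (Ω q)) (follows-plan eq l) ev)
          parity universal eq =
            let (e , even , vals) = universalΩ i eq
            in cobüchi⁺ even (λ l → vals (q (ν l)) (comps l)) λ inf →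
                 no-refutation (ν 0) eq (path , refl , (λ l → q (ν l)) , refl ,
                   (λ l → subst (λ k → Edge t i (w (ν k)) (q (ν l)) (q (ν (suc l)))) (sym (ℕₚ.+-identityʳ l)) (edge eq l)) ,
                   subst (λ κ → Infinite (λ l → Recurring κ (Ω (q (ν l))))) (sym eq) inf)

      system : System gta t
      system = record
        { Pos = Position ; state = Position.q ; word = Position.w ; interp = interp ; next = next
        ; node = Position.node
        ; next-state = λ {ν} ch → proj₁ (next-labels {ν} ch)
        ; next-word = λ {ν} ch → proj₂ (next-labels {ν} ch)
        ; sat = sat
        ; accepting = λ ν q′ d child nexts →
            let open Infinitely ν q′ d child nexts
                (K , constant) = ParityLemmas.eventually-constant em (λ l → rank (ν l)) descending
                shifted = λ l → trans (cong ν (ℕₚ.+-suc K l)) (nexts (K + l))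
                module I = Infinitely (λ l → ν (K + l)) (λ l → q′ (K + l)) (λ l → d (K + l)) (λ l → child (K + l)) shifted
                constant′ = λ l → trans (constant l) (sym (constant 0))
            in ParityOK-drop K (I.Staying.parity constant′ _ refl) }

    module Complete {k : ℕ} (good : ∀ q → toℕ (comp q) < k → Good q) {t : KTree m} (S : System gta t) where
      open KTree t
      open System S
      open IPath
      open ParityLemmas em

      Truth : Pos → Set
      Truth ν = _⊨ˢ_ t (word ν) (φ (state ν))

      module _ (i : Fin c) (i<k : toℕ i < k) (lower : ∀ ν → comp (state ν) <ᶠ i → Truth ν) where

        child-truth : ∀ {ν q d} → Child ν q d → comp q <ᶠ i → _⊨ˢ_ t (d ∷ word ν) (φ q)
        child-truth {ν} {q} {d} ch lt = subst₂ (λ w q → _⊨ˢ_ t w (φ q)) (next-word {ν} ch) (next-state {ν} ch)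
          (lower (next ν q d) (subst (λ q → comp q <ᶠ i) (sym (next-state {ν} ch)) lt))

        holds : ∀ ν x → (∀ q → MentionsA q x → comp q <ᶠ i) → SatA t (word ν) (interp ν) x → Holds t (word ν) x
        holds ν x scope = SatA-mono t x λ d q nd ment mem → ∈-setOf⁺ (child-truth {ν} (nd , mem) (scope q ment))

        all-hold : ∀ ν {As} → All (λ x → ∀ q → MentionsA q x → comp q <ᶠ i) As →
                   All (SatA t (word ν) (interp ν)) As → All (Holds t (word ν)) As
        all-hold ν [] [] = []
        all-hold ν (sc ∷ scs) (s ∷ ss) = holds ν _ sc s ∷ all-hold ν scs ss

        some-holds : ∀ ν {As} → All (λ x → ∀ q → MentionsA q x → comp q <ᶠ i) As →
                     All (λ x → ¬ Holds t (word ν) x) As → ¬ Any (SatA t (word ν) (interp ν)) As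
        some-holds ν (sc ∷ _) (n ∷ _) (here s) = n (holds ν _ sc s)
        some-holds ν (_ ∷ scs) (_ ∷ ns) (there s) = some-holds ν scs ns s

        module Existential (kd : kind i ≡ existential) where

          InComp : Set
          InComp = Σ[ ν ∈ Pos ] comp (state ν) ≡ i

          abstract
            choice : (ν : InComp) → Σ[ q ∈ Fin n ] Σ[ d ∈ Dir ] (Child (proj₁ ν) q d × Edge t i (word (proj₁ ν)) (state (proj₁ ν)) q)
            choice (ν , refl) with DisE⁻ t (subst (SatC t (word ν) (interp ν)) (proj₁ (branches-existential (state ν) _ kd)) (sat ν))
            ... | q , As , mem , (f , _ , h) , s =
              q , f fz , h fz , refl , As , mem ,
              subst (λ κ → All (Literal t κ (word ν)) As) (sym kd)
                (all-hold ν (proj₂ (All.lookup (proj₂ (branches-existential (state ν) _ kd)) mem)) s)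

          follow : InComp → InComp
          follow ν = let (q , d , ch , e) = choice ν in
            next (proj₁ ν) q d , trans (cong comp (next-state {proj₁ ν} ch)) (proj₁ (edge-scope t e))

          along : InComp → ℕ → InComp
          along ν zero = ν
          along ν (suc l) = follow (along ν l)

          witness : ∀ ν → comp (state ν) ≡ i → WitnessPath t i (word ν) (state ν)
          witness ν eq = ρ , refl , (λ l → state (at′ l)) , refl , edge ,
              subst (λ κ → Infinite (λ l → Recurring κ (Ω (state (at′ l))))) (sym kd)
                (büchi⁻ (accepting at′ (λ l → proj₁ (choice (seq l))) (λ l → proj₁ (proj₂ (choice (seq l))))
                   (λ l → child l) (λ l → refl)))
            where
              seq : ℕ → InComp
              seq = along (ν , eq)
              at′ : ℕ → Pos
              at′ l = proj₁ (seq l)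
              child : ∀ l → Child (at′ l) (proj₁ (choice (seq l))) (proj₁ (proj₂ (choice (seq l))))
              child l = proj₁ (proj₂ (proj₂ (choice (seq l))))
              ρ : IPath t
              ρ = record { π = λ l → word (at′ l) ; π-ok = node ν
                         ; step = λ l → _ , next-word {at′ l} (child l) , node (at′ (suc l)) }
              edge : ∀ l → Edge t i (word (at′ (l + 0))) (state (at′ l)) (state (at′ (suc l)))
              edge l = subst₂ (λ j q → Edge t i (word (at′ j)) (state (at′ l)) q) (sym (ℕₚ.+-identityʳ l))
                (sym (next-state {at′ l} (child l))) (proj₂ (proj₂ (proj₂ (choice (seq l)))))

        module Universal (kd : kind i ≡ universal) (ρ : IPath t) (r : ℕ → Fin n)
          (edges : ∀ l → Edge t i (π ρ l) (r l) (r (suc l))) where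

          InStep : ℕ → Set
          InStep l = Σ[ ν ∈ Pos ] (state ν ≡ r l × word ν ≡ π ρ l)

          d : ℕ → Dir
          d l = proj₁ (step ρ l)

          obliged : ∀ l (ν : InStep l) → Child (proj₁ ν) (r (suc l)) (d l)
          obliged l (ν , st′ , wd) = nd , mem (edges l)
            where
              nd : Node (d l ∷ word ν)
              nd = subst Node (trans (proj₁ (proj₂ (step ρ l))) (cong (d l ∷_) (sym wd))) (proj₂ (proj₂ (step ρ l)))
              mem : Edge t i (π ρ l) (r l) (r (suc l)) → r (suc l) ∈ interp ν (d l)
              mem e′ with subst₂ (λ w q → Edge t i w q (r (suc l))) (sym wd) (sym st′) e′
              ... | e@(refl , As , m′ , lits)
                with ConU⁻ t (subst (SatC t (word ν) (interp ν)) (proj₁ (branches-universal (state ν) _ kd)) (sat ν)) m′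
              ... | inj₁ box = dne λ n → box ((λ _ → d l) , (λ { {fz} {fz} _ → refl }) , λ _ → nd , n)
              ... | inj₂ some = ⊥-elim (some-holds ν (proj₂ (edge-scope t e)) (subst (λ κ → All (Literal t κ (word ν)) As) kd lits) some)

          along : InStep 0 → ∀ l → InStep l
          along ν zero = ν
          along ν (suc l) =
            let ν′ = along ν l ; ob = obliged l ν′
            in next (proj₁ ν′) (r (suc l)) (d l) , next-state {proj₁ ν′} ob ,
               trans (next-word {proj₁ ν′} ob) (trans (cong (d l ∷_) (proj₂ (proj₂ ν′))) (sym (proj₁ (proj₂ (step ρ l)))))

          contradiction : InStep 0 → ¬ Infinite (λ l → Odd (Ω (r l)))
          contradiction ν =
            let (e , even , vals) = universalΩ i kd
            in cobüchi⁻ even (λ l → vals (r l) (proj₁ (edges l)))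
                 (ParityOK-cong (λ l → cong Ω (proj₁ (proj₂ (along ν l))))
                   (accepting (λ l → proj₁ (along ν l)) (λ l → r (suc l)) d (λ l → obliged l (along ν l)) (λ l → refl)))

        correct : ∀ ν → comp (state ν) ≡ i → ∀ κ → kind i ≡ κ → Correct t (word ν) (state ν)
        correct ν refl transient kd = tr kd (SatC-mono t (δ (state ν) (lab (word ν)))
          (λ d q nd ment mem → ∈-setOf⁺ (child-truth {ν} (nd , mem) (transientC (state ν) _ kd q ment))) (sat ν))
        correct ν eq existential kd = ex eq kd (Existential.witness kd ν eq)
        correct ν eq universal kd = un eq kd λ { (ρ , wd , r , st′ , edges , inf) →
          Universal.contradiction kd ρ r (λ l → subst (λ j → Edge t i (π ρ j) (r l) (r (suc l))) (ℕₚ.+-identityʳ l) (edges l))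
            (ν , sym st′ , sym wd) (subst (λ κ → Infinite (λ l → Recurring κ (Ω (r l)))) kd inf) }

      complete′ : ∀ b ν → toℕ (comp (state ν)) < b → toℕ (comp (state ν)) < k → Truth ν
      complete′ (suc b) ν lt lt-k = proj₂ (good (state ν) lt-k t (word ν) (node ν))
        (correct (comp (state ν)) lt-k
          (λ ν′ lt′ → complete′ b ν′ (ℕₚ.≤-trans lt′ (s≤s⁻¹ lt)) (ℕₚ.<-trans lt′ lt-k)) ν refl _ refl)

      complete : ∀ ν → toℕ (comp (state ν)) < k → Truth ν
      complete ν lt = complete′ _ ν lt lt

-- The automaton of a constraint on a subtree

subtree : ∀ {m} (t : KTree m) (w : List (KTree.Dir t)) → KTree.Node t w → KTree m
subtree t w nd = record
  { Dir = Dir ; Node = λ v → Node (v ++ w) ; root = nd ; prefix = λ d v → prefix d (v ++ w)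
  ; serial = λ v → serial (v ++ w) ; lab = λ v → lab (v ++ w) }
  where open KTree t

module _ {m n : ℕ} (t : KTree m) (w : List (KTree.Dir t)) (nd : KTree.Node t w)
         {v : List (KTree.Dir t)} {I : KTree.Dir t → Subset n} where

  subtree-SatA : ∀ x → SatA (subtree t w nd) v I x ⇔ SatA t (v ++ w) I x
  subtree-SatA (◇[1+ k ] α) = (λ s → s) , (λ s → s)
  subtree-SatA (□[1+ k ] α) = (λ s → s) , (λ s → s)

  subtree-SatC : ∀ θ → SatC (subtree t w nd) v I θ ⇔ SatC t (v ++ w) I θ
  subtree-SatC ⊤ᶜ = (λ s → s) , (λ s → s)
  subtree-SatC ⊥ᶜ = (λ s → s) , (λ s → s)
  subtree-SatC (θ ∨ᶜ η) =
    [ (λ s → inj₁ (proj₁ (subtree-SatC θ) s)) , (λ s → inj₂ (proj₁ (subtree-SatC η) s)) ]′ ,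
    [ (λ s → inj₁ (proj₂ (subtree-SatC θ) s)) , (λ s → inj₂ (proj₂ (subtree-SatC η) s)) ]′
  subtree-SatC (θ ∧ᶜ η) =
    (λ (s , s′) → proj₁ (subtree-SatC θ) s , proj₁ (subtree-SatC η) s′) ,
    (λ (s , s′) → proj₂ (subtree-SatC θ) s , proj₂ (subtree-SatC η) s′)
  subtree-SatC (at x) = subtree-SatA x

module _ {n n′ : ℕ} (f : Fin n → Fin n′) where

  ren-SatB⁺ : ∀ {I : Subset n} {J : Subset n′} α → (∀ q → q ∈ I → f q ∈ J) → I ⊨ᵇ α → J ⊨ᵇ renB f α
  ren-SatB⁺ tt h s = tt
  ren-SatB⁺ (var q) h s = h q s
  ren-SatB⁺ (α ∧ᵇ β) h (a , b) = ren-SatB⁺ α h a , ren-SatB⁺ β h b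
  ren-SatB⁺ (α ∨ᵇ β) h (inj₁ a) = inj₁ (ren-SatB⁺ α h a)
  ren-SatB⁺ (α ∨ᵇ β) h (inj₂ b) = inj₂ (ren-SatB⁺ β h b)

  ren-SatB⁻ : ∀ {I : Subset n} {J : Subset n′} α → (∀ q → f q ∈ J → q ∈ I) → J ⊨ᵇ renB f α → I ⊨ᵇ α
  ren-SatB⁻ tt h s = tt
  ren-SatB⁻ (var q) h s = h q s
  ren-SatB⁻ (α ∧ᵇ β) h (a , b) = ren-SatB⁻ α h a , ren-SatB⁻ β h b
  ren-SatB⁻ (α ∨ᵇ β) h (inj₁ a) = inj₁ (ren-SatB⁻ α h a)
  ren-SatB⁻ (α ∨ᵇ β) h (inj₂ b) = inj₂ (ren-SatB⁻ β h b)

  module _ {m : ℕ} (t : KTree m) {w : List (KTree.Dir t)} {I : KTree.Dir t → Subset n} {J : KTree.Dir t → Subset n′} where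

    ren-SatA⁺ : ∀ x → (∀ d q → q ∈ I d → f q ∈ J d) → SatA t w I x → SatA t w J (renA f x)
    ren-SatA⁺ (◇[1+ k ] α) h s = AtLeast-map t {P = λ d → I d ⊨ᵇ α} (λ d _ → ren-SatB⁺ α (h d)) s
    ren-SatA⁺ (□[1+ k ] α) h s a = s (AtLeast-map t {P = λ d → ¬ (J d ⊨ᵇ renB f α)} (λ d _ nj i → nj (ren-SatB⁺ α (h d) i)) a)

    ren-SatA⁻ : ∀ x → (∀ d q → f q ∈ J d → q ∈ I d) → SatA t w J (renA f x) → SatA t w I x
    ren-SatA⁻ (◇[1+ k ] α) h s = AtLeast-map t {P = λ d → J d ⊨ᵇ renB f α} (λ d _ → ren-SatB⁻ α (h d)) s
    ren-SatA⁻ (□[1+ k ] α) h s a = s (AtLeast-map t {P = λ d → ¬ (I d ⊨ᵇ α)} (λ d _ ni j → ni (ren-SatB⁻ α (h d) j)) a)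

    ren-SatC⁺ : ∀ θ → (∀ d q → q ∈ I d → f q ∈ J d) → SatC t w I θ → SatC t w J (renC f θ)
    ren-SatC⁺ ⊤ᶜ h s = tt
    ren-SatC⁺ (θ ∨ᶜ η) h (inj₁ s) = inj₁ (ren-SatC⁺ θ h s)
    ren-SatC⁺ (θ ∨ᶜ η) h (inj₂ s) = inj₂ (ren-SatC⁺ η h s)
    ren-SatC⁺ (θ ∧ᶜ η) h (s , s′) = ren-SatC⁺ θ h s , ren-SatC⁺ η h s′
    ren-SatC⁺ (at x) h s = ren-SatA⁺ x h s

    ren-SatC⁻ : ∀ θ → (∀ d q → f q ∈ J d → q ∈ I d) → SatC t w J (renC f θ) → SatC t w I θ
    ren-SatC⁻ ⊤ᶜ h s = tt
    ren-SatC⁻ (θ ∨ᶜ η) h (inj₁ s) = inj₁ (ren-SatC⁻ θ h s)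
    ren-SatC⁻ (θ ∨ᶜ η) h (inj₂ s) = inj₂ (ren-SatC⁻ η h s)
    ren-SatC⁻ (θ ∧ᶜ η) h (s , s′) = ren-SatC⁻ θ h s , ren-SatC⁻ η h s′
    ren-SatC⁻ (at x) h s = ren-SatA⁻ x h s

module ConstraintAutomaton (em : EM₀) {m n : ℕ} (H : HGTA m n) (φ : Fin n → SF m) {k : ℕ}
  (good : ∀ q → toℕ (HGTA.comp H q) < k → Hesitant.Good em H φ q)
  (x : Atom n) (scope : ∀ q → MentionsA q x → toℕ (HGTA.comp H q) < k)
  (t : KTree m) (w : List (KTree.Dir t)) (nd : KTree.Node t w) where
  open Classical em
  open HGTA H
  open GTA gta
  open KTree t
  open Hesitant em H

  t′ : KTree m
  t′ = subtree t w nd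

  automaton : GTA m (suc n)
  automaton = withConstraint gta (at x)

  restrict : Subset (suc n) → Subset n
  restrict J = setOf (λ q → fs q ∈ J)

  module Project (S : System automaton t′) where
    open System S

    Pos′ : Set
    Pos′ = Σ[ ν ∈ Pos ] Σ[ q ∈ Fin n ] state ν ≡ fs q

    Child′ : Pos′ → Fin n → Dir → Set
    Child′ (ν , _) q d = Node (d ∷ word ν ++ w) × q ∈ restrict (interp ν d)

    child : ∀ {ν q d} → Child′ ν q d → Child (proj₁ ν) (fs q) d
    child (nd , mem) = nd , ∈-setOf⁻ mem

    next′ : Pos′ → Fin n → Dir → Pos′
    next′ ν q d with em {Child′ ν q d}
    ... | yes ch = next (proj₁ ν) (fs q) d , q , next-state {proj₁ ν} (child {ν} ch)
    ... | no _ = ν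

    next′-≡ : ∀ {ν q d} → Child′ ν q d → proj₁ (next′ ν q d) ≡ next (proj₁ ν) (fs q) d × proj₁ (proj₂ (next′ ν q d)) ≡ q
    next′-≡ {ν} {q} {d} ch with em {Child′ ν q d}
    ... | yes _ = refl , refl
    ... | no n = ⊥-elim (n ch)

    project : System gta t
    project = record
      { Pos = Pos′
      ; state = λ ν → proj₁ (proj₂ ν)
      ; word = λ ν → word (proj₁ ν) ++ w
      ; interp = λ ν d → restrict (interp (proj₁ ν) d)
      ; next = next′
      ; node = λ ν → node (proj₁ ν)
      ; next-state = λ {ν} ch → proj₂ (next′-≡ {ν} ch)
      ; next-word = λ {ν} ch → cong (_++ w) (trans (cong word (proj₁ (next′-≡ {ν} ch))) (next-word {proj₁ ν} (child {ν} ch)))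
      ; sat = λ (ν , q , eq) → proj₁ (subtree-SatC t w nd (δ q (lab (word ν ++ w))))
          (ren-SatC⁻ fs t′ (δ q (lab (word ν ++ w))) (λ d q′ mem → ∈-setOf⁺ mem)
            (subst (λ q → SatC t′ (word ν) (interp ν) (GTA.δ automaton q (lab (word ν ++ w)))) eq (sat ν)))
      ; accepting = λ ν q d ch nexts → ParityOK-cong (λ l → cong (GTA.Ω automaton) (proj₂ (proj₂ (ν l))))
          (accepting (λ l → proj₁ (ν l)) (λ l → fs (q l)) d (λ l → child {ν l} (ch l))
            (λ l → trans (cong proj₁ (nexts l)) (proj₁ (next′-≡ {ν l} (ch l))))) }

  accepts⇒holds : Accepts automaton t′ → Holds φ t w x
  accepts⇒holds acc = SatA-mono t x lower
      (proj₁ (subtree-SatA t w nd x)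
        (ren-SatA⁻ fs t′ {w = []} {I = λ d → restrict (interp ν₀ d)} {J = interp ν₀} x (λ d q mem → ∈-setOf⁺ mem) (sat ν₀)))
    where
      S = FromRun.system em acc nd
      open System S
      open Project S
      ν₀ : Pos
      ν₀ = [] , tt
      lower : ∀ d q → Node (d ∷ w) → MentionsA q x → q ∈ restrict (interp ν₀ d) → q ∈ canonical φ t w d
      lower d q nd′ ment mem = ∈-setOf⁺ (subst (λ v → _⊨ˢ_ t (v ++ w) (φ q)) (next-word {ν₀} ch)
        (Complete.complete φ good project (next ν₀ (fs q) d , q , next-state {ν₀} ch) (scope q ment)))
        where
          ch : Child ν₀ (fs q) d
          ch = nd′ , ∈-setOf⁻ mem

  module _ (h : Holds φ t w x) where
    open Canonical φ good t

    Included : Subset n → Fin (suc n) → Set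
    Included J fz = ⊥
    Included J (fs q) = q ∈ J

    embed : Subset n → Subset (suc n)
    embed J = setOf (Included J)

    initial : Dir → Subset n
    initial d = setOf (λ q → toℕ (comp q) < k × _⊨ˢ_ t (d ∷ w) (φ q))

    Pos⁺ : Set
    Pos⁺ = ⊤ ⊎ (Σ[ ν ∈ Position ] Σ[ v ∈ List Dir ] Position.w ν ≡ v ++ w)

    state⁺ : Pos⁺ → Fin (suc n)
    state⁺ (inj₁ _) = fz
    state⁺ (inj₂ (ν , _)) = fs (Position.q ν)

    word⁺ : Pos⁺ → List Dir
    word⁺ (inj₁ _) = []
    word⁺ (inj₂ (_ , v , _)) = v

    interp⁺ : Pos⁺ → Dir → Subset (suc n)
    interp⁺ (inj₁ _) d = embed (initial d)
    interp⁺ (inj₂ (ν , _)) d = embed (interp ν d)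

    Child⁺ : Pos⁺ → Fin (suc n) → Dir → Set
    Child⁺ ν q d = Node (d ∷ word⁺ ν ++ w) × q ∈ interp⁺ ν d

    child⁻ : ∀ {ν v} {eq : Position.w ν ≡ v ++ w} {q d} → Child⁺ (inj₂ (ν , v , eq)) (fs q) d → Child ν q d
    child⁻ {eq = eq} {d = d} (nd , mem) = subst (λ w → Node (d ∷ w)) (sym eq) nd , ∈-setOf⁻ {P = Included _} mem

    Pos₁ : Set
    Pos₁ = Σ[ ν ∈ Position ] Σ[ v ∈ List Dir ] Position.w ν ≡ v ++ w

    proceed : ∀ ν q d → Child⁺ ν q d → Pos₁
    proceed (inj₁ _) fz d (_ , mem) = ⊥-elim (∈-setOf⁻ {P = Included _} mem)
    proceed (inj₁ _) (fs q) d (nd′ , mem) =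
      let (lt , h) = ∈-setOf⁻ (∈-setOf⁻ {P = Included _} mem)
      in pos q (d ∷ w) nd′ lt (proj₁ (good q lt t (d ∷ w) nd′) h) , d ∷ [] , refl
    proceed (inj₂ (ν , v , eq)) fz d (_ , mem) = ⊥-elim (∈-setOf⁻ {P = Included _} mem)
    proceed (inj₂ (ν , v , eq)) (fs q) d ch =
      next ν q d , d ∷ v , trans (proj₂ (next-labels {ν} (child⁻ {eq = eq} ch))) (cong (d ∷_) eq)

    next⁺ : Pos⁺ → Fin (suc n) → Dir → Pos⁺
    next⁺ ν q d with em {Child⁺ ν q d}
    ... | yes ch = inj₂ (proceed ν q d ch)
    ... | no _ = ν

    next⁺-≡ : ∀ {ν q d} → Child⁺ ν q d → Σ[ ch ∈ Child⁺ ν q d ] next⁺ ν q d ≡ inj₂ (proceed ν q d ch)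
    next⁺-≡ {ν} {q} {d} ch with em {Child⁺ ν q d}
    ... | yes ch′ = ch′ , refl
    ... | no n = ⊥-elim (n ch)

    proceed-labels : ∀ ν q d ch → state⁺ (inj₂ (proceed ν q d ch)) ≡ q × word⁺ (inj₂ (proceed ν q d ch)) ≡ d ∷ word⁺ ν
    proceed-labels (inj₁ _) fz d (_ , mem) = ⊥-elim (∈-setOf⁻ {P = Included _} mem)
    proceed-labels (inj₁ _) (fs q) d _ = refl , refl
    proceed-labels (inj₂ _) fz d (_ , mem) = ⊥-elim (∈-setOf⁻ {P = Included _} mem)
    proceed-labels (inj₂ (ν , v , eq)) (fs q) d ch = cong fs (proj₁ (next-labels {ν} (child⁻ {eq = eq} ch))) , refl

    next⁺-labels : ∀ {ν q d} → Child⁺ ν q d → state⁺ (next⁺ ν q d) ≡ q × word⁺ (next⁺ ν q d) ≡ d ∷ word⁺ ν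
    next⁺-labels {ν} {q} {d} ch with next⁺-≡ {ν} ch
    ... | ch′ , eq = subst (λ ν′ → state⁺ ν′ ≡ q × word⁺ ν′ ≡ d ∷ word⁺ ν) (sym eq) (proceed-labels ν q d ch′)

    sat⁺ : ∀ ν → SatC t′ (word⁺ ν) (interp⁺ ν) (GTA.δ automaton (state⁺ ν) (lab (word⁺ ν ++ w)))
    sat⁺ (inj₁ _) = ren-SatA⁺ fs t′ {w = []} {I = initial} x (λ d q mem → ∈-setOf⁺ {P = Included _} mem)
      (proj₂ (subtree-SatA t w nd x) (SatA-mono t x (λ d q nd ment mem → ∈-setOf⁺ (scope q ment , ∈-setOf⁻ mem)) h))
    sat⁺ (inj₂ (ν , v , eq)) = ren-SatC⁺ fs t′ {w = v} {I = interp ν} θ (λ d q mem → ∈-setOf⁺ {P = Included _} mem)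
      (proj₂ (subtree-SatC t w nd θ) (subst (λ w → SatC t w (interp ν) (δ (Position.q ν) (lab w))) eq (sat ν)))
      where
        θ : GC n
        θ = δ (Position.q ν) (lab (v ++ w))

    module Branch⁺ (ν : ℕ → Pos⁺) (q : ℕ → Fin (suc n)) (d : ℕ → Dir)
      (ch : ∀ l → Child⁺ (ν l) (q l) (d l)) (nexts : ∀ l → ν (suc l) ≡ next⁺ (ν l) (q l) (d l)) where

      entered : ∀ l → Σ[ y ∈ Pos₁ ] ν (suc l) ≡ inj₂ y
      entered l = let (ch′ , eq) = next⁺-≡ {ν l} (ch l) in _ , trans (nexts l) eq

      inner : ℕ → Position
      inner l = proj₁ (proj₁ (entered l))

      Inner : ℕ → Fin n → Set
      Inner l q₁ = Child (inner l) q₁ (d (suc l)) × inner (suc l) ≡ next (inner l) q₁ (d (suc l))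

      inner-child : ∀ l → Σ[ q₁ ∈ Fin n ] Inner l q₁
      inner-child l = advance (proj₁ (entered l)) (proj₂ (entered l)) (entered (suc l)) (q (suc l)) (ch (suc l)) (nexts (suc l))
        where
          inj₂-injective : ∀ {y z : Pos₁} → _≡_ {A = Pos⁺} (inj₂ y) (inj₂ z) → y ≡ z
          inj₂-injective refl = refl
          advance : ∀ (y : Pos₁) → ν (suc l) ≡ inj₂ y → (z : Σ[ z ∈ Pos₁ ] ν (suc (suc l)) ≡ inj₂ z) →
                    ∀ q → Child⁺ (ν (suc l)) q (d (suc l)) → ν (suc (suc l)) ≡ next⁺ (ν (suc l)) q (d (suc l)) →
                    Σ[ q₁ ∈ Fin n ] (Child (proj₁ y) q₁ (d (suc l)) × proj₁ (proj₁ z) ≡ next (proj₁ y) q₁ (d (suc l)))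
          advance y eq (z , eqz) q ch nx with subst (λ ν → Child⁺ ν q (d (suc l))) eq ch | trans nx (cong (λ ν → next⁺ ν q (d (suc l))) eq)
          advance y eq (z , eqz) fz ch nx | _ , mem | _ = ⊥-elim (∈-setOf⁻ {P = Included _} mem)
          advance y@(_ , _ , eqv) eq (z , eqz) (fs q₁) ch nx | ch₁ | nx₁ with next⁺-≡ {inj₂ y} {fs q₁} {d (suc l)} ch₁
          ... | ch₂ , eq₂ = q₁ , child⁻ {eq = eqv} ch₁ , cong proj₁ (inj₂-injective (trans (sym eqz) (trans nx₁ eq₂)))

      parity : ParityOK (λ l → GTA.Ω automaton (state⁺ (ν l)))
      parity = ParityOK-drop 1 (ParityOK-cong (λ l → cong (λ ν → GTA.Ω automaton (state⁺ ν)) (sym (proj₂ (entered l))))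
        (System.accepting system inner (λ l → proj₁ (inner-child l)) (λ l → d (suc l))
          (λ l → proj₁ (proj₂ (inner-child l))) (λ l → proj₂ (proj₂ (inner-child l)))))

    holds⇒accepts : Accepts automaton t′
    holds⇒accepts = system⇒accepts record
      { Pos = Pos⁺ ; state = state⁺ ; word = word⁺ ; interp = interp⁺ ; next = next⁺
      ; node = λ { (inj₁ _) → nd ; (inj₂ (ν , v , eq)) → subst Node eq (Position.node ν) }
      ; next-state = λ {ν} ch → proj₁ (next⁺-labels {ν} ch)
      ; next-word = λ {ν} ch → proj₂ (next⁺-labels {ν} ch)
      ; sat = sat⁺ ; accepting = λ ν q d ch nexts → Branch⁺.parity ν q d ch nexts }
      (inj₁ tt) refl refl

-- Construction of the formulas

TreeNode : ℕ → Set₁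
TreeNode m = Σ[ t ∈ KTree m ] List (KTree.Dir t)

-- State predicates reuse the closure lemmas for path predicates; their position argument is idle.
StateDefinable : ∀ {m} → (SF m → Set) → Pred (TreeNode m) → Set₁
StateDefinable {m} InS P = Σ[ φ ∈ SF m ] (InS φ × (∀ (p : TreeNode m) i → (_⊨ˢ_ (proj₁ p) (proj₂ p) φ) ⇔ P p i))

atom-in-DisE : ∀ {n} {L : List (Fin n × List (Atom n))} {q As x} → (q , As) LM.∈ L → x LM.∈ As → AtomIn x (DisE L)
atom-in-DisE (here refl) mem = inj₁ (inj₂ (in-Con mem))
  where
    in-Con : ∀ {As x} → x LM.∈ As → AtomIn x (Con As)
    in-Con (here refl) = inj₁ refl
    in-Con (there m) = inj₂ (in-Con m)
atom-in-DisE (there m) mem = inj₂ (atom-in-DisE m mem)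

atom-in-ConU : ∀ {n} {L : List (Fin n × List (Atom n))} {q As x} → (q , As) LM.∈ L → x LM.∈ As → AtomIn x (ConU L)
atom-in-ConU (here refl) mem = inj₁ (inj₂ (in-Dis mem))
  where
    in-Dis : ∀ {As x} → x LM.∈ As → AtomIn x (Dis As)
    in-Dis (here refl) = inj₁ refl
    in-Dis (there m) = inj₂ (in-Dis m)
atom-in-ConU (there m) mem = inj₂ (atom-in-ConU m mem)

Con-injective : ∀ {n} {As Bs : List (Atom n)} → Con As ≡ Con Bs → As ≡ Bs
Con-injective {As = []} {[]} _ = refl
Con-injective {As = _ ∷ _} {_ ∷ _} eq = cong₂ _∷_ (at-injective (∧-injective eq .proj₁)) (Con-injective (∧-injective eq .proj₂))
  where
    ∧-injective : ∀ {n} {θ η θ′ η′ : GC n} → (θ ∧ᶜ η) ≡ (θ′ ∧ᶜ η′) → θ ≡ θ′ × η ≡ η′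
    ∧-injective refl = refl , refl
    at-injective : ∀ {n} {x y : Atom n} → at x ≡ at y → x ≡ y
    at-injective refl = refl

Dis-injective : ∀ {n} {As Bs : List (Atom n)} → Dis As ≡ Dis Bs → As ≡ Bs
Dis-injective {As = []} {[]} _ = refl
Dis-injective {As = _ ∷ _} {_ ∷ _} eq = cong₂ _∷_ (at-injective (∨-injective eq .proj₁)) (Dis-injective (∨-injective eq .proj₂))
  where
    ∨-injective : ∀ {n} {θ η θ′ η′ : GC n} → (θ ∨ᶜ η) ≡ (θ′ ∨ᶜ η′) → θ ≡ θ′ × η ≡ η′
    ∨-injective refl = refl , refl
    at-injective : ∀ {n} {x y : Atom n} → at x ≡ at y → x ≡ y
    at-injective refl = refl

DisE-injective : ∀ {n} {L L′ : List (Fin n × List (Atom n))} → DisE L ≡ DisE L′ → L ≡ L′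
DisE-injective {L = []} {[]} _ = refl
DisE-injective {L = _ ∷ _} {_ ∷ _} eq =
  let (eq-q , eq-As , eq-L) = parts eq in cong₂ _∷_ (cong₂ _,_ eq-q (Con-injective eq-As)) (DisE-injective eq-L)
  where
    parts : ∀ {n} {q q′ : Fin n} {α β γ δ : GC n} → ((at (◇[1+ 0 ] var q) ∧ᶜ α) ∨ᶜ β) ≡ ((at (◇[1+ 0 ] var q′) ∧ᶜ γ) ∨ᶜ δ) →
            q ≡ q′ × α ≡ γ × β ≡ δ
    parts refl = refl , refl , refl

ConU-injective : ∀ {n} {L L′ : List (Fin n × List (Atom n))} → ConU L ≡ ConU L′ → L ≡ L′
ConU-injective {L = []} {[]} _ = refl
ConU-injective {L = _ ∷ _} {_ ∷ _} eq =
  let (eq-q , eq-As , eq-L) = parts eq in cong₂ _∷_ (cong₂ _,_ eq-q (Dis-injective eq-As)) (ConU-injective eq-L)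
  where
    parts : ∀ {n} {q q′ : Fin n} {α β γ δ : GC n} → ((at (□[1+ 0 ] var q) ∨ᶜ α) ∧ᶜ β) ≡ ((at (□[1+ 0 ] var q′) ∨ᶜ γ) ∧ᶜ δ) →
            q ≡ q′ × α ≡ γ × β ≡ δ
    parts refl = refl , refl , refl

module Construction (em : EM₀) {m n : ℕ} (H : HGTA m n) (fr : Fragment m (Symmetric H)) where
  open Classical em
  open HGTA H
  open GTA gta
  open Hesitant em H
  open Fragment fr

  stateClosed : Closed (StateDefinable InS)
  stateClosed = record
    { iff-closed = λ h (φ , i , eqv) → φ , i , λ p k → ⇔-trans (eqv p k) (h p k)
    ; true-closed = ⊤ˢ , in-⊤ , λ p k → (λ x → x) , (λ x → x)
    ; neg = λ (φ , i , eqv) → ¬ˢ φ , in-¬ i , λ p k → (λ a x → a (proj₂ (eqv p k) x)) , (λ a x → a (proj₁ (eqv p k) x))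
    ; conj = λ (φ , i , eqv) (ψ , j , eqv′) → φ ∧ˢ ψ , in-∧ i j , λ p k →
        (λ (x , y) → proj₁ (eqv p k) x , proj₁ (eqv′ p k) y) , (λ (x , y) → proj₂ (eqv p k) x , proj₂ (eqv′ p k) y) }

  module SC = ClosedProps em stateClosed

  label-definable : ∀ a → StateDefinable InS (λ (t , w) _ → KTree.lab t w ≡ a)
  label-definable a = SC.iff-closed (λ (t , w) _ → Vec-ext , (λ { refl p → refl }))
    (SC.∀fin (Finite-Fin m) bit)
    where
      bit : ∀ p → StateDefinable InS (λ (t , w) _ → lookup (KTree.lab t w) p ≡ lookup a p)
      bit p with lookup a p
      ... | true = prop p , in-prop p , λ (t , w) _ → Vecₚ.[]=⇒lookup , Vecₚ.lookup⇒[]= p _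
      ... | false = ¬ˢ prop p , in-¬ (in-prop p) , λ (t , w) _ →
          (λ n → not-true (λ eq → n (Vecₚ.lookup⇒[]= p _ eq))) , (λ eq mem → clash (trans (sym (Vecₚ.[]=⇒lookup mem)) eq))
        where
          not-true : ∀ {b} → ¬ (b ≡ true) → b ≡ false
          not-true {false} _ = refl
          not-true {true} h = ⊥-elim (h refl)
          clash : ¬ (true ≡ false)
          clash ()

  path-definable : ∀ {P} → StateDefinable InS P → Definable InP (λ (t , ρ) i → P (t , IPath.π ρ i) 0)
  path-definable (φ , i , eqv) = st φ , in-st i , λ (t , ρ) k → eqv (t , IPath.π ρ k) 0

  module _ (φ : Fin n → SF m) (φ-in : ∀ q → InS (φ q)) where

    truth : (t : KTree m) → List (KTree.Dir t) → Subset n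
    truth t v = setOf (λ q → _⊨ˢ_ t v (φ q))

    boolean-definable : ∀ α → StateDefinable InS (λ (t , v) _ → truth t v ⊨ᵇ α)
    boolean-definable tt = SC.true-closed
    boolean-definable ff = SC.const ⊥
    boolean-definable (var q) = φ q , φ-in q , λ p _ → ∈-setOf⁺ , ∈-setOf⁻
    boolean-definable (α ∧ᵇ β) = SC.conj (boolean-definable α) (boolean-definable β)
    boolean-definable (α ∨ᵇ β) = SC.disj (boolean-definable α) (boolean-definable β)

    holds-definable : ∀ x → (Symmetric H → IsK1 x) → StateDefinable InS (λ (t , w) _ → Holds φ t w x)
    holds-definable (◇[1+ k ] α) k1 with boolean-definable α
    ... | F , F-in , eqv = D[1+ k ] F , in-D k1 F-in , λ (t , w) i →
      AtLeast-map t (λ d _ → proj₁ (eqv (t , d ∷ w) i)) , AtLeast-map t (λ d _ → proj₂ (eqv (t , d ∷ w) i))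
    holds-definable (□[1+ k ] α) k1 with SC.neg (boolean-definable α)
    ... | F , F-in , eqv = ¬ˢ (D[1+ k ] F) , in-¬ (in-D k1 F-in) , λ (t , w) i →
      (λ a b → a (AtLeast-map t (λ d _ → proj₂ (eqv (t , d ∷ w) i)) b)) ,
      (λ a b → a (AtLeast-map t (λ d _ → proj₁ (eqv (t , d ∷ w) i)) b))

    constraint-definable : ∀ θ → (∀ x → AtomIn x θ → Symmetric H → IsK1 x) →
                           StateDefinable InS (λ (t , w) _ → SatC t w (canonical φ t w) θ)
    constraint-definable ⊤ᶜ k1 = SC.true-closed
    constraint-definable ⊥ᶜ k1 = SC.const ⊥
    constraint-definable (θ ∨ᶜ η) k1 = SC.disj (constraint-definable θ (λ x a → k1 x (inj₁ a))) (constraint-definable η (λ x a → k1 x (inj₂ a)))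
    constraint-definable (θ ∧ᶜ η) k1 = SC.conj (constraint-definable θ (λ x a → k1 x (inj₁ a))) (constraint-definable η (λ x a → k1 x (inj₂ a)))
    constraint-definable (at x) k1 = holds-definable x (k1 x refl)

    literal-definable : ∀ κ x → (Symmetric H → IsK1 x) → StateDefinable InS (λ (t , w) _ → Literal φ t κ w x)
    literal-definable transient x k1 = holds-definable x k1
    literal-definable existential x k1 = holds-definable x k1
    literal-definable universal x k1 = SC.neg (holds-definable x k1)

    literals-definable : ∀ κ As → (∀ {x} → x LM.∈ As → Symmetric H → IsK1 x) →
                         StateDefinable InS (λ (t , w) _ → All (Literal φ t κ w) As)
    literals-definable κ [] k1 = SC.iff-closed (λ _ _ → (λ _ → []) , (λ _ → tt)) SC.true-closed
    literals-definable κ (x ∷ As) k1 = SC.iff-closed (λ _ _ → (λ (a , as) → a ∷ as) , (λ { (a ∷ as) → a , as }))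
      (SC.conj (literal-definable κ x (k1 (here refl))) (literals-definable κ As (λ m → k1 (there m))))

    branch-definable : ∀ κ q′ (L : List Branch) → (∀ {q As x} → (q , As) LM.∈ L → x LM.∈ As → Symmetric H → IsK1 x) →
      StateDefinable InS (λ (t , w) _ → Σ[ As ∈ List (Atom n) ] ((q′ , As) LM.∈ L × All (Literal φ t κ w) As))
    branch-definable κ q′ [] k1 = SC.iff-closed (λ _ _ → ⊥-elim , (λ { (_ , () , _) })) (SC.const ⊥)
    branch-definable κ q′ ((q , As) ∷ L) k1 = SC.iff-closed
      (λ _ _ → (λ { (inj₁ (refl , ls)) → As , here refl , ls ; (inj₂ (As , mem , ls)) → As , there mem , ls }) ,
               (λ { (As , here refl , ls) → inj₁ (refl , ls) ; (As , there mem , ls) → inj₂ (As , mem , ls) }))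
      (SC.disj (SC.conj (SC.const (q′ ≡ q)) (literals-definable κ As (k1 (here refl))))
               (branch-definable κ q′ L (λ mem → k1 (there mem))))

    branches-symmetric : ∀ q a {q′ As x} → (q′ , As) LM.∈ branches q a → x LM.∈ As → Symmetric H → IsK1 x
    branches-symmetric q a {q′} {As} {x} mem mem′ sym-H = sym-H q a x (go refl mem)
      where
        go : ∀ {κ} (eq : kind (comp q) ≡ κ) → (q′ , As) LM.∈ branches-of q a eq → AtomIn x (δ q a)
        go {existential} eq mem = subst (AtomIn x) (sym (proj₁ (proj₂ (existentialC q a eq)))) (atom-in-DisE mem mem′)
        go {universal} eq mem = subst (AtomIn x) (sym (proj₁ (proj₂ (universalC q a eq)))) (atom-in-ConU mem mem′)

    edge-definable : ∀ i q q′ → StateDefinable InS (λ (t , w) _ → Edge φ t i w q q′)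
    edge-definable i q q′ = SC.iff-closed
      (λ _ _ → (λ { (eq , a , refl , e) → eq , e }) , (λ (eq , e) → eq , _ , refl , e))
      (SC.conj (SC.const (comp q ≡ i)) (SC.∃fin (Finite-Vec m Finite-Bool) λ a →
        SC.conj (label-definable a) (branch-definable (kind i) q′ (branches q a) (branches-symmetric q a))))

    edges-on-path : Fin c → Fin n → Fin n → Pred (TreePath m)
    edges-on-path i q q′ (t , ρ) l = Edge φ t i (IPath.π ρ l) q q′

    RunsDefinable : Fin c → Set₁
    RunsDefinable i = ∀ q → Definable InP (λ p j → InfiniteRun (λ q q′ l → edges-on-path i q q′ p l) (λ q → Recurring (kind i) (Ω q)) j q)

    witness-definable : ∀ {i} → RunsDefinable i → ∀ q → StateDefinable InS (λ (t , w) _ → WitnessPath φ t i w q)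
    witness-definable runs q with runs q
    ... | ψ , ψ-in , eqv = E ψ , in-E ψ-in , λ (t , w) _ →
      (λ (ρ , eq , h) → ρ , eq , proj₁ (eqv (t , ρ) 0) h) , (λ (ρ , eq , h) → ρ , eq , proj₂ (eqv (t , ρ) 0) h)

    correct-definable : ∀ q → (kind (comp q) ≢ transient → RunsDefinable (comp q)) →
                        StateDefinable InS (λ (t , w) _ → Correct φ t w q)
    correct-definable q runs = go (kind (comp q)) refl
      where
        clash : ∀ {κ κ′} → kind (comp q) ≡ κ → kind (comp q) ≡ κ′ → κ ≢ κ′ → ⊥
        clash eq eq′ ne = ne (trans (sym eq) eq′)
        go : ∀ κ → kind (comp q) ≡ κ → StateDefinable InS (λ (t , w) _ → Correct φ t w q)
        go transient eq = SC.iff-closed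
          (λ _ _ → (λ { (a , refl , s) → tr eq s }) ,
                   (λ { (tr _ s) → _ , refl , s
                      ; (ex refl eq′ _) → ⊥-elim (clash eq eq′ λ ()) ; (un refl eq′ _) → ⊥-elim (clash eq eq′ λ ()) }))
          (SC.∃fin (Finite-Vec m Finite-Bool) λ a → SC.conj (label-definable a)
            (constraint-definable (δ q a) λ x at-x sym-H → sym-H q a x at-x))
        go existential eq = SC.iff-closed
          (λ _ _ → ex refl eq ,
                   (λ { (ex refl _ wp) → wp
                      ; (tr eq′ _) → ⊥-elim (clash eq eq′ λ ()) ; (un refl eq′ _) → ⊥-elim (clash eq eq′ λ ()) }))
          (witness-definable (runs (λ eq′ → clash eq eq′ λ ())) q)
        go universal eq = SC.iff-closed
          (λ _ _ → un refl eq ,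
                   (λ { (un refl _ none) → none
                      ; (tr eq′ _) → ⊥-elim (clash eq eq′ λ ()) ; (ex refl eq′ _) → ⊥-elim (clash eq eq′ λ ()) }))
          (SC.neg (witness-definable (runs (λ eq′ → clash eq eq′ λ ())) q))

  module _ {φ φ′ : Fin n → SF m} {i : Fin c} (agree : ∀ q → comp q <ᶠ i → φ q ≡ φ′ q) (t : KTree m) where

    holds-cong : ∀ {w} x → (∀ q → MentionsA q x → comp q <ᶠ i) → Holds φ t w x → Holds φ′ t w x
    holds-cong {w} x scope = SatA-mono t x λ d q nd ment mem →
      ∈-setOf⁺ (subst (_⊨ˢ_ t (d ∷ w)) (agree q (scope q ment)) (∈-setOf⁻ mem))

  module _ {φ φ′ : Fin n → SF m} {i : Fin c} (agree : ∀ q → comp q <ᶠ i → φ q ≡ φ′ q) (t : KTree m) where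

    literal-cong : ∀ κ {w} x → (∀ q → MentionsA q x → comp q <ᶠ i) → Literal φ t κ w x → Literal φ′ t κ w x
    literal-cong transient x scope = holds-cong {φ} {φ′} {i} agree t x scope
    literal-cong existential x scope = holds-cong {φ} {φ′} {i} agree t x scope
    literal-cong universal x scope n h = n (holds-cong {φ′} {φ} {i} (λ q lt → sym (agree q lt)) t x scope h)

    edge-cong : ∀ {w q q′} → Edge φ t i w q q′ → Edge φ′ t i w q q′
    edge-cong {w} e@(eq , As , mem , ls) = eq , As , mem , lits As (proj₂ (edge-scope φ t e)) ls
      where
        lits : ∀ As → All (λ x → ∀ q → MentionsA q x → comp q <ᶠ i) As →
               All (Literal φ t (kind i) w) As → All (Literal φ′ t (kind i) w) As
        lits [] _ _ = []
        lits (x ∷ As) (sc ∷ scs) (l ∷ ls) = literal-cong (kind i) x sc l ∷ lits As scs ls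

    witness-cong : ∀ {w q} → WitnessPath φ t i w q → WitnessPath φ′ t i w q
    witness-cong (ρ , eq , r , eq′ , edges , inf) = ρ , eq , r , eq′ , (λ l → edge-cong (edges l)) , inf

  correct-cong : ∀ {φ φ′ : Fin n → SF m} {q} → (∀ q′ → comp q′ <ᶠ comp q → φ q′ ≡ φ′ q′) →
                 ∀ t {w} → Correct φ t w q → Correct φ′ t w q
  correct-cong {φ} {φ′} {q} agree t {w} (tr eq s) = tr eq (SatC-mono t (δ q (KTree.lab t w)) (λ d q′ nd ment mem →
    ∈-setOf⁺ (subst (_⊨ˢ_ t (d ∷ w)) (agree q′ (transientC q _ eq q′ ment)) (∈-setOf⁻ mem))) s)
  correct-cong {φ} {φ′} agree t (ex refl eq wp) = ex refl eq (witness-cong {φ} {φ′} agree t wp)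
  correct-cong {φ} {φ′} agree t (un refl eq none) = un refl eq λ wp → none (witness-cong {φ′} {φ} (λ q lt → sym (agree q lt)) t wp)

  module _ (runs : ∀ φ (φ-in : ∀ q → InS (φ q)) i → (∀ q → comp q <ᶠ i → Good φ q) → kind i ≢ transient → RunsDefinable φ φ-in i) where

    Stage : ℕ → Set₁
    Stage k = Σ[ φ ∈ (Fin n → SF m) ] ((∀ q → InS (φ q)) × (∀ q → toℕ (comp q) < k → Good φ q))

    stage : ∀ k → Stage k
    stage zero = (λ _ → ⊤ˢ) , (λ _ → in-⊤) , λ _ ()
    stage (suc k) with stage k
    ... | φ , φ-in , good = φ′ , φ′-in , good′
      where
        build : ∀ q → toℕ (comp q) ≡ k → StateDefinable InS (λ (t , w) _ → Correct φ t w q)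
        build q refl = correct-definable φ φ-in q (runs φ φ-in (comp q) good)
        choose : ∀ q → Dec (toℕ (comp q) ≡ k) → SF m
        choose q (yes eq) = proj₁ (build q eq)
        choose q (no _) = φ q
        choose-in : ∀ q d → InS (choose q d)
        choose-in q (yes eq) = proj₁ (proj₂ (build q eq))
        choose-in q (no _) = φ-in q
        φ′ : Fin n → SF m
        φ′ q = choose q (toℕ (comp q) ℕₚ.≟ k)
        φ′-in : ∀ q → InS (φ′ q)
        φ′-in q = choose-in q (toℕ (comp q) ℕₚ.≟ k)
        agree : ∀ q → toℕ (comp q) < k → φ q ≡ φ′ q
        agree q lt with toℕ (comp q) ℕₚ.≟ k
        ... | yes eq = ⊥-elim (ℕₚ.<-irrefl eq lt)
        ... | no _ = refl
        good′ : ∀ q → toℕ (comp q) < suc k → Good φ′ q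
        good′ q lt t w nd = ⇔-trans (meaning (toℕ (comp q) ℕₚ.≟ k))
            (correct-cong {φ} {φ′} lower t , correct-cong {φ′} {φ} (λ q′ lt′ → sym (lower q′ lt′)) t)
          where
            lower : ∀ q′ → comp q′ <ᶠ comp q → φ q′ ≡ φ′ q′
            lower q′ lt′ = agree q′ (ℕₚ.≤-trans lt′ (s≤s⁻¹ lt))
            meaning : (d : Dec (toℕ (comp q) ≡ k)) → (_⊨ˢ_ t w (choose q d)) ⇔ Correct φ t w q
            meaning (yes eq) = proj₂ (proj₂ (build q eq)) (t , w) 0
            meaning (no ne) = good q (ℕₚ.≤∧≢⇒< (s≤s⁻¹ lt) ne) t w nd

    formula : Σ[ φ ∈ SF m ] (InS φ × SameLang φ gta)
    formula with stage c
    ... | φ , φ-in , good = φ q₀ , φ-in q₀ , λ t → to t , from t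
      where
        to : ∀ t → t ⊨ φ q₀ → Accepts gta t
        to t h = system⇒accepts (Canonical.system φ good t)
          (Canonical.pos q₀ [] (KTree.root t) (Finₚ.toℕ<n (comp q₀)) (proj₁ (good q₀ (Finₚ.toℕ<n (comp q₀)) t [] (KTree.root t)) h)) refl refl
        from : ∀ t → Accepts gta t → t ⊨ φ q₀
        from t acc = Complete.complete φ good (FromRun.system em acc (KTree.root t)) ([] , tt) (Finₚ.toℕ<n (comp q₀))

module DynamicCase (em : EM₀) {m n : ℕ} (H : HGTA m n) where
  open HGTA H
  open GTA gta
  open Hesitant em H
  open Construction em H (dynamic m (Symmetric H))
  open Matrices em (n * 2)

  runs : ∀ φ (φ-in : ∀ q → Fragment.InS (dynamic m (Symmetric H)) (φ q)) i →
         (∀ q → comp q <ᶠ i → Good φ q) → kind i ≢ transient → RunsDefinable φ φ-in i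
  runs φ φ-in i good nt = run-closed ded
      (TestAutomaton.dia em m (Symmetric H) finite-Mat _⊙_ one letter (letter-closed ded) (λ p k → _ , refl))
    where
      ded : ∀ q q′ → Definable (Fragment.InP (dynamic m (Symmetric H))) (edges-on-path φ φ-in i q q′)
      ded q q′ = path-definable (edge-definable φ φ-in i q q′)
      open BüchiDefinable em (definable-closed (dynamic m (Symmetric H))) (λ q → Recurring (kind i) (Ω q)) (edges-on-path φ φ-in i)

module TemporalCase (em : EM₀) {m n : ℕ} (H : HGTA m n) (cf : CounterFree H) where
  open Classical em
  open HGTA H
  open GTA gta
  open Hesitant em H
  open Construction em H (temporal m (Symmetric H))
  open Matrices em (n * 2)

  -- nothing is the letter read where no set of atoms of the component holds.
  Transition : Fin c → Maybe (Letter H) → Fin n → Fin n → Set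
  Transition i nothing q q′ = ⊥
  Transition i (just l) q q′ = LinTrans H i q l q′

  module _ {i : Fin c} where

    letters : ∀ {q ρ q′} → ListPath (Transition i) q ρ q′ → Σ[ σ ∈ List (Letter H) ] (ρ ≡ map just σ × LinPath H i q σ q′)
    letters nil = [] , refl , []
    letters (cons {l = just l} t p) = let (σ , eq , p′) = letters p in l ∷ σ , cong (just l ∷_) eq , t ∷ p′

    from-LinPath : ∀ {q σ q′} → LinPath H i q σ q′ → ListPath (Transition i) q (map just σ) q′
    from-LinPath [] = nil
    from-LinPath (t ∷ p) = cons t (from-LinPath p)

    map-concat-replicate : ∀ k (σ : List (Letter H)) → concat (replicate k (map just σ)) ≡ map just (concat (replicate k σ))
    map-concat-replicate zero σ = refl
    map-concat-replicate (suc k) σ = trans (cong (map just σ ++_) (map-concat-replicate k σ)) (sym (map-++ just σ _))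

    split-path : ∀ ρ {τ q q′} → ListPath (Transition i) q (ρ ++ τ) q′ → Σ[ s ∈ Fin n ] ListPath (Transition i) q ρ s
    split-path [] p = _ , nil
    split-path (l ∷ ρ) (cons t p) = let (s , p′) = split-path ρ p in s , cons t p′

    path-comp : ∀ {q l ρ q′} → ListPath (Transition i) q (l ∷ ρ) q′ → comp q ≡ i
    path-comp (cons {l = just _} (eq , _) _) = eq

    counter-free : kind i ≢ transient → ∀ k ρ {q} → ListPath (Transition i) q (concat (replicate (suc k) ρ)) q → ListPath (Transition i) q ρ q
    counter-free nt k [] p = nil
    counter-free nt k ρ@(_ ∷ _) {q} p with letters (proj₂ (split-path ρ p)) | letters p
    ... | σ , eq , _ | σ′ , eq′ , lp = subst (λ ρ → ListPath (Transition i) q ρ q) (sym eq)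
        (from-LinPath (proj₁ cf i nt q (path-comp p) k σ (subst (λ σ → LinPath H i q σ q) σ′≡ lp)))
      where
        σ′≡ : σ′ ≡ concat (replicate (suc k) σ)
        σ′≡ = map-injective just-injective (trans (sym eq′)
          (trans (cong (λ ρ → concat (replicate (suc k) ρ)) eq) (map-concat-replicate (suc k) σ)))

  module _ (φ : Fin n → SF m) (i : Fin c) (good : ∀ q → comp q <ᶠ i → Good φ q) (nt : kind i ≢ transient) where

    module _ (t : KTree m) (w : List (KTree.Dir t)) (nd : KTree.Node t w) where

      edge-LinTrans : ∀ {q q′} (e : Edge φ t i w q q′) → LinTrans H i q (KTree.lab t w , proj₁ (proj₂ e)) q′
      edge-LinTrans {q} {q′} (refl , As , mem , _) = by-kind (kind (comp q)) refl
        where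
          by-kind : ∀ κ → kind (comp q) ≡ κ → LinTrans H (comp q) q (KTree.lab t w , As) q′
          by-kind transient eq = ⊥-elim (nt eq)
          by-kind existential eq =
            refl , inj₁ (eq , _ , proj₁ (branches-existential q _ eq) , As , mem , (λ m → m) , (λ m → m))
          by-kind universal eq =
            refl , inj₂ (eq , _ , proj₁ (branches-universal q _ eq) , As , mem , (λ m → m) , (λ m → m))

      -- Two branches of the component that are both enabled have the same atoms, since complementary
      -- atoms cannot both hold (nor both fail).
      enabled-unique : ∀ {q q′ r r′} (e : Edge φ t i w q q′) (e′ : Edge φ t i w r r′) →
                       proj₁ (proj₂ e) ≈ˢ proj₁ (proj₂ e′)
      enabled-unique {q} {q′} {r} {r′} e@(_ , As , _ , ls) e′@(_ , Bs , _ , ls′) = dne λ ne →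
        let (x , y , x∈ , y∈ , compl) = proj₂ cf i nt As Bs (q , _ , q′ , edge-LinTrans e) (r , _ , r′ , edge-LinTrans e′) ne
            (acc⇒ , acc⇐) = compl (subtree t w nd)
            scope-x = All.lookup (proj₂ (edge-scope φ t e)) x∈
            scope-y = All.lookup (proj₂ (edge-scope φ t e′)) y∈
            module Cx = ConstraintAutomaton em H φ good x scope-x t w nd
            module Cy = ConstraintAutomaton em H φ good y scope-y t w nd
        in clash (kind i) (All.lookup ls x∈) (All.lookup ls′ y∈)
             (λ hx hy → acc⇒ (Cx.holds⇒accepts hx) (Cy.holds⇒accepts hy))
             (λ nx ny → nx (Cx.accepts⇒holds (acc⇐ (λ acc → ny (Cy.accepts⇒holds acc)))))
        where
          clash : ∀ κ {x y} → Literal φ t κ w x → Literal φ t κ w y →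
                  (Holds φ t w x → ¬ Holds φ t w y) → (¬ Holds φ t w x → ¬ ¬ Holds φ t w y) → ⊥
          clash transient hx hy f g = f hx hy
          clash existential hx hy f g = f hx hy
          clash universal nx ny f g = g nx ny

      LinTrans-edge : ∀ {q q′ As} → All (Literal φ t (kind i) w) As →
                      LinTrans H i q (KTree.lab t w , As) q′ → Edge φ t i w q q′
      LinTrans-edge {q} ls (refl , inj₁ (kd , L , eq , As′ , mem , (sub , _))) =
        refl , As′ , subst ((_ , As′) LM.∈_) (DisE-injective (trans (sym eq) (proj₁ (branches-existential q _ kd)))) mem ,
        All.tabulate (λ m → All.lookup ls (sub m))
      LinTrans-edge {q} ls (refl , inj₂ (kd , L , eq , As′ , mem , (sub , _))) =
        refl , As′ , subst ((_ , As′) LM.∈_) (ConU-injective (trans (sym eq) (proj₁ (branches-universal q _ kd)))) mem ,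
        All.tabulate (λ m → All.lookup ls (sub m))

      LinTrans-≈ : ∀ {q a As Bs q′} → As ≈ˢ Bs → LinTrans H i q (a , As) q′ → LinTrans H i q (a , Bs) q′
      LinTrans-≈ (f , g) (eq , inj₁ (kd , L , eq′ , As′ , mem , (f′ , g′))) =
        eq , inj₁ (kd , L , eq′ , As′ , mem , (λ m → f (f′ m)) , (λ m → g′ (g m)))
      LinTrans-≈ (f , g) (eq , inj₂ (kd , L , eq′ , As′ , mem , (f′ , g′))) =
        eq , inj₂ (kd , L , eq′ , As′ , mem , (λ m → f (f′ m)) , (λ m → g′ (g m)))

      node-letter : Σ[ l ∈ Maybe (Letter H) ] (∀ q q′ → Edge φ t i w q q′ ⇔ Transition i l q q′)
      node-letter with em {Σ[ q ∈ Fin n ] Σ[ q′ ∈ Fin n ] Edge φ t i w q q′}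
      ... | no none = nothing , λ q q′ → (λ e → none (q , q′ , e)) , ⊥-elim
      ... | yes (_ , _ , e₀@(_ , As , _ , ls)) = just (KTree.lab t w , As) , λ q q′ →
            (λ e → LinTrans-≈ (enabled-unique e e₀) (edge-LinTrans e)) , LinTrans-edge ls

  runs : ∀ φ (φ-in : ∀ q → Fragment.InS (temporal m (Symmetric H)) (φ q)) i →
         (∀ q → comp q <ᶠ i → Good φ q) → kind i ≢ transient → RunsDefinable φ φ-in i
  runs φ φ-in i good nt = run-closed ded (AperiodicDia.aperiodic-dia em (definable-closed (temporal m (Symmetric H)))
      (temporal-next m (Symmetric H)) (temporal-until m (Symmetric H)) finite-Mat
      transitionMonoid (letter-closed ded) (λ {x} {p} {k} → in-monoid {x} {p} {k}) (λ eq eq′ → trans (sym eq) eq′))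
    where
      F : Fin n → Set
      F q = Recurring (kind i) (Ω q)
      ded : ∀ q q′ → Definable (Fragment.InP (temporal m (Symmetric H))) (edges-on-path φ φ-in i q q′)
      ded q q′ = path-definable (edge-definable φ φ-in i q q′)
      open BüchiDefinable em (definable-closed (temporal m (Symmetric H))) F (edges-on-path φ φ-in i)
      open CounterFreeMonoid em F (Transition i) (counter-free nt)
      path-node : ∀ {t : KTree m} (ρ : IPath t) k → KTree.Node t (IPath.π ρ k)
      path-node ρ zero = IPath.π-ok ρ
      path-node ρ (suc k) = proj₂ (proj₂ (IPath.step ρ k))
      in-monoid : ∀ {x p k} → letter x p k → AperiodicMonoid.S transitionMonoid x
      in-monoid {p = t , ρ} {k} refl with node-letter φ i good nt t (IPath.π ρ k) (path-node ρ k)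
      ... | l , eqv = subst (AperiodicMonoid.S transitionMonoid) (Mat-ext λ a b →
              ⇔-trans (mat⁻ , mat⁺) (⇔-trans
                ((λ (u , fl) → proj₂ (eqv (Doubled.state F a) (Doubled.state F b)) u , fl) ,
                 (λ (u , fl) → proj₁ (eqv (Doubled.state F a) (Doubled.state F b)) u , fl)) (mat⁺ , mat⁻)))
              (∈-monoid l)

theorem9 : ExcludedMiddle (lsuc 0ℓ) → ∀ {m n : ℕ} →
    ((A : HGTA m n) →
    Σ[ φ ∈ SF m ] (IsCCDL φ × SameLang φ (HGTA.gta A) × (Symmetric A → IsCDL φ)))
    ×
    ((A : HGTA m n) → CounterFree A →
    Σ[ φ ∈ SF m ] (IsCCTL* φ × SameLang φ (HGTA.gta A) × (Symmetric A → IsCTL* φ)))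
theorem9 em₁ {m} =
  (λ A → let (φ , (dyn , sym) , lang) = Construction.formula em A (dynamic m (Symmetric A)) (DynamicCase.runs em A)
         in φ , dyn , lang , λ s → dyn , sym s) ,
  (λ A cf → let (φ , (tmp , sym) , lang) = Construction.formula em A (temporal m (Symmetric A)) (TemporalCase.runs em A cf)
            in φ , tmp , lang , λ s → tmp , sym s)
  where
    em : EM₀
    em {P} = map′ Level.lower Level.lift (em₁ {Level.Lift (lsuc 0ℓ) P})
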